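{- There is a function $f$ of two nonnegative real variables, satisfying $f(\lambda_1,\lambda_2)\le \lambda_1+\lambda_2+\lambda_2^2$ for all $\lambda_1,\lambda_2$ and $f(\lambda_1,\lambda_2)<1$ whenever $\lambda_1,\lambda_2<1$, such that the following holds. If $G_1$ is an $(N_1,D_1,\lambda_1)$-graph on $[N_1]$ and $G_2$ is a $(D_1,D_2,\lambda_2)$-graph on $[D_1]$, then their zig-zag product $G$ is an $(N_1\cdot D_1,\, D_2^2,\, f(\lambda_1,\lambda_2))$-graph. Moreover, $\mathrm{Rot}_{G}$ can be computed in time $\mathrm{poly}(\log N_1,\log D_1,\log D_2)$ with one oracle query to $\mathrm{Rot}_{G_1}$ and two oracle queries to $\mathrm{Rot}_{G_2}$.
   Context: For a positive integer $n$, $[n]=\{1,\dots,n\}$. Graphs are finite, undirected and regular, and may have self-loops and parallel edges. A $D$-regular graph $G$ on $[N]$ is specified by its rotation map $\mathrm{Rot}_G:[N]\times[D]\to[N]\times[D]$: $\mathrm{Rot}_G(v,i)=(w,j)$ means that the $i$-th edge incident to $v$ leads to $w$ and that this edge is the $j$-th edge incident to $w$. Thus $\mathrm{Rot}_G$ is a permutation with $\mathrm{Rot}_G\circ\mathrm{Rot}_G=\mathrm{id}$ (and any such involution specifies a $D$-regular graph). Vertex sets and sets of edge labels may be any finite sets of the right cardinality. The normalized adjacency matrix of $G$ is the symmetric $N\times N$ matrix with $M_{u,v}=\frac1D|\{(i,j)\in[D]^2:\mathrm{Rot}_G(u,i)=(v,j)\}|$. The second largest eigenvalue in absolute value is $\lambda(G)=\max_{\alpha\perp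 1_N,\,\alpha\ne0}\|M\alpha\|/\|\alpha\|$, where $1_N$ is the all-ones vector and the norm is Euclidean (with $\lambda(G)=0$ if $N=1$). An $(N,D,\lambda)$-graph is a $D$-regular graph on $N$ vertices with $\lambda(G)\le\lambda$. Zig-zag product: for a $D_1$-regular graph $G_1$ on $[N_1]$ and a $D_2$-regular graph $G_2$ on $[D_1]$, it is the $D_2^2$-regular graph on $[N_1]\times[D_1]$, with edge labels in $[D_2]\times[D_2]$, whose rotation map sends $((v,k),(i,j))$ to $((w,\ell),(j',i'))$, where $(k',i')=\mathrm{Rot}_{G_2}(k,i)$, then $(w,\ell')=\mathrm{Rot}_{G_1}(v,k')$, then $(\ell,j')=\mathrm{Rot}_{G_2}(\ell',j)$. Computation: $\mathrm{poly}(\cdot)$ denotes a fixed unspecified polynomial in its arguments. An algorithm with oracle access to a function may evaluate it on inputs of its choice at the cost of one time step per evaluation. One single algorithm, given the parameters as additional input, works for all graphs; the time and query counts are per evaluation of the rotation map. -}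

module Defs where

open import Data.Bool using (Bool; if_then_else_)
open import Data.Fin as Fin using (Fin; toℕ)
open import Data.Fin.Properties using (*↔×)
open import Data.Integer as ℤ using (+_)
open import Data.List using (List; []; _∷_; _++_; map; foldr; filter; length; allFin)
open import Data.Maybe using (Maybe; just; nothing)
open import Data.Nat as ℕ using (ℕ; zero; suc; NonZero)
open import Data.Nat.Logarithm using (⌊log₂_⌋)
import Data.Nat.Properties as ℕₚ
open import Data.Product using (Σ; ∃; _×_; _,_; proj₁; proj₂)
open import Data.Product.Function.NonDependent.Propositional using (_×-↔_)
open import Data.Product.Properties using (≡-dec)
open import Data.Rational as ℚ using (ℚ; 0ℚ; 1ℚ; ½; ∣_∣)
import Data.Rational.Properties as ℚₚ
open import Data.Rational.Solver using (module +-*-Solver)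
import Data.Rational.Unnormalised as ℚᵘ
import Data.Rational.Unnormalised.Properties as ℚᵘₚ
import Data.Integer.Properties as ℤₚ
open import Data.Sum using (inj₁; inj₂)
open import Data.Vec as Vec using (Vec; []; _∷_; lookup)
open import Function using (_↔_; Inverse)
open import Function.Construct.Composition using (_↔-∘_)
open import Function.Construct.Identity using (↔-id)
open import Function.Construct.Symmetry using (↔-sym)
open import Function.Properties.Inverse using (↔⇒↣)
open import Relation.Binary.Definitions using (DecidableEquality)
open import Relation.Binary.PropositionalEquality
open import Relation.Nullary using (¬_; Dec; does; yes; no)
open import Relation.Nullary.Decidable using (via-injection)
open import Relation.Nullary.Negation using (contradiction)

------------------------------------------------------------------------
-- Rational estimates

module Q where
  open import Data.Rational
  open import Data.Rational.Properties

  p≤∣p∣ : ∀ p → p ≤ ∣ p ∣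
  p≤∣p∣ p with ≤-total 0ℚ p
  ... | inj₁ 0≤p = ≤-reflexive (sym (0≤p⇒∣p∣≡p 0≤p))
  ... | inj₂ p≤0 = ≤-trans p≤0 (0≤∣p∣ p)

  p-q+q : ∀ p q → (p - q) + q ≡ p
  p-q+q = solve 2 (λ p q → (p :- q) :+ q := p) refl
    where open +-*-Solver

  p≤q+∣p-q∣ : ∀ p q → p ≤ q + ∣ p - q ∣
  p≤q+∣p-q∣ p q = begin
    p               ≡⟨ p-q+q p q ⟨
    (p - q) + q     ≤⟨ +-monoˡ-≤ q (p≤∣p∣ (p - q)) ⟩
    ∣ p - q ∣ + q   ≡⟨ +-comm ∣ p - q ∣ q ⟩
    q + ∣ p - q ∣   ∎
    where open ≤-Reasoning

  ∣∣-elim : ∀ {p q e} → ∣ p - q ∣ ≤ e → p ≤ q + e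
  ∣∣-elim {p} {q} h = ≤-trans (p≤q+∣p-q∣ p q) (+-monoʳ-≤ q h)

  p≤q+e⇒p-q≤e : ∀ {p q e} → p ≤ q + e → p - q ≤ e
  p≤q+e⇒p-q≤e {p} {q} {e} h = begin
    p - q         ≤⟨ +-monoˡ-≤ (- q) h ⟩
    (q + e) - q   ≡⟨ solve 2 (λ q e → (q :+ e) :- q := e) refl q e ⟩
    e             ∎
    where
    open ≤-Reasoning
    open +-*-Solver

  neg-swap : ∀ p q → - (p - q) ≡ q - p
  neg-swap = solve 2 (λ p q → :- (p :- q) := q :- p) refl
    where open +-*-Solver

  ∣∣-intro : ∀ {p q e} → p ≤ q + e → q ≤ p + e → ∣ p - q ∣ ≤ e
  ∣∣-intro {p} {q} {e} h k with ∣p∣≡p∨∣p∣≡-p (p - q)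
  ... | inj₁ eq = subst (_≤ e) (sym eq) (p≤q+e⇒p-q≤e h)
  ... | inj₂ eq = subst (_≤ e) (sym (trans eq (neg-swap p q))) (p≤q+e⇒p-q≤e k)

  *-mono-≤ : ∀ {p q r s} → 0ℚ ≤ r → 0ℚ ≤ q → p ≤ q → r ≤ s → p * r ≤ q * s
  *-mono-≤ {p} {q} {r} {s} 0≤r 0≤q p≤q r≤s = ≤-trans
    (*-monoʳ-≤-nonNeg r {{nonNegative 0≤r}} p≤q)
    (*-monoˡ-≤-nonNeg q {{nonNegative 0≤q}} r≤s)

  *-pos : ∀ {p q} → 0ℚ < p → 0ℚ < q → 0ℚ < p * q
  *-pos {p} {q} 0<p 0<q = subst (_< p * q) (*-zeroʳ p)
    (*-monoʳ-<-pos p {{positive 0<p}} 0<q)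

  0<½ : 0ℚ < ½
  0<½ = positive⁻¹ ½

  halves : ∀ e → e * ½ + e * ½ ≡ e
  halves e = trans (sym (*-distribˡ-+ e ½ ½)) (*-identityʳ e)

  +-nonNeg : ∀ {p q} → 0ℚ ≤ p → 0ℚ ≤ q → 0ℚ ≤ p + q
  +-nonNeg 0≤p 0≤q = +-mono-≤ 0≤p 0≤q

  +-pos : ∀ {p q} → 0ℚ ≤ p → 0ℚ < q → 0ℚ < p + q
  +-pos 0≤p 0<q = +-mono-≤-< 0≤p 0<q

  0<1 : 0ℚ < 1ℚ
  0<1 = positive⁻¹ 1ℚ

  split : ∀ {e} k → 0ℚ < e → 0ℚ < k → ∃ λ d → 0ℚ < d × k * d ≡ e
  split {e} k 0<e 0<k = d , 0<d , eq
    where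
    instance
      k-pos = positive 0<k
      k-nz  = pos⇒nonZero k
    d = e * 1/ k
    0<d : 0ℚ < d
    0<d = *-pos 0<e (positive⁻¹ (1/ k) {{1/pos⇒pos k}})
    eq : k * (e * 1/ k) ≡ e
    eq = begin
      k * (e * 1/ k)   ≡⟨ *-assoc k e (1/ k) ⟨
      k * e * 1/ k     ≡⟨ cong (_* 1/ k) (*-comm k e) ⟩
      e * k * 1/ k     ≡⟨ *-assoc e k (1/ k) ⟩
      e * (k * 1/ k)   ≡⟨ cong (e *_) (*-inverseʳ k) ⟩
      e * 1ℚ           ≡⟨ *-identityʳ e ⟩
      e                ∎
      where open ≡-Reasoning

------------------------------------------------------------------------
-- Rational approximations to square roots

-- bisect q n approximates √ q (for q ≥ 0) from below: after n halvings of
-- [0 , q + 1), the root lies in [bisect q n , bisect q n + width q n).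
width : ℚ → ℕ → ℚ
width q zero    = q ℚ.+ 1ℚ
width q (suc n) = width q n ℚ.* ½

bisect : ℚ → ℕ → ℚ
bisect q zero    = 0ℚ
bisect q (suc n) =
  let a = bisect q n
      b = a ℚ.+ width q (suc n)
  in if does (b ℚ.* b ℚ.≤? q) then b else a

module Bisection where
  open import Data.Rational
  open import Data.Rational.Properties
  open +-*-Solver using (solve; _:=_; _:+_; _:*_; :-_; _:-_; con)

  nat : ℕ → ℚ
  nat zero    = 0ℚ
  nat (suc n) = nat n + 1ℚ

  nat≃ : ∀ n → toℚᵘ (nat n) ℚᵘ.≃ ℚᵘ.mkℚᵘ (+ n) 0
  nat≃ zero    = ℚᵘₚ.≃-refl
  nat≃ (suc n) = ℚᵘₚ.≃-trans (toℚᵘ-homo-+ (nat n) 1ℚ)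
    (ℚᵘₚ.≃-trans (ℚᵘₚ.+-congˡ (toℚᵘ 1ℚ) (nat≃ n))
      (ℚᵘ.*≡* (cong (ℤ._* + 1)
        (trans (cong (ℤ._+ + 1) (ℤₚ.*-identityʳ (+ n))) (cong +_ (ℕₚ.+-comm n 1))))))

  archimedean : ∀ p → ∃ λ n → p ≤ nat n
  archimedean p@(mkℚ _ _ _) = n , toℚᵘ-cancel-≤ (ℚᵘₚ.≤-trans p≤n (ℚᵘₚ.≤-reflexive (ℚᵘₚ.≃-sym (nat≃ n))))
    where
    n = ℤ.∣ ↥ p ∣
    i≤∣i∣ : ∀ i → i ℤ.≤ + ℤ.∣ i ∣
    i≤∣i∣ (+ _)       = ℤₚ.≤-refl
    i≤∣i∣ (ℤ.-[1+ _ ]) = ℤ.-≤+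
    p≤n : toℚᵘ p ℚᵘ.≤ ℚᵘ.mkℚᵘ (+ n) 0
    p≤n = ℚᵘ.*≤* (ℤₚ.≤-trans
      (ℤₚ.≤-trans (ℤₚ.≤-reflexive (ℤₚ.*-identityʳ (↥ p))) (i≤∣i∣ (↥ p)))
      (subst (+ n ℤ.≤_) (ℤₚ.pos-* n (↧ₙ p)) (ℤ.+≤+ (ℕₚ.m≤m*n n (↧ₙ p)))))

  nat-nonNeg : ∀ n → 0ℚ ≤ nat n
  nat-nonNeg zero    = ≤-refl
  nat-nonNeg (suc n) = Q.+-nonNeg (nat-nonNeg n) (<⇒≤ Q.0<1)

  width-pos : ∀ {q} n → 0ℚ ≤ q → 0ℚ < width q n
  width-pos zero    0≤q = Q.+-pos 0≤q Q.0<1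
  width-pos (suc n) 0≤q = Q.*-pos (width-pos n 0≤q) Q.0<½

  width-mono : ∀ {p q} n → p ≤ q → width p n ≤ width q n
  width-mono zero    h = +-monoˡ-≤ 1ℚ h
  width-mono (suc n) h = *-monoʳ-≤-nonNeg ½ (width-mono n h)

  width-bound : ∀ {q} n → 0ℚ ≤ q → width q n * nat (suc n) ≤ q + 1ℚ
  width-bound {q} zero 0≤q = ≤-reflexive (*-identityʳ (q + 1ℚ))
  width-bound {q} (suc n) 0≤q = begin
    (w * ½) * ((k + 1ℚ) + 1ℚ)   ≤⟨ *-monoˡ-≤-nonNeg (w * ½) {{nonNegative (<⇒≤ (width-pos (suc n) 0≤q))}} le ⟩
    (w * ½) * ((k + 1ℚ) + (k + 1ℚ)) ≡⟨ eq w k ⟩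
    w * (k + 1ℚ)                ≤⟨ width-bound n 0≤q ⟩
    q + 1ℚ                      ∎
    where
    open ≤-Reasoning
    w = width q n
    k = nat n
    le : (k + 1ℚ) + 1ℚ ≤ (k + 1ℚ) + (k + 1ℚ)
    le = +-monoʳ-≤ (k + 1ℚ) (subst (_≤ k + 1ℚ) (+-identityˡ 1ℚ) (+-monoˡ-≤ 1ℚ (nat-nonNeg n)))
    eq : ∀ w k → (w * ½) * ((k + 1ℚ) + (k + 1ℚ)) ≡ w * (k + 1ℚ)
    eq = solve 2 (λ w k → (w :* con ½) :* ((k :+ con 1ℚ) :+ (k :+ con 1ℚ)) := w :* (k :+ con 1ℚ)) refl

  width-antitone : ∀ {q} m k → 0ℚ ≤ q → width q (k ℕ.+ m) ≤ width q m
  width-antitone m zero    0≤q = ≤-refl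
  width-antitone {q} m (suc k) 0≤q = ≤-trans half (width-antitone m k 0≤q)
    where
    w = width q (k ℕ.+ m)
    half : w * ½ ≤ w
    half = subst (w * ½ ≤_) (*-identityʳ w)
      (*-monoˡ-≤-nonNeg w {{nonNegative (<⇒≤ (width-pos (k ℕ.+ m) 0≤q))}} (≤ᵇ⇒≤ _))

  width-small : ∀ {q ε} → 0ℚ ≤ q → 0ℚ < ε → ∃ λ N → ∀ n → N ℕ.≤ n → width q n ≤ ε
  width-small {q} {ε} 0≤q 0<ε = N , λ n N≤n →
    subst (λ m → width q m ≤ ε) (ℕₚ.m∸n+n≡m N≤n)
      (≤-trans (width-antitone N (n ℕ.∸ N) 0≤q) at-N)
    where
    r : ∃ λ d → 0ℚ < d × ε * d ≡ q + 1ℚ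
    r = Q.split ε (Q.+-pos 0≤q Q.0<1) 0<ε
    arch = archimedean (proj₁ r)
    N = proj₁ arch
    sucN-pos : 0ℚ < nat (suc N)
    sucN-pos = Q.+-pos (nat-nonNeg N) Q.0<1
    at-N : width q N ≤ ε
    at-N = *-cancelʳ-≤-pos (nat (suc N)) {{positive sucN-pos}} (begin
      width q N * nat (suc N) ≤⟨ width-bound N 0≤q ⟩
      q + 1ℚ                  ≡⟨ proj₂ (proj₂ r) ⟨
      ε * proj₁ r             ≤⟨ *-monoˡ-≤-nonNeg ε {{nonNegative (<⇒≤ 0<ε)}} (≤-trans (proj₂ arch)
                                   (subst (_≤ nat (suc N)) (+-identityʳ (nat N)) (+-monoʳ-≤ (nat N) (<⇒≤ Q.0<1)))) ⟩
      ε * nat (suc N)         ∎)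
      where open ≤-Reasoning

  bisect-suc : ∀ q n (P : ℚ → Set) → let b = bisect q n + width q (suc n) in
    (b * b ≤ q → P b) → (q < b * b → P (bisect q n)) → P (bisect q (suc n))
  bisect-suc q n P y f = if-elim (b * b ≤? q)
    where
    b = bisect q n + width q (suc n)
    if-elim : (d : Dec (b * b ≤ q)) → P (if does d then b else bisect q n)
    if-elim (yes h) = y h
    if-elim (no h)  = f (≰⇒> h)

  bisect-nonNeg : ∀ q n → 0ℚ ≤ q → 0ℚ ≤ bisect q n
  bisect-nonNeg q zero    0≤q = ≤-refl
  bisect-nonNeg q (suc n) 0≤q = bisect-suc q n (0ℚ ≤_)
    (λ _ → Q.+-nonNeg {bisect q n} {width q (suc n)}
             (bisect-nonNeg q n 0≤q) (<⇒≤ (width-pos (suc n) 0≤q)))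
    (λ _ → bisect-nonNeg q n 0≤q)

  bisect-lower : ∀ q n → 0ℚ ≤ q → bisect q n * bisect q n ≤ q
  bisect-lower q zero    0≤q = 0≤q
  bisect-lower q (suc n) 0≤q = bisect-suc q n (λ c → c * c ≤ q)
    (λ h → h) (λ _ → bisect-lower q n 0≤q)

  bisect-upper : ∀ q n → 0ℚ ≤ q →
    q < (bisect q n + width q n) * (bisect q n + width q n)
  bisect-upper q zero 0≤q = begin-strict
    q                                 ≡⟨ +-identityʳ q ⟨
    q + 0ℚ                            <⟨ +-monoʳ-< q (Q.+-pos {q * q} 0≤q² (Q.+-pos 0≤q Q.0<1)) ⟩
    q + (q * q + (q + 1ℚ))            ≡⟨ eq q ⟩
    (0ℚ + (q + 1ℚ)) * (0ℚ + (q + 1ℚ)) ∎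
    where
    open ≤-Reasoning
    0≤q² : 0ℚ ≤ q * q
    0≤q² = Q.*-mono-≤ {0ℚ} {q} {0ℚ} {q} ≤-refl 0≤q 0≤q 0≤q
    eq : ∀ q → q + (q * q + (q + 1ℚ)) ≡ (0ℚ + (q + 1ℚ)) * (0ℚ + (q + 1ℚ))
    eq = solve 1 (λ q → q :+ (q :* q :+ (q :+ con 1ℚ))
           := (con 0ℚ :+ (q :+ con 1ℚ)) :* (con 0ℚ :+ (q :+ con 1ℚ))) refl
  bisect-upper q (suc n) 0≤q =
    bisect-suc q n (λ c → q < (c + width q (suc n)) * (c + width q (suc n)))
      (λ _ → subst (λ c → q < c * c) (sym eq) (bisect-upper q n 0≤q))
      (λ h → h)
    where
    eq : (bisect q n + width q n * ½) + width q n * ½ ≡ bisect q n + width q n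
    eq = trans (+-assoc (bisect q n) (width q n * ½) (width q n * ½))
               (cong (λ c → bisect q n + c) (Q.halves (width q n)))

  -- If the bisection of q is within ε/2 of √ q, then raising q by at most
  -- (ε/2)² raises the lower approximation to the root by at most ε.
  close : ∀ p q ε m n → 0ℚ ≤ p → 0ℚ ≤ q → 0ℚ < ε →
    width q n ≤ ε * ½ → p ≤ q + (ε * ½) * (ε * ½) → bisect p m ≤ bisect q n + ε
  close p q ε m n 0≤p 0≤q 0<ε w≤ p≤ with bisect p m ≤? bisect q n + ε
  ... | yes h = h
  ... | no  h = contradiction chain (<-irrefl refl)
    where
    open ≤-Reasoning
    a = bisect p m
    b = bisect q n
    w = width q n
    e = ε * ½
    0≤b = bisect-nonNeg q n 0≤q
    0≤e : 0ℚ ≤ e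
    0≤e = <⇒≤ (Q.*-pos 0<ε Q.0<½)
    b+e+e≤a : (b + e) + e ≤ a
    b+e+e≤a = ≤-trans
      (≤-reflexive (trans (+-assoc b e e) (cong (λ c → b + c) (Q.halves ε))))
      (<⇒≤ (≰⇒> h))
    b+w≤b+e : b + w ≤ b + e
    b+w≤b+e = +-monoʳ-≤ b w≤
    0≤b+w = Q.+-nonNeg {b} {w} 0≤b (<⇒≤ (width-pos n 0≤q))
    0≤b+e = Q.+-nonNeg {b} {e} 0≤b 0≤e
    0≤b+e+e = Q.+-nonNeg {b + e} {e} 0≤b+e 0≤e
    extra : 0ℚ ≤ (b + e) * e + (b + e) * e
    extra = Q.+-nonNeg {(b + e) * e} {(b + e) * e} 0≤be 0≤be
      where 0≤be = Q.*-mono-≤ {0ℚ} {b + e} {0ℚ} {e} ≤-refl 0≤b+e 0≤b+e 0≤e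
    expand : ∀ c e → (c * c + e * e) + (c * e + c * e) ≡ (c + e) * (c + e)
    expand = solve 2 (λ c e → (c :* c :+ e :* e) :+ (c :* e :+ c :* e) := (c :+ e) :* (c :+ e)) refl
    chain : p < p
    chain = begin-strict
      p                                       ≤⟨ p≤ ⟩
      q + e * e                               <⟨ +-monoˡ-< (e * e) (bisect-upper q n 0≤q) ⟩
      (b + w) * (b + w) + e * e               ≤⟨ +-monoˡ-≤ (e * e) (Q.*-mono-≤ {b + w} {b + e} {b + w} {b + e} 0≤b+w 0≤b+e b+w≤b+e b+w≤b+e) ⟩
      (b + e) * (b + e) + e * e               ≡⟨ +-identityʳ _ ⟨
      ((b + e) * (b + e) + e * e) + 0ℚ        ≤⟨ +-monoʳ-≤ ((b + e) * (b + e) + e * e) extra ⟩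
      ((b + e) * (b + e) + e * e) + ((b + e) * e + (b + e) * e)
                                              ≡⟨ expand (b + e) e ⟩
      ((b + e) + e) * ((b + e) + e)           ≤⟨ Q.*-mono-≤ {(b + e) + e} {a} {(b + e) + e} {a} 0≤b+e+e (bisect-nonNeg p m 0≤p) b+e+e≤a b+e+e≤a ⟩
      a * a                                   ≤⟨ bisect-lower p m 0≤p ⟩
      p                                       ∎

  ⊔0-mono : ∀ {p q d} → 0ℚ ≤ d → p ≤ q + d → p ⊔ 0ℚ ≤ q ⊔ 0ℚ + d
  ⊔0-mono {p} {q} {d} 0≤d h = ⊔-lub
    (≤-trans h (+-monoˡ-≤ d (p≤p⊔q q 0ℚ)))
    (Q.+-nonNeg (p≤q⊔p q 0ℚ) 0≤d)

------------------------------------------------------------------------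
-- Real numbers: Cauchy sequences of rationals up to _≈_

Cauchy : (ℕ → ℚ) → Set
Cauchy x = ∀ ε → 0ℚ ℚ.< ε →
  ∃ λ N → ∀ m n → N ℕ.≤ m → N ℕ.≤ n → ∣ x m ℚ.- x n ∣ ℚ.≤ ε

record ℝ : Set where
  constructor mkℝ
  field
    seq    : ℕ → ℚ
    cauchy : Cauchy seq

open ℝ public

infix  4 _≈_ _≤_ _<_
infixl 6 _+_
infixl 7 _*_

_≈_ : ℝ → ℝ → Set
x ≈ y = ∀ ε → 0ℚ ℚ.< ε →
  ∃ λ N → ∀ n → N ℕ.≤ n → ∣ seq x n ℚ.- seq y n ∣ ℚ.≤ ε

_≤_ : ℝ → ℝ → Set
x ≤ y = ∀ ε → 0ℚ ℚ.< ε →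
  ∃ λ N → ∀ n → N ℕ.≤ n → seq x n ℚ.≤ seq y n ℚ.+ ε

_<_ : ℝ → ℝ → Set
x < y = ∃ λ ε → 0ℚ ℚ.< ε ×
  ∃ λ N → ∀ n → N ℕ.≤ n → seq x n ℚ.+ ε ℚ.≤ seq y n

fromℚ : ℚ → ℝ
fromℚ q = mkℝ (λ _ → q) λ ε 0<ε → 0 , λ _ _ _ _ →
  subst (λ r → ∣ r ∣ ℚ.≤ ε) (sym (ℚₚ.+-inverseʳ q)) (ℚₚ.<⇒≤ 0<ε)

0ℝ 1ℝ : ℝ
0ℝ = fromℚ 0ℚ
1ℝ = fromℚ 1ℚ

_+_ : ℝ → ℝ → ℝ
x + y = mkℝ (λ n → seq x n ℚ.+ seq y n) λ ε 0<ε →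
  let 0<ε/2   = Q.*-pos 0<ε Q.0<½
      N₁ , h₁ = cauchy x (ε ℚ.* ½) 0<ε/2
      N₂ , h₂ = cauchy y (ε ℚ.* ½) 0<ε/2
  in N₁ ℕ.⊔ N₂ , λ m n N≤m N≤n →
     bound ε m n
       (h₁ m n (ℕₚ.m⊔n≤o⇒m≤o N₁ N₂ N≤m) (ℕₚ.m⊔n≤o⇒m≤o N₁ N₂ N≤n))
       (h₂ m n (ℕₚ.m⊔n≤o⇒n≤o N₁ N₂ N≤m) (ℕₚ.m⊔n≤o⇒n≤o N₁ N₂ N≤n))
  where
  bound : ∀ ε m n → ∣ seq x m ℚ.- seq x n ∣ ℚ.≤ ε ℚ.* ½ →
          ∣ seq y m ℚ.- seq y n ∣ ℚ.≤ ε ℚ.* ½ →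
          ∣ (seq x m ℚ.+ seq y m) ℚ.- (seq x n ℚ.+ seq y n) ∣ ℚ.≤ ε
  bound ε m n p q = begin
    ∣ (a ℚ.+ b) ℚ.- (c ℚ.+ d) ∣      ≡⟨ cong ∣_∣ (rearrange a b c d) ⟩
    ∣ (a ℚ.- c) ℚ.+ (b ℚ.- d) ∣      ≤⟨ ℚₚ.∣p+q∣≤∣p∣+∣q∣ (a ℚ.- c) (b ℚ.- d) ⟩
    ∣ a ℚ.- c ∣ ℚ.+ ∣ b ℚ.- d ∣      ≤⟨ ℚₚ.+-mono-≤ p q ⟩
    ε ℚ.* ½ ℚ.+ ε ℚ.* ½              ≡⟨ Q.halves ε ⟩
    ε                                ∎
    where
    open ℚₚ.≤-Reasoning
    a = seq x m
    b = seq y m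
    c = seq x n
    d = seq y n
    rearrange : ∀ a b c d → (a ℚ.+ b) ℚ.- (c ℚ.+ d) ≡ (a ℚ.- c) ℚ.+ (b ℚ.- d)
    rearrange = solve 4 (λ a b c d → (a :+ b) :- (c :+ d) := (a :- c) :+ (b :- d)) refl
      where open +-*-Solver

bounded : ∀ x → ∃ λ B → 0ℚ ℚ.< B × ∃ λ N → ∀ n → N ℕ.≤ n → ∣ seq x n ∣ ℚ.≤ B
bounded x =
  let N , h = cauchy x 1ℚ Q.0<1
  in ∣ seq x N ∣ ℚ.+ 1ℚ , Q.+-pos (ℚₚ.0≤∣p∣ (seq x N)) Q.0<1 , N , λ n N≤n →
     bound N n (h n N N≤n ℕₚ.≤-refl)
  where
  bound : ∀ N n → ∣ seq x n ℚ.- seq x N ∣ ℚ.≤ 1ℚ → ∣ seq x n ∣ ℚ.≤ ∣ seq x N ∣ ℚ.+ 1ℚ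
  bound N n h = begin
    ∣ a ∣                        ≡⟨ cong ∣_∣ (Q.p-q+q a b) ⟨
    ∣ (a ℚ.- b) ℚ.+ b ∣          ≤⟨ ℚₚ.∣p+q∣≤∣p∣+∣q∣ (a ℚ.- b) b ⟩
    ∣ a ℚ.- b ∣ ℚ.+ ∣ b ∣        ≤⟨ ℚₚ.+-monoˡ-≤ ∣ b ∣ h ⟩
    1ℚ ℚ.+ ∣ b ∣                 ≡⟨ ℚₚ.+-comm 1ℚ ∣ b ∣ ⟩
    ∣ b ∣ ℚ.+ 1ℚ                 ∎
    where
    open ℚₚ.≤-Reasoning
    a = seq x n
    b = seq x N

_*_ : ℝ → ℝ → ℝ
x * y = mkℝ (λ n → seq x n ℚ.* seq y n) λ ε 0<ε →
  let A , 0<A , Nx , hx = bounded x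
      B , 0<B , Ny , hy = bounded y
      δ , 0<δ , eq      = Q.split (A ℚ.+ B) 0<ε (Q.+-pos (ℚₚ.<⇒≤ 0<A) 0<B)
      N₁ , h₁           = cauchy x δ 0<δ
      N₂ , h₂           = cauchy y δ 0<δ
      M = (Nx ℕ.⊔ Ny) ℕ.⊔ (N₁ ℕ.⊔ N₂)
      Nx≤ = λ {n} (h : M ℕ.≤ n) → ℕₚ.m⊔n≤o⇒m≤o Nx Ny (ℕₚ.m⊔n≤o⇒m≤o (Nx ℕ.⊔ Ny) (N₁ ℕ.⊔ N₂) h)
      Ny≤ = λ {n} (h : M ℕ.≤ n) → ℕₚ.m⊔n≤o⇒n≤o Nx Ny (ℕₚ.m⊔n≤o⇒m≤o (Nx ℕ.⊔ Ny) (N₁ ℕ.⊔ N₂) h)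
      N₁≤ = λ {n} (h : M ℕ.≤ n) → ℕₚ.m⊔n≤o⇒m≤o N₁ N₂ (ℕₚ.m⊔n≤o⇒n≤o (Nx ℕ.⊔ Ny) (N₁ ℕ.⊔ N₂) h)
      N₂≤ = λ {n} (h : M ℕ.≤ n) → ℕₚ.m⊔n≤o⇒n≤o N₁ N₂ (ℕₚ.m⊔n≤o⇒n≤o (Nx ℕ.⊔ Ny) (N₁ ℕ.⊔ N₂) h)
  in M , λ m n M≤m M≤n →
     subst (∣ seq x m ℚ.* seq y m ℚ.- seq x n ℚ.* seq y n ∣ ℚ.≤_) eq
       (bound m n A B δ 0<A
         (hx m (Nx≤ M≤m)) (hy n (Ny≤ M≤n))
         (h₁ m n (N₁≤ M≤m) (N₁≤ M≤n)) (h₂ m n (N₂≤ M≤m) (N₂≤ M≤n)) (ℚₚ.<⇒≤ 0<δ))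
  where
  bound : ∀ m n A B δ → 0ℚ ℚ.< A → ∣ seq x m ∣ ℚ.≤ A → ∣ seq y n ∣ ℚ.≤ B →
          ∣ seq x m ℚ.- seq x n ∣ ℚ.≤ δ → ∣ seq y m ℚ.- seq y n ∣ ℚ.≤ δ → 0ℚ ℚ.≤ δ →
          ∣ seq x m ℚ.* seq y m ℚ.- seq x n ℚ.* seq y n ∣ ℚ.≤ (A ℚ.+ B) ℚ.* δ
  bound m n A B δ 0<A a≤A d≤B ac bd 0≤δ = begin
    ∣ a ℚ.* b ℚ.- c ℚ.* d ∣
      ≡⟨ cong ∣_∣ (rearrange a b c d) ⟩
    ∣ a ℚ.* (b ℚ.- d) ℚ.+ d ℚ.* (a ℚ.- c) ∣
      ≤⟨ ℚₚ.∣p+q∣≤∣p∣+∣q∣ (a ℚ.* (b ℚ.- d)) (d ℚ.* (a ℚ.- c)) ⟩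
    ∣ a ℚ.* (b ℚ.- d) ∣ ℚ.+ ∣ d ℚ.* (a ℚ.- c) ∣
      ≡⟨ cong₂ ℚ._+_ (ℚₚ.∣p*q∣≡∣p∣*∣q∣ a (b ℚ.- d)) (ℚₚ.∣p*q∣≡∣p∣*∣q∣ d (a ℚ.- c)) ⟩
    ∣ a ∣ ℚ.* ∣ b ℚ.- d ∣ ℚ.+ ∣ d ∣ ℚ.* ∣ a ℚ.- c ∣
      ≤⟨ ℚₚ.+-mono-≤
           (Q.*-mono-≤ (ℚₚ.0≤∣p∣ (b ℚ.- d)) (ℚₚ.<⇒≤ 0<A) a≤A bd)
           (Q.*-mono-≤ (ℚₚ.0≤∣p∣ (a ℚ.- c)) (ℚₚ.≤-trans (ℚₚ.0≤∣p∣ d) d≤B) d≤B ac) ⟩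
    A ℚ.* δ ℚ.+ B ℚ.* δ
      ≡⟨ ℚₚ.*-distribʳ-+ δ A B ⟨
    (A ℚ.+ B) ℚ.* δ
      ∎
    where
    open ℚₚ.≤-Reasoning
    a = seq x m
    b = seq y m
    c = seq x n
    d = seq y n
    rearrange : ∀ a b c d →
      a ℚ.* b ℚ.- c ℚ.* d ≡ a ℚ.* (b ℚ.- d) ℚ.+ d ℚ.* (a ℚ.- c)
    rearrange = solve 4 (λ a b c d →
      a :* b :- c :* d := a :* (b :- d) :+ d :* (a :- c)) refl
      where open +-*-Solver

-- For negative x this is the root of 0.
√_ : ℝ → ℝ
√ x = mkℝ (λ n → bisect (seq x n ℚ.⊔ 0ℚ) n) λ ε 0<ε →
  let 0<e           = Q.*-pos 0<ε Q.0<½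
      0<d           = Q.*-pos 0<e 0<e
      B , 0<B , N₁ , hB = bounded x
      N₂ , hw       = Bisection.width-small (ℚₚ.<⇒≤ 0<B) 0<e
      N₃ , hx       = cauchy x ((ε ℚ.* ½) ℚ.* (ε ℚ.* ½)) 0<d
      N₁≤ = λ {n} (h : N₁ ℕ.⊔ (N₂ ℕ.⊔ N₃) ℕ.≤ n) → ℕₚ.m⊔n≤o⇒m≤o N₁ (N₂ ℕ.⊔ N₃) h
      N₂≤ = λ {n} (h : N₁ ℕ.⊔ (N₂ ℕ.⊔ N₃) ℕ.≤ n) → ℕₚ.m⊔n≤o⇒m≤o N₂ N₃ (ℕₚ.m⊔n≤o⇒n≤o N₁ (N₂ ℕ.⊔ N₃) h)
      N₃≤ = λ {n} (h : N₁ ℕ.⊔ (N₂ ℕ.⊔ N₃) ℕ.≤ n) → ℕₚ.m⊔n≤o⇒n≤o N₂ N₃ (ℕₚ.m⊔n≤o⇒n≤o N₁ (N₂ ℕ.⊔ N₃) h)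
      half = λ m n (M≤m : N₁ ℕ.⊔ (N₂ ℕ.⊔ N₃) ℕ.≤ m) (M≤n : N₁ ℕ.⊔ (N₂ ℕ.⊔ N₃) ℕ.≤ n) →
        Bisection.close (seq x m ℚ.⊔ 0ℚ) (seq x n ℚ.⊔ 0ℚ) ε m n (ℚₚ.p≤q⊔p (seq x m) 0ℚ) (ℚₚ.p≤q⊔p (seq x n) 0ℚ) 0<ε
          (ℚₚ.≤-trans
            (Bisection.width-mono n (ℚₚ.⊔-lub
              (ℚₚ.≤-trans (Q.p≤∣p∣ (seq x n)) (hB n (N₁≤ M≤n))) (ℚₚ.<⇒≤ 0<B)))
            (hw n (N₂≤ M≤n)))
          (Bisection.⊔0-mono {seq x m} {seq x n} (ℚₚ.<⇒≤ 0<d) (Q.∣∣-elim (hx m n (N₃≤ M≤m) (N₃≤ M≤n))))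
  in N₁ ℕ.⊔ (N₂ ℕ.⊔ N₃) , λ m n M≤m M≤n → Q.∣∣-intro (half m n M≤m M≤n) (half n m M≤n M≤m)

ℝ≥0 : Set
ℝ≥0 = ∃ λ (x : ℝ) → 0ℝ ≤ x

⟨_⟩ : ℝ≥0 → ℝ
⟨ x ⟩ = proj₁ x

------------------------------------------------------------------------
-- Nonempty finite sets

record FinSet : Set₁ where
  field
    Carrier : Set
    size    : ℕ
    nonZero : NonZero size
    enum    : Carrier ↔ Fin size

  elements : List Carrier
  elements = map (Inverse.from enum) (allFin size)

  _≟_ : DecidableEquality Carrier
  _≟_ = via-injection (↔⇒↣ enum) Fin._≟_

open FinSet public using (Carrier; size; elements)

[1⋯_] : (n : ℕ) {{_ : NonZero n}} → FinSet
[1⋯ n ] {{n≢0}} = record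
  { Carrier = Fin n ; size = n ; nonZero = n≢0 ; enum = ↔-id (Fin n) }

infixr 2 _⊗_

_⊗_ : FinSet → FinSet → FinSet
A ⊗ B = record
  { Carrier = Carrier A × Carrier B
  ; size    = size A ℕ.* size B
  ; nonZero = ℕₚ.m*n≢0 (size A) (size B) {{FinSet.nonZero A}} {{FinSet.nonZero B}}
  ; enum    = ↔-sym *↔× ↔-∘ (FinSet.enum A ×-↔ FinSet.enum B)
  }

∑ : (A : FinSet) → (Carrier A → ℝ) → ℝ
∑ A f = foldr _+_ 0ℝ (map f (elements A))

count : (A : FinSet) {P : Carrier A → Set} → (∀ a → Dec (P a)) → ℕ
count A P? = length (filter P? (elements A))

------------------------------------------------------------------------
-- Regular graphs, given by their rotation maps

record Graph (V L : FinSet) : Set where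
  field
    rot            : Carrier V × Carrier L → Carrier V × Carrier L
    rot-involutive : ∀ x → rot (rot x) ≡ x

open Graph public

module _ {V L : FinSet} (G : Graph V L) where

  Edge : Carrier V → Carrier V → Carrier (L ⊗ L) → Set
  Edge u v (i , j) = rot G (u , i) ≡ (v , j)

  edge? : ∀ u v e → Dec (Edge u v e)
  edge? u v (i , j) = ≡-dec (FinSet._≟_ V) (FinSet._≟_ L) (rot G (u , i)) (v , j)

  adjacency : Carrier V → Carrier V → ℚ
  adjacency u v = ((+ count (L ⊗ L) (edge? u v)) ℚ./ size L) {{FinSet.nonZero L}}

  _·_ : (Carrier V → ℝ) → (Carrier V → ℝ)
  _·_ α u = ∑ V λ v → fromℚ (adjacency u v) * α v

⟪_,_⟫ : {V : FinSet} → (Carrier V → ℝ) → (Carrier V → ℝ) → ℝ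
⟪_,_⟫ {V} α β = ∑ V λ v → α v * β v

‖_‖ : {V : FinSet} → (Carrier V → ℝ) → ℝ
‖_‖ {V} α = √ ⟪_,_⟫ {V} α α

-- λ(G) ≤ c, where λ(G) is the maximum of ‖Mα‖/‖α‖ over nonzero α ⊥ 1, or 0
-- if there is no such α.  Constructively the maximum itself need not be
-- attained, so it is bounded through the quotients, denominators cleared.
-- As a maximum of nonnegative numbers λ(G) is nonnegative, whence 0 ≤ c.
λ[_]≤_ : {V L : FinSet} → Graph V L → ℝ → Set
λ[_]≤_ {V} G c =
  0ℝ ≤ c ×
  (∀ (α : Carrier V → ℝ) →
     ⟪_,_⟫ {V} α (λ _ → 1ℝ) ≈ 0ℝ →
     ¬ (∀ v → α v ≈ 0ℝ) →
     ‖_‖ {V} (G · α) ≤ c * ‖_‖ {V} α)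

_is⟨_,_,_⟩-graph : {V L : FinSet} → Graph V L → ℕ → ℕ → ℝ → Set
_is⟨_,_,_⟩-graph {V} {L} G N D c = size V ≡ N × size L ≡ D × λ[ G ]≤ c

module _ {V K L : FinSet} (G₁ : Graph V K) (G₂ : Graph K L) where

  zigzagRot : Carrier (V ⊗ K) × Carrier (L ⊗ L) → Carrier (V ⊗ K) × Carrier (L ⊗ L)
  zigzagRot ((v , k) , (i , j)) =
    let (k′ , i′) = rot G₂ (k , i)
        (w  , ℓ′) = rot G₁ (v , k′)
        (ℓ  , j′) = rot G₂ (ℓ′ , j)
    in (w , ℓ) , (j′ , i′)

  zigzagRot-involutive : ∀ x → zigzagRot (zigzagRot x) ≡ x
  zigzagRot-involutive ((v , k) , (i , j))
    rewrite rot-involutive G₂ (proj₂ (rot G₁ (v , proj₁ (rot G₂ (k , i)))) , j)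
          | rot-involutive G₁ (v , proj₁ (rot G₂ (k , i)))
          | rot-involutive G₂ (k , i)
    = refl

  _ⓩ_ : Graph (V ⊗ K) (L ⊗ L)
  _ⓩ_ = record { rot = zigzagRot ; rot-involutive = zigzagRot-involutive }

------------------------------------------------------------------------
-- Deterministic multitape Turing machines with two oracles

data Letter : Set where
  bit : Bool → Letter
  #   : Letter

String : Set
String = List Letter

-- nothing is the blank.
Symbol : Set
Symbol = Maybe Letter

data Move : Set where
  left stay right : Move

-- The cells to the left of the head are listed nearest first; all cells
-- beyond the two lists are blank.
record Tape : Set where
  constructor tape
  field
    before : List Symbol
    here   : Symbol
    after  : List Symbol

pop : List Symbol → Symbol × List Symbol
pop []       = nothing , []
pop (s ∷ ss) = s , ss

act : Symbol × Move → Tape → Tape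
act (s , left)  (tape ls _ rs) = let (h , ls′) = pop ls in tape ls′ h (s ∷ rs)
act (s , stay)  (tape ls _ rs) = tape ls s rs
act (s , right) (tape ls _ rs) = let (h , rs′) = pop rs in tape (s ∷ ls) h rs′

-- A string is written rightwards from the head, and read from the head up to
-- the first blank.
write : String → Tape
write []       = tape [] nothing []
write (a ∷ as) = tape [] (just a) (map just as)

upToBlank : List Symbol → String
upToBlank []             = []
upToBlank (nothing ∷ _)  = []
upToBlank (just a  ∷ ss) = a ∷ upToBlank ss

read : Tape → String
read (tape _ h rs) = upToBlank (h ∷ rs)

data Oracle : Set where
  oracle₁ oracle₂ : Oracle

data Action (states tapes : ℕ) : Set where
  halt  : Action states tapes
  step  : Fin states → Vec (Symbol × Move) tapes → Action states tapes
  query : Oracle → Fin states → Action states tapes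

-- The input, output and query tapes come first, followed by the work tapes.
record Machine : Set where
  field
    states    : ℕ
    workTapes : ℕ

  tapes : ℕ
  tapes = 3 ℕ.+ workTapes

  field
    start : Fin states
    δ     : Fin states → Vec Symbol tapes → Action states tapes

module _ (M : Machine) (O : Oracle → String → String) where
  open Machine M

  Tapes : Set
  Tapes = Vec Tape tapes

  scan : Tapes → Vec Symbol tapes
  scan = Vec.map Tape.here

  initial : String → Tapes
  initial x = write x ∷ Vec.replicate (2 ℕ.+ workTapes) (write [])

  output : Tapes → String
  output (_ ∷ out ∷ _) = read out

  -- The content of the query tape is replaced by the oracle's answer.
  ask : Oracle → Tapes → Tapes
  ask o (inp ∷ out ∷ qry ∷ wrk) = inp ∷ out ∷ write (O o (read qry)) ∷ wrk

  -- Halts s τ t a b y: from state s and tapes τ the machine halts after t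
  -- steps, among them a queries to oracle₁ and b queries to oracle₂, with
  -- output y.
  data Halts : Fin states → Tapes → ℕ → ℕ → ℕ → String → Set where
    halts : ∀ {s τ} → δ s (scan τ) ≡ halt → Halts s τ 0 0 0 (output τ)
    steps : ∀ {s τ s′ as t a b y} → δ s (scan τ) ≡ step s′ as →
            Halts s′ (Vec.zipWith act as τ) t a b y →
            Halts s τ (suc t) a b y
    asks₁ : ∀ {s τ s′ t a b y} → δ s (scan τ) ≡ query oracle₁ s′ →
            Halts s′ (ask oracle₁ τ) t a b y →
            Halts s τ (suc t) (suc a) b y
    asks₂ : ∀ {s τ s′ t a b y} → δ s (scan τ) ≡ query oracle₂ s′ →
            Halts s′ (ask oracle₂ τ) t a b y →
            Halts s τ (suc t) a (suc b) y

  -- On input x the machine outputs y within T steps, making a queries to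
  -- oracle₁ and b queries to oracle₂.
  Computes : (x y : String) (T a b : ℕ) → Set
  Computes x y T a b =
    ∃ λ t → t ℕ.≤ T × Halts start (initial x) t a b y

-- The w least significant binary digits of n, least significant first.
bits : ℕ → ℕ → String
bits zero    n = []
bits (suc w) n = bit (n ℕ.% 2 ℕ.≡ᵇ 1) ∷ bits w (n ℕ./ 2)

-- n ≤ N in binary, padded to the length of the binary expansion of N.
numeral : ℕ → ℕ → String
numeral N n = bits (suc ⌊log₂ N ⌋) n ++ # ∷ []

-- An element of [1⋯ N ] is represented by its index in {0,…,N-1}.
vertex : ∀ {N} → Fin N → String
vertex {N} v = numeral N (toℕ v)

pair : ∀ {M N} → Fin M × Fin N → String
pair (x , y) = vertex x ++ vertex y

-- Nothing is required of f on strings that do not represent a pair.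
_represents_ : ∀ {N D} {{_ : NonZero N}} {{_ : NonZero D}} →
               (String → String) → Graph [1⋯ N ] [1⋯ D ] → Set
f represents G = ∀ x → f (pair x) ≡ pair (rot G x)

data Polynomial (n : ℕ) : Set where
  con       : ℕ → Polynomial n
  var       : Fin n → Polynomial n
  _:+_ _:*_ : Polynomial n → Polynomial n → Polynomial n

eval : ∀ {n} → Polynomial n → Vec ℕ n → ℕ
eval (con c)  ρ = c
eval (var x)  ρ = lookup ρ x
eval (p :+ q) ρ = eval p ρ ℕ.+ eval q ρ
eval (p :* q) ρ = eval p ρ ℕ.* eval q ρ

-- Since p has nonnegative coefficients, the bound with ⌊log₂_⌋ is also a
-- bound with the real logarithm.
ComputesZigzag : Machine → Polynomial 3 → Set
ComputesZigzag M p =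
  ∀ (N₁ D₁ D₂ : ℕ) {{_ : NonZero N₁}} {{_ : NonZero D₁}} {{_ : NonZero D₂}}
    (G₁ : Graph [1⋯ N₁ ] [1⋯ D₁ ]) (G₂ : Graph [1⋯ D₁ ] [1⋯ D₂ ])
    (O : Oracle → String → String) →
    O oracle₁ represents G₁ → O oracle₂ represents G₂ →
    ∀ x → Computes M O
      (numeral N₁ N₁ ++ numeral D₁ D₁ ++ numeral D₂ D₂ ++ dart x)
      (dart (rot (G₁ ⓩ G₂) x))
      (eval p (⌊log₂ N₁ ⌋ ∷ ⌊log₂ D₁ ⌋ ∷ ⌊log₂ D₂ ⌋ ∷ []))
      1 2
  where
  dart : ∀ {N D E} → (Fin N × Fin D) × (Fin E × Fin E) → String
  dart (vk , ij) = pair vk ++ pair ij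

{-# OPTIONS --safe #-}
-- Let B̃ act on functions on [N₁] × [D₁] as G₂ does on each fibre, let Ã be
-- the permutation Rot_{G₁} and J the averaging over the fibres.  The zig-zag
-- product walks by B̃ÃB̃, and JÃJ is G₁ acting on the fibre means, so it is
-- bounded by λ₁ on functions orthogonal to 1.  Two splittings B̃ = tJ + E give
-- the two bounds whose minimum is f.
--   t = 1: E is bounded by λ₂, and J and E have orthogonal ranges and vanish
--   on complementary subspaces, so JÃE + EÃJ is bounded by λ₂ and the sum
--   JÃJ + (JÃE + EÃJ) + EÃE by λ₁ + λ₂ + λ₂².
--   t = 1 - μ with μ = min(λ₂,1): E is bounded by μ, and t²JÃJ + tJÃE + EÃB̃
--   by t²λ₁ + tμ + μ = 1 - t²(1 - λ₁).
module Submission where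

open import Algebra.Bundles using (CommutativeRing)
import Algebra.Solver.Ring
import Algebra.Solver.Ring.AlmostCommutativeRing as ACR
open import Data.Empty using (⊥-elim)
open import Data.Fin as Fin using (Fin; zero; suc; toℕ; _↑ˡ_; _↑ʳ_; combine)
import Data.Fin.Properties as Finₚ
import Data.Integer as ℤ
import Data.Integer.Properties as ℤₚ
open import Data.List as List using (List; []; _∷_; _++_; _ʳ++_; foldr; map; filter; length)
import Data.List.Properties as Listₚ
open import Data.Maybe using (just; nothing)
open import Data.Nat as ℕ using (ℕ; NonZero)
open import Data.Nat.Logarithm using (⌊log₂_⌋)
import Data.Nat.Properties as ℕₚ
open import Data.Nat.Tactic.RingSolver using (solve-∀)
open import Data.Product using (∃; _×_; _,_; proj₁; proj₂)
open import Data.Rational as ℚ using (ℚ; 0ℚ; 1ℚ; ½)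
import Data.Rational.Properties as ℚₚ
open import Data.Rational.Solver using (module +-*-Solver)
import Data.Rational.Unnormalised as ℚᵘ
import Data.Rational.Unnormalised.Properties as ℚᵘₚ
open import Data.Sum as Sum using (_⊎_; inj₁; inj₂)
open import Data.Vec as Vec using (Vec; []; _∷_; lookup; _[_]≔_)
import Data.Vec.Properties as Vecₚ
open import Function using (_∘_; id; _↔_; Inverse; mk↔ₛ′)
open import Function.Construct.Composition using (_↔-∘_)
open import Function.Construct.Symmetry using (↔-sym)
open import Level using (0ℓ)
open import Relation.Binary.Definitions using (WeaklyDecidable)
open import Relation.Binary.PropositionalEquality as ≡ using (_≡_)
open import Relation.Nullary using (¬_; Dec; yes; no)
open import Relation.Nullary.Negation using (contradiction)

-- Neither bound suffices alone: λ₁ + λ₂ + λ₂² can exceed 1 with λ₁, λ₂ < 1, while 1 - t²(1 - λ₁)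
-- stays below 1 but is 2λ₂ - λ₂² at λ₁ = 0, too large for 0 < λ₂ < 1/2. The minimum is an operation
-- on Cauchy reals, so f is defined without a case distinction, which their undecidable order would
-- not permit. The estimates are made for squared norms and rest on ring identities and the
-- comparison of squares. Classical case distinctions remain in two places, the minimum of two
-- factors and the condition α ≠ 0 in λ(G). Both times the goal is an inequality, and inequalities
-- are stable under double negation. The spectral part is therefore carried out over an abstract
-- ordered ring with just these properties. The machine exploits that numerals are closed by `#` and
-- that their length depends on the parameter alone: it moves them whole, without counting, in a
-- number of steps that is the same for all graphs with the given parameters.

-- Ordered rings with square roots and minima

record OrderedAlgebra : Set₁ where
  infix  4 _≤_
  infixl 6 _⊓_
  infix  8 √_
  field
    commutativeRing : CommutativeRing 0ℓ 0ℓ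

  open CommutativeRing commutativeRing public

  field
    _≤_         : Carrier → Carrier → Set
    ≤-reflexive : ∀ {x y} → x ≈ y → x ≤ y
    ≤-trans     : ∀ {x y z} → x ≤ y → y ≤ z → x ≤ z
    ≤-antisym   : ∀ {x y} → x ≤ y → y ≤ x → x ≈ y
    -- The classical reasoning that the order of the constructive reals admits.
    ≤-total     : ∀ x y → ¬ ¬ (x ≤ y ⊎ y ≤ x)
    ≤-stable    : ∀ {x y} → ¬ ¬ (x ≤ y) → x ≤ y
    +-mono-≤    : ∀ {x y u v} → x ≤ y → u ≤ v → x + u ≤ y + v
    *-nonNeg    : ∀ {x y} → 0# ≤ x → 0# ≤ y → 0# ≤ x * y
    square≥0    : ∀ x → 0# ≤ x * x
    square-cancel-≤ : ∀ {x y} → 0# ≤ y → x * x ≤ y * y → x ≤ y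

    ι        : ℚ → Carrier
    ι-homo-+ : ∀ p q → ι (p ℚ.+ q) ≈ ι p + ι q
    ι-homo-* : ∀ p q → ι (p ℚ.* q) ≈ ι p * ι q
    ι-homo-0 : ι 0ℚ ≈ 0#
    ι-homo-1 : ι 1ℚ ≈ 1#
    ι-mono   : ∀ {p q} → p ℚ.≤ q → ι p ≤ ι q

    √_       : Carrier → Carrier
    √-nonNeg : ∀ x → 0# ≤ √ x
    √-square : ∀ {x} → 0# ≤ x → √ x * √ x ≈ x

    _⊓_      : Carrier → Carrier → Carrier
    x⊓y≤x    : ∀ x y → x ⊓ y ≤ x
    x⊓y≤y    : ∀ x y → x ⊓ y ≤ y
    ⊓-glb    : ∀ {x y z} → z ≤ x → z ≤ y → z ≤ x ⊓ y

module OrderedAlgebraProperties (R : OrderedAlgebra) where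
  open OrderedAlgebra R
  open import Algebra.Properties.Ring ring using (+-cancelʳ)

  ι-homo-neg : ∀ p → ι (ℚ.- p) ≈ - ι p
  ι-homo-neg p = +-cancelʳ (ι p) _ _ (begin
    ι (ℚ.- p) + ι p   ≈⟨ ι-homo-+ (ℚ.- p) p ⟨
    ι (ℚ.- p ℚ.+ p)   ≡⟨ ≡.cong ι (ℚₚ.+-inverseˡ p) ⟩
    ι 0ℚ              ≈⟨ ι-homo-0 ⟩
    0#                ≈⟨ -‿inverseˡ (ι p) ⟨
    - ι p + ι p       ∎)
    where open import Relation.Binary.Reasoning.Setoid setoid

  -- The ring solver wants coefficients with decidable equality. The carrier has none, so the
  -- rationals serve, interpreted through `ι`; this also admits the constants 2 and ½.
  morphism : CommutativeRing.rawRing ℚₚ.+-*-commutativeRing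
             ACR.-Raw-AlmostCommutative⟶ ACR.fromCommutativeRing commutativeRing
  morphism = record
    { ⟦_⟧    = ι
    ; +-homo = ι-homo-+
    ; *-homo = ι-homo-*
    ; -‿homo = ι-homo-neg
    ; 0-homo = ι-homo-0
    ; 1-homo = ι-homo-1
    }

  ι-≟ : WeaklyDecidable (ACR.Induced-equivalence morphism)
  ι-≟ p q with p ℚₚ.≟ q
  ... | yes p≡q = just (reflexive (≡.cong ι p≡q))
  ... | no  _   = nothing

  open Algebra.Solver.Ring (CommutativeRing.rawRing ℚₚ.+-*-commutativeRing)
    (ACR.fromCommutativeRing commutativeRing) morphism ι-≟ public
    using (solve; _:=_; _:+_; _:*_; :-_; _:-_; con)

  ≤-respˡ : ∀ {x y z} → x ≈ y → x ≤ z → y ≤ z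
  ≤-respˡ x≈y = ≤-trans (≤-reflexive (sym x≈y))

  ≤-respʳ : ∀ {x y z} → x ≈ y → z ≤ x → z ≤ y
  ≤-respʳ x≈y z≤x = ≤-trans z≤x (≤-reflexive x≈y)

  ≤-refl : ∀ {x} → x ≤ x
  ≤-refl = ≤-reflexive refl

  +-nonNeg : ∀ {x y} → 0# ≤ x → 0# ≤ y → 0# ≤ x + y
  +-nonNeg p q = ≤-respˡ (+-identityˡ 0#) (+-mono-≤ p q)

  x≤x+y : ∀ {x y} → 0# ≤ y → x ≤ x + y
  x≤x+y {x} 0≤y = ≤-respˡ (+-identityʳ x) (+-mono-≤ ≤-refl 0≤y)

  x≤y⇒0≤y-x : ∀ {x y} → x ≤ y → 0# ≤ y - x
  x≤y⇒0≤y-x {x} h = ≤-respˡ (-‿inverseʳ x) (+-mono-≤ h ≤-refl)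

  0≤y-x⇒x≤y : ∀ {x y} → 0# ≤ y - x → x ≤ y
  0≤y-x⇒x≤y {x} {y} h = ≤-respˡ (+-identityˡ x)
    (≤-respʳ (solve 2 (λ x y → (y :- x) :+ x := y) refl x y) (+-mono-≤ h ≤-refl))

  *-monoˡ-≤ : ∀ {x y z} → 0# ≤ z → x ≤ y → z * x ≤ z * y
  *-monoˡ-≤ {x} {y} {z} 0≤z x≤y = 0≤y-x⇒x≤y (≤-respʳ
    (solve 3 (λ x y z → z :* (y :- x) := z :* y :- z :* x) refl x y z)
    (*-nonNeg 0≤z (x≤y⇒0≤y-x x≤y)))

  *-mono-≤ : ∀ {x y u v} → 0# ≤ y → 0# ≤ u → x ≤ y → u ≤ v → x * u ≤ y * v
  *-mono-≤ {x} {y} {u} {v} 0≤y 0≤u x≤y u≤v = ≤-trans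
    (≤-respˡ (*-comm u x) (≤-respʳ (*-comm u y) (*-monoˡ-≤ 0≤u x≤y)))
    (*-monoˡ-≤ 0≤y u≤v)

  ⊓-cong : ∀ {x y u v} → x ≈ y → u ≈ v → x ⊓ u ≈ y ⊓ v
  ⊓-cong p q = ≤-antisym (mono (≤-reflexive p) (≤-reflexive q))
                         (mono (≤-reflexive (sym p)) (≤-reflexive (sym q)))
    where
    mono : ∀ {x y u v} → x ≤ y → u ≤ v → x ⊓ u ≤ y ⊓ v
    mono p q = ⊓-glb (≤-trans (x⊓y≤x _ _) p) (≤-trans (x⊓y≤y _ _) q)

  -- Classically x ⊓ y is one of x and y.
  ≤-*-⊓ : ∀ {x y z w} → 0# ≤ w → z ≤ x * w → z ≤ y * w → z ≤ (x ⊓ y) * w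
  ≤-*-⊓ {x} {y} {z} {w} 0≤w h k = ≤-stable λ ¬goal → ≤-total x y λ where
      (inj₁ x≤y) → ¬goal (≤-trans h (mono (⊓-glb ≤-refl x≤y)))
      (inj₂ y≤x) → ¬goal (≤-trans k (mono (⊓-glb y≤x ≤-refl)))
    where
    mono : ∀ {u v} → u ≤ v → u * w ≤ v * w
    mono {u} {v} h = ≤-respˡ (*-comm w u) (≤-respʳ (*-comm w v) (*-monoˡ-≤ 0≤w h))

  -- Monotonicity of the root is not an axiom; it comes from comparing squares, for which the right
  -- side must be nonnegative. This lemma and the next are the passage between norms and squared
  -- norms.
  √≤*√ : ∀ {p q c} → 0# ≤ p → 0# ≤ q → 0# ≤ c → p ≤ c * c * q → √ p ≤ c * √ q
  √≤*√ {p} {q} {c} 0≤p 0≤q 0≤c h = square-cancel-≤ (*-nonNeg 0≤c (√-nonNeg q))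
    (≤-respˡ (sym (√-square 0≤p)) (≤-respʳ
      (trans (*-congˡ (sym (√-square 0≤q)))
        (solve 2 (λ c s → c :* c :* (s :* s) := c :* s :* (c :* s)) refl c (√ q)))
      h))

  ≤*√⇒≤ : ∀ {p q c} → 0# ≤ p → 0# ≤ q → 0# ≤ c → √ p ≤ c * √ q → p ≤ c * c * q
  ≤*√⇒≤ {p} {q} {c} 0≤p 0≤q 0≤c h = ≤-respˡ (√-square 0≤p) (≤-respʳ
    (trans (solve 2 (λ c s → c :* s :* (c :* s) := c :* c :* (s :* s)) refl c (√ q))
      (*-congˡ (√-square 0≤q)))
    (*-mono-≤ (*-nonNeg 0≤c (√-nonNeg q)) (√-nonNeg p) h h))

-- Finite sums, averages, and the adjacency matrix as a random walk

module Sums (R : OrderedAlgebra) where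
  open import Defs using (FinSet; Carrier; size; elements; _⊗_; count; Graph; rot;
                      adjacency; edge?; module Bisection)
  open Bisection using (nat; nat≃; nat-nonNeg)
  open OrderedAlgebra R hiding (zero) renaming (Carrier to S)
  open OrderedAlgebraProperties R
  open import Algebra.Properties.CommutativeMonoid.Sum +-commutativeMonoid
    using (sum; sum-cong-≋; sum-permute; ∑-comm; ∑-distrib-+; sum-replicate-zero)
  open import Algebra.Properties.Semiring.Sum semiring using (*-distribˡ-sum)
  open import Relation.Binary.Reasoning.Setoid setoid

  ∑ : (A : FinSet) → (Carrier A → S) → S
  ∑ A f = foldr _+_ 0# (map f (elements A))

  -- Bridge from folds over lists of elements to the library's `sum` over `Fin n`, which brings
  -- permutation and interchange of sums.
  foldr-tabulate : ∀ {n} {A B : Set} (f : B → S) (g : A → B) (h : Fin n → A) →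
    foldr _+_ 0# (map f (map g (List.tabulate h))) ≡ sum (f ∘ g ∘ h)
  foldr-tabulate {ℕ.zero}  f g h = ≡.refl
  foldr-tabulate {ℕ.suc n} f g h = ≡.cong (f (g (h zero)) +_) (foldr-tabulate f g (h ∘ suc))

  ∑≡sum : ∀ A f → ∑ A f ≡ sum (f ∘ Inverse.from (FinSet.enum A))
  ∑≡sum A f = foldr-tabulate f (Inverse.from (FinSet.enum A)) id

  ∑-cong : ∀ A {f g : Carrier A → S} → (∀ a → f a ≈ g a) → ∑ A f ≈ ∑ A g
  ∑-cong A {f} {g} h = go (elements A)
    where
    go : ∀ as → foldr _+_ 0# (map f as) ≈ foldr _+_ 0# (map g as)
    go []       = refl
    go (a ∷ as) = +-cong (h a) (go as)

  ∑-mono : ∀ A {f g : Carrier A → S} → (∀ a → f a ≤ g a) → ∑ A f ≤ ∑ A g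
  ∑-mono A {f} {g} h = go (elements A)
    where
    go : ∀ as → foldr _+_ 0# (map f as) ≤ foldr _+_ 0# (map g as)
    go []       = ≤-refl
    go (a ∷ as) = +-mono-≤ (h a) (go as)

  ∑-+ : ∀ A (f g : Carrier A → S) → ∑ A (λ a → f a + g a) ≈ ∑ A f + ∑ A g
  ∑-+ A f g = begin
    ∑ A (λ a → f a + g a)          ≡⟨ ∑≡sum A _ ⟩
    sum (λ i → f (e i) + g (e i))  ≈⟨ ∑-distrib-+ (f ∘ e) (g ∘ e) ⟩
    sum (f ∘ e) + sum (g ∘ e)      ≡⟨ ≡.cong₂ _+_ (∑≡sum A f) (∑≡sum A g) ⟨
    ∑ A f + ∑ A g                  ∎
    where e = Inverse.from (FinSet.enum A)

  ∑-* : ∀ A c (f : Carrier A → S) → ∑ A (λ a → c * f a) ≈ c * ∑ A f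
  ∑-* A c f = begin
    ∑ A (λ a → c * f a)    ≡⟨ ∑≡sum A _ ⟩
    sum (λ i → c * f (e i)) ≈⟨ *-distribˡ-sum c (f ∘ e) ⟨
    c * sum (f ∘ e)        ≡⟨ ≡.cong (c *_) (∑≡sum A f) ⟨
    c * ∑ A f              ∎
    where e = Inverse.from (FinSet.enum A)

  ∑-*ʳ : ∀ A c (f : Carrier A → S) → ∑ A (λ a → f a * c) ≈ ∑ A f * c
  ∑-*ʳ A c f = trans (∑-cong A (λ a → *-comm (f a) c)) (trans (∑-* A c f) (*-comm c _))

  ∑-zero : ∀ A {f : Carrier A → S} → (∀ a → f a ≈ 0#) → ∑ A f ≈ 0#
  ∑-zero A {f} h = trans (∑-cong A h) (trans (reflexive (∑≡sum A _)) (sum-replicate-zero (size A)))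

  ∑-nonNeg : ∀ A {f : Carrier A → S} → (∀ a → 0# ≤ f a) → 0# ≤ ∑ A f
  ∑-nonNeg A h = ≤-respˡ (∑-zero A (λ _ → refl)) (∑-mono A h)

  ∑-swap : ∀ A B (f : Carrier A → Carrier B → S) →
    ∑ A (λ a → ∑ B (f a)) ≈ ∑ B (λ b → ∑ A (λ a → f a b))
  ∑-swap A B f = begin
    ∑ A (λ a → ∑ B (f a))                   ≡⟨ ∑≡sum A _ ⟩
    sum (λ i → ∑ B (f (eA i)))              ≈⟨ sum-cong-≋ (λ i → reflexive (∑≡sum B (f (eA i)))) ⟩
    sum (λ i → sum (λ j → f (eA i) (eB j))) ≈⟨ ∑-comm (λ i j → f (eA i) (eB j)) ⟩
    sum (λ j → sum (λ i → f (eA i) (eB j))) ≈⟨ sum-cong-≋ (λ j → reflexive (∑≡sum A (λ a → f a (eB j)))) ⟨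
    sum (λ j → ∑ A (λ a → f a (eB j)))      ≡⟨ ∑≡sum B _ ⟨
    ∑ B (λ b → ∑ A (λ a → f a b))           ∎
    where
    eA = Inverse.from (FinSet.enum A)
    eB = Inverse.from (FinSet.enum B)

  -- Applied to the rotation map, a permutation of the darts: it makes `A₁` an isometry and lets
  -- walks preserve sums.
  ∑-bij : ∀ A B (φ : Carrier A ↔ Carrier B) f → ∑ B f ≈ ∑ A (f ∘ Inverse.to φ)
  ∑-bij A B φ f = begin
    ∑ B f                        ≡⟨ ∑≡sum B f ⟩
    sum (f ∘ eB)                 ≈⟨ sum-permute (f ∘ eB) π ⟩
    sum (f ∘ eB ∘ Inverse.to π)  ≈⟨ sum-cong-≋ (λ i → reflexive (≡.cong f
                                      (Inverse.strictlyInverseʳ (FinSet.enum B) (Inverse.to φ (eA i))))) ⟩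
    sum (f ∘ Inverse.to φ ∘ eA)  ≡⟨ ∑≡sum A _ ⟨
    ∑ A (f ∘ Inverse.to φ)       ∎
    where
    eA = Inverse.from (FinSet.enum A)
    eB = Inverse.from (FinSet.enum B)
    π : Fin (size A) ↔ Fin (size B)
    π = FinSet.enum B ↔-∘ (φ ↔-∘ ↔-sym (FinSet.enum A))

  sum-↑ : ∀ m {n} (f : Fin (m ℕ.+ n) → S) →
    sum f ≈ sum (λ i → f (i ↑ˡ n)) + sum (λ j → f (m ↑ʳ j))
  sum-↑ ℕ.zero    f = sym (+-identityˡ _)
  sum-↑ (ℕ.suc m) f = trans (+-congˡ (sum-↑ m (f ∘ suc))) (sym (+-assoc _ _ _))

  sum-combine : ∀ m n (f : Fin (m ℕ.* n) → S) →
    sum f ≈ sum {m} (λ i → sum {n} (λ j → f (combine i j)))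
  sum-combine ℕ.zero    n f = refl
  sum-combine (ℕ.suc m) n f = trans (sum-↑ n f) (+-congˡ (sum-combine m n (f ∘ (n ↑ʳ_))))

  ∑-⊗ : ∀ A B (f : Carrier (A ⊗ B) → S) → ∑ (A ⊗ B) f ≈ ∑ A (λ a → ∑ B (λ b → f (a , b)))
  ∑-⊗ A B f = begin
    ∑ (A ⊗ B) f                                   ≡⟨ ∑≡sum (A ⊗ B) f ⟩
    sum (f ∘ e)                                   ≈⟨ sum-combine (size A) (size B) (f ∘ e) ⟩
    sum {size A} (λ i → sum {size B} (λ j → f (e (combine i j))))

                                                    ≈⟨ sum-cong-≋ {size A} (λ i → sum-cong-≋ {size B} (λ j → reflexive
         (≡.cong (λ ij → f (eA (proj₁ ij) , eB (proj₂ ij))) (Finₚ.remQuot-combine {size A} i j)))) ⟩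
    sum (λ i → sum (λ j → f (eA i , eB j)))
      ≈⟨ sum-cong-≋ (λ i → reflexive (∑≡sum B (λ b → f (eA i , b)))) ⟨
    sum (λ i → ∑ B (λ b → f (eA i , b)))          ≡⟨ ∑≡sum A _ ⟨
    ∑ A (λ a → ∑ B (λ b → f (a , b)))             ∎
    where
    e = Inverse.from (FinSet.enum (A ⊗ B))
    eA = Inverse.from (FinSet.enum A)
    eB = Inverse.from (FinSet.enum B)

  sum-single : ∀ {n} (g : Fin n → S) i → (∀ j → ¬ j ≡ i → g j ≈ 0#) → sum g ≈ g i
  sum-single {ℕ.suc n} g zero h = trans
    (+-congˡ (trans (sum-cong-≋ {n} (λ j → h (suc j) λ ())) (sum-replicate-zero n))) (+-identityʳ _)
  sum-single g (suc i) h = trans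
    (+-cong (h zero λ ()) (sum-single (g ∘ suc) i (λ j j≢i → h (suc j) (j≢i ∘ Finₚ.suc-injective))))
    (+-identityˡ _)

  ∑-single : ∀ A (g : Carrier A → S) a → (∀ b → ¬ a ≡ b → g b ≈ 0#) → ∑ A g ≈ g a
  ∑-single A g a h = begin
    ∑ A g              ≡⟨ ∑≡sum A g ⟩
    sum (g ∘ from)     ≈⟨ sum-single (g ∘ from) (to a) (λ j j≢a → h (from j)
                            (λ a≡ → j≢a (≡.sym (≡.trans (≡.cong to a≡) (strictlyInverseˡ j))))) ⟩
    g (from (to a))    ≡⟨ ≡.cong g (strictlyInverseʳ a) ⟩
    g a                ∎
    where open Inverse (FinSet.enum A)

  𝟙 : ∀ {P : Set} → Dec P → S
  𝟙 (yes _) = 1#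
  𝟙 (no _)  = 0#

  -- The decision procedure is arbitrary so that `edge?` can be used as it is: an edge is by
  -- definition an equality with a value of `rot`.
  ∑-𝟙 : ∀ A (f : Carrier A → S) a (a≟ : ∀ b → Dec (a ≡ b)) → ∑ A (λ b → 𝟙 (a≟ b) * f b) ≈ f a
  ∑-𝟙 A f a a≟ = trans (∑-single A _ a off) on
    where
    off : ∀ b → ¬ a ≡ b → 𝟙 (a≟ b) * f b ≈ 0#
    off b a≢b with a≟ b
    ... | yes a≡b = contradiction a≡b a≢b
    ... | no _    = zeroˡ (f b)
    on : 𝟙 (a≟ a) * f a ≈ f a
    on with a≟ a
    ... | yes _   = *-identityˡ (f a)
    ... | no a≢a  = contradiction ≡.refl a≢a

  -- Division of rationals cancels the gcd, so the identity is checked on unnormalised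
  -- representatives, where it is a cross multiplication.
  quotient : ∀ c d {{_ : NonZero d}} → (ℤ.+ c ℚ./ d) ℚ.* nat d ≡ nat c
  quotient c d@(ℕ.suc d-1) = ℚₚ.toℚᵘ-injective (ℚᵘₚ.≃-trans
    (ℚₚ.toℚᵘ-homo-* (ℤ.+ c ℚ./ d) (nat d)) (ℚᵘₚ.≃-trans
    (ℚᵘₚ.*-cong (ℚₚ.toℚᵘ-fromℚᵘ (ℚᵘ.mkℚᵘ (ℤ.+ c) d-1)) (nat≃ d)) (ℚᵘₚ.≃-trans
    (ℚᵘ.*≡* (≡.trans (ℤₚ.*-identityʳ _) (≡.cong (λ z → ℤ.+ c ℤ.* ℤ.+ z) (≡.sym (ℕₚ.*-identityʳ d)))))
    (ℚᵘₚ.≃-sym (nat≃ c)))))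

  ∣_∣ : FinSet → S
  ∣ A ∣ = ι (nat (size A))

  ν : FinSet → S
  ν A = ι ((ℤ.+ 1 ℚ./ size A) {{FinSet.nonZero A}})

  ν*∣∣ : ∀ A → ν A * ∣ A ∣ ≈ 1#
  ν*∣∣ A = trans (sym (ι-homo-* _ _)) (trans
    (reflexive (≡.cong ι (≡.trans (quotient 1 (size A) {{FinSet.nonZero A}}) (ℚₚ.+-identityˡ 1ℚ)))) ι-homo-1)

  ι-nonNeg : ∀ {p} → 0ℚ ℚ.≤ p → 0# ≤ ι p
  ι-nonNeg h = ≤-respˡ ι-homo-0 (ι-mono h)

  ν-nonNeg : ∀ A → 0# ≤ ν A
  ν-nonNeg A = ι-nonNeg (ℚₚ.nonNegative⁻¹ _ {{ℚₚ.normalize-nonNeg 1 (size A) {{FinSet.nonZero A}}}})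

  ∣∣-nonNeg : ∀ A → 0# ≤ ∣ A ∣
  ∣∣-nonNeg A = ι-nonNeg (nat-nonNeg (size A))

  ι-nat-suc : ∀ n → ι (nat (ℕ.suc n)) ≈ 1# + ι (nat n)
  ι-nat-suc n = trans (ι-homo-+ (nat n) 1ℚ) (trans (+-congˡ ι-homo-1) (+-comm _ _))

  ∑-1 : ∀ A → ∑ A (λ _ → 1#) ≈ ∣ A ∣
  ∑-1 A = trans (reflexive (∑≡sum A _)) (go (size A))
    where
    go : ∀ n → sum {n} (λ _ → 1#) ≈ ι (nat n)
    go ℕ.zero    = sym ι-homo-0
    go (ℕ.suc n) = trans (+-congˡ (go n)) (sym (ι-nat-suc n))

  ∑-const : ∀ A c → ∑ A (λ _ → c) ≈ ∣ A ∣ * c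
  ∑-const A c = trans (∑-cong A (λ _ → sym (*-identityˡ c))) (trans (∑-*ʳ A c _) (*-congʳ (∑-1 A)))

  ι-count : ∀ A {P : Carrier A → Set} (P? : ∀ a → Dec (P a)) →
    ι (nat (count A P?)) ≈ ∑ A (λ a → 𝟙 (P? a))
  ι-count A P? = go (elements A)
    where
    go : ∀ as → ι (nat (length (filter P? as))) ≈ foldr _+_ 0# (map (λ a → 𝟙 (P? a)) as)
    go []       = ι-homo-0
    go (a ∷ as) with P? a
    ... | yes _ = trans (ι-nat-suc (length (filter P? as))) (+-congˡ (go as))
    ... | no _  = trans (go as) (sym (+-identityˡ _))

  avg : (A : FinSet) → (Carrier A → S) → S
  avg A f = ν A * ∑ A f

  avg-cong : ∀ A {f g : Carrier A → S} → (∀ a → f a ≈ g a) → avg A f ≈ avg A g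
  avg-cong A h = *-congˡ (∑-cong A h)

  avg-+ : ∀ A f g → avg A (λ a → f a + g a) ≈ avg A f + avg A g
  avg-+ A f g = trans (*-congˡ (∑-+ A f g)) (distribˡ _ _ _)

  avg-* : ∀ A c f → avg A (λ a → c * f a) ≈ c * avg A f
  avg-* A c f = trans (*-congˡ (∑-* A c f))
    (solve 3 (λ n c s → n :* (c :* s) := c :* (n :* s)) refl (ν A) c (∑ A f))

  ∣∣*avg : ∀ A f → ∣ A ∣ * avg A f ≈ ∑ A f
  ∣∣*avg A f = trans (solve 3 (λ s n x → s :* (n :* x) := n :* s :* x) refl ∣ A ∣ (ν A) (∑ A f))
    (trans (*-congʳ (ν*∣∣ A)) (*-identityˡ _))

  avg-const : ∀ A c → avg A (λ _ → c) ≈ c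
  avg-const A c = trans (*-congˡ (∑-const A c)) (trans (sym (*-assoc _ _ _))
    (trans (*-congʳ (ν*∣∣ A)) (*-identityˡ c)))

  ∣⊗∣ : ∀ A B → ∣ A ⊗ B ∣ ≈ ∣ A ∣ * ∣ B ∣
  ∣⊗∣ A B = begin
    ∣ A ⊗ B ∣                      ≈⟨ ∑-1 (A ⊗ B) ⟨
    ∑ (A ⊗ B) (λ _ → 1#)           ≈⟨ ∑-⊗ A B _ ⟩
    ∑ A (λ _ → ∑ B (λ _ → 1#))     ≈⟨ ∑-const A _ ⟩
    ∣ A ∣ * ∑ B (λ _ → 1#)         ≈⟨ *-congˡ (∑-1 B) ⟩
    ∣ A ∣ * ∣ B ∣                  ∎

  -- Both sides are inverse to `∣ A ⊗ B ∣`, and inverses are unique.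
  ν-⊗ : ∀ A B → ν (A ⊗ B) ≈ ν A * ν B
  ν-⊗ A B = begin
    ν (A ⊗ B)                                      ≈⟨ *-identityʳ _ ⟨
    ν (A ⊗ B) * 1#
      ≈⟨ *-congˡ (trans (*-cong (ν*∣∣ A) (ν*∣∣ B)) (*-identityˡ 1#)) ⟨
    ν (A ⊗ B) * (ν A * ∣ A ∣ * (ν B * ∣ B ∣))
      ≈⟨ solve 5 (λ n a b x y → n :* (a :* x :* (b :* y)) := n :* (x :* y) :* (a :* b))
           refl (ν (A ⊗ B)) (ν A) (ν B) ∣ A ∣ ∣ B ∣ ⟩
    ν (A ⊗ B) * (∣ A ∣ * ∣ B ∣) * (ν A * ν B)      ≈⟨ *-congʳ (*-congˡ (∣⊗∣ A B)) ⟨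
    ν (A ⊗ B) * ∣ A ⊗ B ∣ * (ν A * ν B)            ≈⟨ *-congʳ (ν*∣∣ (A ⊗ B)) ⟩
    1# * (ν A * ν B)                               ≈⟨ *-identityˡ _ ⟩
    ν A * ν B                                      ∎

  avg-⊗ : ∀ A B f → avg (A ⊗ B) f ≈ avg A (λ a → avg B (λ b → f (a , b)))
  avg-⊗ A B f = begin
    ν (A ⊗ B) * ∑ (A ⊗ B) f                      ≈⟨ *-cong (ν-⊗ A B) (∑-⊗ A B f) ⟩
    ν A * ν B * ∑ A (λ a → ∑ B (λ b → f (a , b))) ≈⟨ *-assoc _ _ _ ⟩
    ν A * (ν B * ∑ A (λ a → ∑ B (λ b → f (a , b)))) ≈⟨ *-congˡ (∑-* A (ν B) _) ⟨
    avg A (λ a → avg B (λ b → f (a , b)))        ∎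

  module _ {V L : FinSet} (G : Graph V L) where

    neighbour : Carrier V → Carrier L → Carrier V
    neighbour u i = proj₁ (rot G (u , i))

    walk : (Carrier V → S) → Carrier V → S
    walk α u = avg L (λ i → α (neighbour u i))

    ι-adjacency : ∀ u v → ι (adjacency G u v) ≈
      ν L * ∑ L (λ i → ∑ L (λ j → 𝟙 (edge? G u v (i , j))))
    ι-adjacency u v = begin
      ι q                         ≈⟨ *-identityʳ (ι q) ⟨
      ι q * 1#                    ≈⟨ *-congˡ (ν*∣∣ L) ⟨
      ι q * (ν L * ∣ L ∣)
        ≈⟨ solve 3 (λ q n s → q :* (n :* s) := n :* (q :* s)) refl (ι q) (ν L) ∣ L ∣ ⟩
      ν L * (ι q * ∣ L ∣)         ≈⟨ *-congˡ (ι-homo-* q (nat (size L))) ⟨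
      ν L * ι (q ℚ.* nat (size L))
        ≡⟨ ≡.cong (λ z → ν L * ι z) (quotient (count (L ⊗ L) (edge? G u v)) (size L) {{FinSet.nonZero L}}) ⟩
      ν L * ι (nat (count (L ⊗ L) (edge? G u v))) ≈⟨ *-congˡ (ι-count (L ⊗ L) (edge? G u v)) ⟩
      ν L * ∑ (L ⊗ L) (λ e → 𝟙 (edge? G u v e))  ≈⟨ *-congˡ (∑-⊗ L L _) ⟩
      ν L * ∑ L (λ i → ∑ L (λ j → 𝟙 (edge? G u v (i , j)))) ∎
      where q = adjacency G u v

    -- For a fixed label i exactly one pair (v , j) equals `rot G (u , i)`. Summing the indicators
    -- against α over v and j thus leaves the value of α at the i-th neighbour, and the
    -- normalization turns the sum over i into an average.
    adjacency≈walk : ∀ α u → ∑ V (λ v → ι (adjacency G u v) * α v) ≈ walk α u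
    adjacency≈walk α u = begin
      ∑ V (λ v → ι (adjacency G u v) * α v)
        ≈⟨ ∑-cong V (λ v → trans (*-congʳ (ι-adjacency u v)) (*-assoc _ _ _)) ⟩
      ∑ V (λ v → ν L * (∑ L (λ i → ∑ L (λ j → E v i j)) * α v))
        ≈⟨ ∑-* V (ν L) _ ⟩
      ν L * ∑ V (λ v → ∑ L (λ i → ∑ L (λ j → E v i j)) * α v)
        ≈⟨ *-congˡ (∑-cong V (λ v → trans (sym (∑-*ʳ L (α v) _))
             (∑-cong L (λ i → sym (∑-*ʳ L (α v) _))))) ⟩
      ν L * ∑ V (λ v → ∑ L (λ i → ∑ L (λ j → E v i j * α v)))
        ≈⟨ *-congˡ (∑-swap V L _) ⟩
      ν L * ∑ L (λ i → ∑ V (λ v → ∑ L (λ j → E v i j * α v)))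
        ≈⟨ *-congˡ (∑-cong L (λ i → trans (sym (∑-⊗ V L (λ (v , j) → E v i j * α v)))
             (∑-𝟙 (V ⊗ L) (α ∘ proj₁) (rot G (u , i)) (λ (v , j) → edge? G u v (i , j))))) ⟩
      walk α u ∎
      where E = λ v i j → 𝟙 (edge? G u v (i , j))

-- Quadratic forms: Cauchy-Schwarz, triangle inequality, mean and deviation

module Forms (R : OrderedAlgebra) where
  open import Defs using (FinSet; Carrier; _⊗_; Graph; rot; rot-involutive)
  open OrderedAlgebra R hiding (zero) renaming (Carrier to S)
  open OrderedAlgebraProperties R
  open Sums R

  ⟨_⟩_∙_ : (A : FinSet) → (α β : Carrier A → S) → S
  ⟨ A ⟩ α ∙ β = ∑ A (λ a → α a * β a)

  Q : (A : FinSet) → (Carrier A → S) → S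
  Q A α = ⟨ A ⟩ α ∙ α

  module _ (A : FinSet) where
    open import Relation.Binary.Reasoning.Setoid setoid

    Q-cong : ∀ {α β} → (∀ a → α a ≈ β a) → Q A α ≈ Q A β
    Q-cong h = ∑-cong A (λ a → *-cong (h a) (h a))

    Q-nonNeg : ∀ α → 0# ≤ Q A α
    Q-nonNeg α = ∑-nonNeg A (λ a → square≥0 (α a))

    Q-* : ∀ c α → Q A (λ a → c * α a) ≈ c * c * Q A α
    Q-* c α = trans (∑-cong A (λ a → solve 2 (λ c x → c :* x :* (c :* x) := c :* c :* (x :* x)) refl c (α a)))
      (∑-* A (c * c) _)

    Q-+ : ∀ α β → Q A (λ a → α a + β a) ≈ Q A α + (⟨ A ⟩ α ∙ β + ⟨ A ⟩ α ∙ β) + Q A β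
    Q-+ α β = begin
      Q A (λ a → α a + β a)
        ≈⟨ ∑-cong A (λ a → solve 2 (λ x y → (x :+ y) :* (x :+ y) := x :* x :+ (x :* y :+ x :* y) :+ y :* y)
             refl (α a) (β a)) ⟩
      ∑ A (λ a → α a * α a + (α a * β a + α a * β a) + β a * β a)
        ≈⟨ ∑-+ A _ _ ⟩
      ∑ A (λ a → α a * α a + (α a * β a + α a * β a)) + Q A β
        ≈⟨ +-congʳ (trans (∑-+ A _ _) (+-congˡ (∑-+ A _ _))) ⟩
      Q A α + (⟨ A ⟩ α ∙ β + ⟨ A ⟩ α ∙ β) + Q A β ∎

    private
      ∑-combination : ∀ f g h x y z → ∑ A (λ a → f a * x + g a * y + h a * z)
                                    ≈ ∑ A f * x + ∑ A g * y + ∑ A h * z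
      ∑-combination f g h x y z = trans (∑-+ A _ _)
        (+-cong (trans (∑-+ A _ _) (+-cong (∑-*ʳ A x f) (∑-*ʳ A y g))) (∑-*ʳ A z h))

    -- Lagrange's identity; the factor 2 appears because the double sum meets every unordered pair
    -- twice. It yields Cauchy-Schwarz without dividing by a norm, hence without asking whether the
    -- norm is zero.
    lagrange : ∀ α β →
      ∑ A (λ a → ∑ A (λ b → (α a * β b - α b * β a) * (α a * β b - α b * β a)))
      ≈ ι (1ℚ ℚ.+ 1ℚ) * (Q A α * Q A β - ⟨ A ⟩ α ∙ β * ⟨ A ⟩ α ∙ β)
    lagrange α β = begin
      ∑ A (λ a → ∑ A (λ b → (α a * β b - α b * β a) * (α a * β b - α b * β a)))
        ≈⟨ ∑-cong A (λ a → trans (∑-cong A (λ b → expand (α a) (β a) (α b) (β b)))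
             (∑-combination (λ b → β b * β b) (λ b → α b * α b) (λ b → α b * β b) _ _ _)) ⟩
      ∑ A (λ a → Q A β * (α a * α a) + Q A α * (β a * β a) + I * (- (α a * β a + α a * β a)))
        ≈⟨ ∑-cong A (λ a → reorder (α a) (β a) (Q A α) (Q A β) I) ⟩
      ∑ A (λ a → α a * α a * Q A β + β a * β a * Q A α + α a * β a * (- (I + I)))
        ≈⟨ ∑-combination _ _ _ _ _ _ ⟩
      Q A α * Q A β + Q A β * Q A α + I * (- (I + I))
        ≈⟨ solve 3 (λ p q i → p :* q :+ q :* p :+ i :* (:- (i :+ i))
             := con (1ℚ ℚ.+ 1ℚ) :* (p :* q :- i :* i)) refl (Q A α) (Q A β) I ⟩
      ι (1ℚ ℚ.+ 1ℚ) * (Q A α * Q A β - I * I) ∎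
      where
      I = ⟨ A ⟩ α ∙ β
      expand : ∀ x y z w → (x * w - z * y) * (x * w - z * y) ≈
        w * w * (x * x) + z * z * (y * y) + z * w * (- (x * y + x * y))
      expand = solve 4 (λ x y z w → (x :* w :- z :* y) :* (x :* w :- z :* y) :=
        w :* w :* (x :* x) :+ z :* z :* (y :* y) :+ z :* w :* (:- (x :* y :+ x :* y))) refl
      reorder : ∀ x y p q i → q * (x * x) + p * (y * y) + i * (- (x * y + x * y)) ≈
        x * x * q + y * y * p + x * y * (- (i + i))
      reorder = solve 5 (λ x y p q i → q :* (x :* x) :+ p :* (y :* y) :+ i :* (:- (x :* y :+ x :* y))
        := x :* x :* q :+ y :* y :* p :+ x :* y :* (:- (i :+ i))) refl

    cauchy-schwarz : ∀ α β → ⟨ A ⟩ α ∙ β * ⟨ A ⟩ α ∙ β ≤ Q A α * Q A β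
    cauchy-schwarz α β = 0≤y-x⇒x≤y (≤-respʳ
      (solve 1 (λ x → con ½ :* (con (1ℚ ℚ.+ 1ℚ) :* x) := x) refl _)
      (*-nonNeg (ι-nonNeg (ℚₚ.nonNegative⁻¹ ½))
        (≤-respʳ (lagrange α β) (∑-nonNeg A (λ a → ∑-nonNeg A (λ b → square≥0 _))))))

    -- The triangle inequality without roots: by Cauchy-Schwarz the square of the mixed term is at
    -- most (x²q)(y²q), so the mixed term is at most xyq.
    Q-+-≤ : ∀ {x y q α β} → 0# ≤ x → 0# ≤ y → 0# ≤ q → Q A α ≤ x * x * q → Q A β ≤ y * y * q →
      Q A (λ a → α a + β a) ≤ (x + y) * (x + y) * q
    Q-+-≤ {x} {y} {q} {α} {β} 0≤x 0≤y 0≤q hα hβ = ≤-respˡ (sym (Q-+ α β)) (≤-respʳ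
      (solve 3 (λ x y q → x :* x :* q :+ (x :* y :* q :+ x :* y :* q) :+ y :* y :* q
        := (x :+ y) :* (x :+ y) :* q) refl x y q)
      (+-mono-≤ (+-mono-≤ hα (+-mono-≤ mixed mixed)) hβ))
      where
      mixed : ⟨ A ⟩ α ∙ β ≤ x * y * q
      mixed = square-cancel-≤ (*-nonNeg (*-nonNeg 0≤x 0≤y) 0≤q)
        (≤-trans (cauchy-schwarz α β) (≤-respʳ
          (solve 3 (λ x y q → x :* x :* q :* (y :* y :* q) := x :* y :* q :* (x :* y :* q)) refl x y q)
          (*-mono-≤ (*-nonNeg (square≥0 x) 0≤q) (Q-nonNeg β) hα hβ)))

    Q-*-≤ : ∀ c {x q α} → Q A α ≤ x * x * q → Q A (λ a → c * α a) ≤ c * x * (c * x) * q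
    Q-*-≤ c {x} {q} {α} h = ≤-respˡ (sym (Q-* c α)) (≤-respʳ
      (solve 3 (λ c x q → c :* c :* (x :* x :* q) := c :* x :* (c :* x) :* q) refl c x q)
      (*-monoˡ-≤ (square≥0 c) h))

    Q-const : ∀ c → Q A (λ _ → c) ≈ ∣ A ∣ * (c * c)
    Q-const c = ∑-const A (c * c)

    pythagoras : ∀ c {δ} → ∑ A δ ≈ 0# → Q A (λ a → c + δ a) ≈ ∣ A ∣ * (c * c) + Q A δ
    pythagoras c {δ} ∑δ≈0 = trans (Q-+ (λ _ → c) δ) (+-congʳ (trans
      (+-cong (Q-const c) (trans (+-cong mixed≈0 mixed≈0) (+-identityˡ 0#))) (+-identityʳ _)))
      where
      mixed≈0 : ⟨ A ⟩ (λ _ → c) ∙ δ ≈ 0#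
      mixed≈0 = trans (∑-* A c δ) (trans (*-congˡ ∑δ≈0) (zeroʳ c))

    -- Cauchy-Schwarz against the constant 1, whose squared norm `∣ A ∣` cancels one of the two
    -- factors `ν A`.
    jensen : ∀ f → avg A f * avg A f ≤ avg A (λ a → f a * f a)
    jensen f = ≤-respˡ
      (solve 2 (λ n s → n :* n :* (s :* s) := n :* s :* (n :* s)) refl (ν A) (∑ A f))
      (≤-respʳ shrink (*-monoˡ-≤ (*-nonNeg (ν-nonNeg A) (ν-nonNeg A))
        (≤-respˡ (*-cong 1-right 1-right) (cauchy-schwarz f (λ _ → 1#)))))
      where
      1-right : ⟨ A ⟩ f ∙ (λ _ → 1#) ≈ ∑ A f
      1-right = ∑-cong A (λ a → *-identityʳ (f a))
      shrink : ν A * ν A * (Q A f * Q A (λ _ → 1#)) ≈ avg A (λ a → f a * f a)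
      shrink = begin
        ν A * ν A * (Q A f * Q A (λ _ → 1#))   ≈⟨ *-congˡ (*-congˡ (Q-const 1#)) ⟩
        ν A * ν A * (Q A f * (∣ A ∣ * (1# * 1#)))
          -- `1#` is passed as a variable: the constants of the solver denote values of `ι`, and
          -- `ι 1ℚ` is only `≈` to `1#`.
          ≈⟨ solve 4 (λ n q m o → n :* n :* (q :* (m :* (o :* o))) := n :* m :* (o :* o :* (n :* q)))
               refl (ν A) (Q A f) ∣ A ∣ 1# ⟩
        ν A * ∣ A ∣ * (1# * 1# * (ν A * Q A f))
          ≈⟨ *-cong (ν*∣∣ A) (*-congʳ (*-identityˡ 1#)) ⟩
        1# * (1# * (ν A * Q A f))              ≈⟨ trans (*-identityˡ _) (*-identityˡ _) ⟩
        ν A * Q A f                            ∎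

    dev : (Carrier A → S) → Carrier A → S
    dev γ a = γ a - avg A γ

    ∑-dev : ∀ γ → ∑ A (dev γ) ≈ 0#
    ∑-dev γ = begin
      ∑ A (λ a → γ a - avg A γ)        ≈⟨ ∑-+ A _ _ ⟩
      ∑ A γ + ∑ A (λ _ → - avg A γ)    ≈⟨ +-congˡ (∑-const A _) ⟩
      ∑ A γ + ∣ A ∣ * (- avg A γ)      ≈⟨ solve 3 (λ s n m → s :+ n :* (:- m) := s :- n :* m) refl _ _ _ ⟩
      ∑ A γ - ∣ A ∣ * avg A γ          ≈⟨ +-congˡ (-‿cong (∣∣*avg A γ)) ⟩
      ∑ A γ - ∑ A γ                    ≈⟨ -‿inverseʳ _ ⟩
      0#                               ∎

    avg+dev : ∀ γ a → γ a ≈ avg A γ + dev γ a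
    avg+dev γ a = solve 2 (λ g m → g := m :+ (g :- m)) refl (γ a) (avg A γ)

    Q-dev : ∀ γ → Q A γ ≈ ∣ A ∣ * (avg A γ * avg A γ) + Q A (dev γ)
    Q-dev γ = trans (Q-cong (avg+dev γ)) (pythagoras (avg A γ) (∑-dev γ))

  module _ {V L : FinSet} (G : Graph V L) where

    walk-cong : ∀ {α β} → (∀ v → α v ≈ β v) → ∀ u → walk G α u ≈ walk G β u
    walk-cong h u = avg-cong L (λ i → h (neighbour G u i))

    rot-↔ : (Carrier V × Carrier L) ↔ (Carrier V × Carrier L)
    rot-↔ = mk↔ₛ′ (rot G) (rot G) (rot-involutive G) (rot-involutive G)

    -- The sum over all darts of α at the far end equals the sum of α at the near end, since `rot`
    -- permutes the darts; each vertex is the near end of equally many.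
    ∑-walk : ∀ α → ∑ V (walk G α) ≈ ∑ V α
    ∑-walk α = begin
      ∑ V (λ u → ν L * ∑ L (λ i → α (neighbour G u i)))  ≈⟨ ∑-* V (ν L) _ ⟩
      ν L * ∑ V (λ u → ∑ L (λ i → α (neighbour G u i)))  ≈⟨ *-congˡ (∑-⊗ V L (α ∘ proj₁ ∘ rot G)) ⟨
      ν L * ∑ (V ⊗ L) (α ∘ proj₁ ∘ rot G)
        ≈⟨ *-congˡ (∑-bij (V ⊗ L) (V ⊗ L) rot-↔ (α ∘ proj₁)) ⟨
      ν L * ∑ (V ⊗ L) (α ∘ proj₁)                        ≈⟨ *-congˡ (∑-⊗ V L _) ⟩
      ν L * ∑ V (λ u → ∑ L (λ _ → α u))                  ≈⟨ ∑-* V (ν L) _ ⟨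
      ∑ V (λ u → avg L (λ _ → α u))                      ≈⟨ ∑-cong V (λ u → avg-const L (α u)) ⟩
      ∑ V α                                              ∎
      where open import Relation.Binary.Reasoning.Setoid setoid

    -- Jensen at every vertex, followed by the preservation of the sum of α². Orthogonality to 1 is
    -- not assumed, so the lemma also serves for `B₂` and for vanishing α.
    walk-contracts : ∀ α → Q V (walk G α) ≤ Q V α
    walk-contracts α = ≤-trans (∑-mono V (λ u → jensen L (λ i → α (neighbour G u i))))
      (≤-reflexive (∑-walk (λ v → α v * α v)))

    walk-dev : ∀ γ u → walk G γ u ≈ avg V γ + walk G (dev V γ) u
    walk-dev γ u = trans (walk-cong (avg+dev V γ) u)
      (trans (avg-+ L _ _) (+-congʳ (avg-const L (avg V γ))))

-- The two spectral estimates for the zig-zag product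

module Expansion (R : OrderedAlgebra) where
  open import Defs using (FinSet; Carrier; _⊗_; Graph; rot; _ⓩ_)
  open OrderedAlgebra R hiding (zero) renaming (Carrier to S)
  open OrderedAlgebraProperties R
  open Sums R
  open Forms R

  -- For c ≥ 0 this is λ(G) ≤ c with the norms squared. The case α = 0, where both sides vanish, is
  -- included, so that fibres and means can be inserted without testing them.
  Contracts : {V L : FinSet} → Graph V L → S → Set
  Contracts {V} G c = ∀ α → ∑ V α ≈ 0# → Q V (walk G α) ≤ c * c * Q V α

  module _ {V K L : FinSet} (G₁ : Graph V K) (G₂ : Graph K L) where
    private
      X = V ⊗ K

    mean : (Carrier X → S) → Carrier V → S
    mean γ v = avg K (λ k → γ (v , k))

    -- `A₁` and `B₂` are Ã and B̃ of the overview; `E t` below is its remainder B̃ - tJ.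
    J A₁ B₂ : (Carrier X → S) → Carrier X → S
    J γ (v , k)  = mean γ v
    A₁ γ x       = γ (rot G₁ x)
    B₂ γ (v , k) = walk G₂ (λ k → γ (v , k)) k

    E : S → (Carrier X → S) → Carrier X → S
    E t γ x = B₂ γ x - t * J γ x

    deviation : (Carrier X → S) → Carrier X → S
    deviation γ (v , k) = dev K (λ k → γ (v , k)) k

    Q-fibres : ∀ γ → Q X γ ≈ ∑ V (λ v → Q K (λ k → γ (v , k)))
    Q-fibres γ = ∑-⊗ V K _

    Q-J : ∀ γ → Q X (J γ) ≈ ∣ K ∣ * Q V (mean γ)
    Q-J γ = trans (Q-fibres (J γ)) (trans (∑-cong V (λ v → Q-const K (mean γ v))) (∑-* V ∣ K ∣ _))

    Q-J+deviation : ∀ γ → Q X γ ≈ Q X (J γ) + Q X (deviation γ)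
    Q-J+deviation γ = trans (Q-fibres γ) (trans
      (∑-cong V (λ v → trans (Q-dev K (λ k → γ (v , k))) (+-congʳ (sym (Q-const K (mean γ v))))))
      (trans (∑-+ V _ _) (+-cong (sym (Q-fibres (J γ))) (sym (Q-fibres (deviation γ))))))

    J-contracts : ∀ γ → Q X (J γ) ≤ Q X γ
    J-contracts γ = ≤-respʳ (sym (Q-J+deviation γ)) (x≤x+y (Q-nonNeg X (deviation γ)))

    deviation-contracts : ∀ γ → Q X (deviation γ) ≤ Q X γ
    deviation-contracts γ = ≤-respʳ (trans (+-comm _ _) (sym (Q-J+deviation γ)))
      (x≤x+y (Q-nonNeg X (J γ)))

    A₁-isometry : ∀ γ → Q X (A₁ γ) ≈ Q X γ
    A₁-isometry γ = sym (∑-bij X X (rot-↔ G₁) (λ x → γ x * γ x))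

    B₂-contracts : ∀ γ → Q X (B₂ γ) ≤ Q X γ
    B₂-contracts γ = ≤-respˡ (sym (Q-fibres (B₂ γ))) (≤-respʳ (sym (Q-fibres γ))
      (∑-mono V (λ v → walk-contracts G₂ (λ k → γ (v , k)))))

    -- The outer `B₂` averages over i and the inner one over j. The exchange of j′ and i′ in the
    -- product concerns only the label of the reverse edge, which a walk forgets.
    walk-zigzag : ∀ α x → walk (G₁ ⓩ G₂) α x ≈ B₂ (A₁ (B₂ α)) x
    walk-zigzag α (v , k) = avg-⊗ L L _

    J-cong : ∀ {γ η} → (∀ x → γ x ≈ η x) → ∀ x → J γ x ≈ J η x
    J-cong h (v , k) = avg-cong K (λ k → h (v , k))

    J-+ : ∀ γ η x → J (λ x → γ x + η x) x ≈ J γ x + J η x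
    J-+ γ η (v , k) = avg-+ K _ _

    J-* : ∀ c γ x → J (λ x → c * γ x) x ≈ c * J γ x
    J-* c γ (v , k) = avg-* K c _

    B₂-cong : ∀ {γ η} → (∀ x → γ x ≈ η x) → ∀ x → B₂ γ x ≈ B₂ η x
    B₂-cong h (v , k) = avg-cong L (λ i → h _)

    B₂-+ : ∀ γ η x → B₂ (λ x → γ x + η x) x ≈ B₂ γ x + B₂ η x
    B₂-+ γ η (v , k) = avg-+ L _ _

    E-cong : ∀ t {γ η} → (∀ x → γ x ≈ η x) → ∀ x → E t γ x ≈ E t η x
    E-cong t h x = +-cong (B₂-cong h x) (-‿cong (*-congˡ (J-cong h x)))

    E-+ : ∀ t γ η x → E t (λ x → γ x + η x) x ≈ E t γ x + E t η x
    E-+ t γ η x = trans (+-cong (B₂-+ γ η x) (-‿cong (*-congˡ (J-+ γ η x))))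
      (solve 5 (λ t b c j k → (b :+ c) :- t :* (j :+ k) := (b :- t :* j) :+ (c :- t :* k))
        refl t (B₂ γ x) (B₂ η x) (J γ x) (J η x))

    B₂-split : ∀ t γ x → B₂ γ x ≈ t * J γ x + E t γ x
    B₂-split t γ x = solve 2 (λ b j → b := j :+ (b :- j)) refl (B₂ γ x) (t * J γ x)

    -- The right factor B̃ is split only behind J. In EÃB̃ the second bound uses it as a
    -- contraction; the first bound splits it there as well.
    zigzag-split : ∀ t α x → B₂ (A₁ (B₂ α)) x ≈
      t * (t * J (A₁ (J α)) x + J (A₁ (E t α)) x) + E t (A₁ (B₂ α)) x
    zigzag-split t α x = trans (B₂-split t (A₁ (B₂ α)) x) (+-congʳ (*-congˡ (begin
      J (A₁ (B₂ α)) x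
        ≈⟨ J-cong {η = λ x → t * A₁ (J α) x + A₁ (E t α) x} (λ x → B₂-split t α (rot G₁ x)) x ⟩
      J (λ x → t * A₁ (J α) x + A₁ (E t α) x) x          ≈⟨ J-+ (λ x → t * A₁ (J α) x) (A₁ (E t α)) x ⟩
      J (λ x → t * A₁ (J α) x) x + J (A₁ (E t α)) x      ≈⟨ +-congʳ (J-* t (A₁ (J α)) x) ⟩
      t * J (A₁ (J α)) x + J (A₁ (E t α)) x              ∎)))
      where open import Relation.Binary.Reasoning.Setoid setoid

    -- Both `B₂` and `J` preserve the sum over a fibre. Hence the range of `E 1#` is orthogonal to
    -- the functions constant on fibres.
    E₁-sum : ∀ γ v → ∑ K (λ k → E 1# γ (v , k)) ≈ 0#
    E₁-sum γ v = trans (∑-+ K _ _) (trans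
      (+-cong (∑-walk G₂ (λ k → γ (v , k))) (∑-const K _)) (trans
      (+-congʳ (sym (∣∣*avg K (λ k → γ (v , k))))) (trans (+-congʳ (*-congˡ (sym (*-identityˡ _))))
      (-‿cancel _ _))))
      where
      -‿cancel : ∀ n m → n * m + n * (- m) ≈ 0#
      -‿cancel n m = trans (solve 2 (λ n m → n :* m :+ n :* (:- m) := con 0ℚ) refl n m) ι-homo-0

    J⊥E₁ : ∀ ξ η → Q X (λ x → J ξ x + E 1# η x) ≈ Q X (J ξ) + Q X (E 1# η)
    J⊥E₁ ξ η = trans (Q-fibres _) (trans
      (∑-cong V (λ v → trans (pythagoras K (mean ξ v) (E₁-sum η v)) (+-congʳ (sym (Q-const K (mean ξ v))))))
      (trans (∑-+ V _ _) (+-cong (sym (Q-fibres (J ξ))) (sym (Q-fibres (E 1# η))))))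

    module _ {λ₁ μ : S} (0≤λ₁ : 0# ≤ λ₁) (0≤μ : 0# ≤ μ)
             (H₁ : Contracts G₁ λ₁) (H₂ : Contracts G₂ μ) where

      -- On the functions constant on the fibres, A₁ followed by J acts as G₁.
      JAJ-bound : ∀ α → ∑ X α ≈ 0# → Q X (J (A₁ (J α))) ≤ λ₁ * λ₁ * Q X α
      JAJ-bound α ∑α≈0 = ≤-respˡ (sym (Q-J (A₁ (J α)))) (≤-trans
        (*-monoˡ-≤ (∣∣-nonNeg K) (H₁ (mean α) ∑mean≈0))
        (≤-respˡ (trans (*-congˡ (Q-J α))
            (solve 3 (λ l n q → l :* (n :* q) := n :* (l :* q)) refl (λ₁ * λ₁) ∣ K ∣ _))
          (*-monoˡ-≤ (square≥0 λ₁) (J-contracts α))))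
        where
        ∑mean≈0 : ∑ V (mean α) ≈ 0#
        ∑mean≈0 = trans (∑-* V (ν K) _) (trans (*-congˡ (trans (sym (∑-⊗ V K α)) ∑α≈0)) (zeroʳ _))

      -- B₂ acts on a fibre as the identity on constants and as a contraction
      -- by μ on their orthogonal complement.
      E-fibre : ∀ t γ v → Q K (λ k → E t γ (v , k)) ≤
        ∣ K ∣ * ((1# - t) * mean γ v * ((1# - t) * mean γ v)) + μ * μ * Q K (λ k → deviation γ (v , k))
      E-fibre t γ v = ≤-respˡ (sym (trans (Q-cong K rewrite-E) (pythagoras K _ ∑walk≈0)))
        (+-mono-≤ ≤-refl (H₂ _ (∑-dev K _)))
        where
        fibre = λ k → γ (v , k)
        m = mean γ v
        rewrite-E : ∀ k → E t γ (v , k) ≈ (1# - t) * m + walk G₂ (dev K fibre) k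
        rewrite-E k = trans (+-congʳ (walk-dev G₂ fibre k)) (trans
          (+-congʳ (+-congʳ (sym (*-identityˡ m))))
          (solve 4 (λ o t m w → (o :* m :+ w) :- t :* m := (o :- t) :* m :+ w) refl 1# t m _))
        ∑walk≈0 : ∑ K (walk G₂ (dev K fibre)) ≈ 0#
        ∑walk≈0 = trans (∑-walk G₂ _) (∑-dev K fibre)

      -- The reason for t = 1 - μ: the factor 1 - t on constants then equals the factor μ on their
      -- complement, and the two parts recombine to the whole of γ.
      E-bound : ∀ {t} → t + μ ≈ 1# → ∀ γ → Q X (E t γ) ≤ μ * μ * Q X γ
      E-bound {t} t+μ≈1 γ = ≤-respˡ (sym (Q-fibres (E t γ))) (≤-trans
        (∑-mono V (E-fibre t γ))
        (≤-reflexive (trans (∑-cong V per-fibre)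
          (trans (∑-* V (μ * μ) _) (*-congˡ (sym (Q-fibres γ)))))))
        where
        1-t≈μ : 1# - t ≈ μ
        1-t≈μ = trans (+-congʳ (sym t+μ≈1)) (solve 2 (λ t m → (t :+ m) :- t := m) refl t μ)
        per-fibre : ∀ v →
          ∣ K ∣ * ((1# - t) * mean γ v * ((1# - t) * mean γ v)) + μ * μ * Q K (λ k → deviation γ (v , k))
          ≈ μ * μ * Q K (λ k → γ (v , k))
        per-fibre v = trans (+-congʳ (*-congˡ (*-cong (*-congʳ 1-t≈μ) (*-congʳ 1-t≈μ)))) (trans
          (solve 4 (λ n u m q → n :* (u :* m :* (u :* m)) :+ u :* u :* q := u :* u :* (n :* (m :* m) :+ q))
            refl ∣ K ∣ μ (mean γ v) _)
          (*-congˡ (sym (Q-dev K (λ k → γ (v , k))))))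

      -- At t = 1 the factor 1 - t on constants is zero, so only the deviation survives on the
      -- right. This refinement is what `cross-bound` feeds on.
      E₁-bound : ∀ γ → Q X (E 1# γ) ≤ μ * μ * Q X (deviation γ)
      E₁-bound γ = ≤-respˡ (sym (Q-fibres (E 1# γ))) (≤-trans
        (∑-mono V (E-fibre 1# γ))
        (≤-reflexive (trans (∑-cong V per-fibre)
          (trans (∑-* V (μ * μ) _) (*-congˡ (sym (Q-fibres (deviation γ))))))))
        where
        per-fibre : ∀ v →
          ∣ K ∣ * ((1# - 1#) * mean γ v * ((1# - 1#) * mean γ v)) + μ * μ * Q K (λ k → deviation γ (v , k))
          ≈ μ * μ * Q K (λ k → deviation γ (v , k))
        per-fibre v = solve 4 (λ n o m q → n :* ((o :- o) :* m :* ((o :- o) :* m)) :+ q := q)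
          refl ∣ K ∣ 1# (mean γ v) _

      -- The triangle inequality would give 2μ here. Instead the squared norms of the orthogonal
      -- summands add up, one bounded through `deviation α` and the other through `J α`, and these
      -- two parts together make up `Q X α`.
      cross-bound : ∀ α → Q X (λ x → J (A₁ (E 1# α)) x + E 1# (A₁ (J α)) x) ≤ μ * μ * Q X α
      cross-bound α = ≤-respˡ (sym (J⊥E₁ _ _)) (≤-respʳ
        (trans (sym (distribˡ (μ * μ) _ _)) (*-congˡ (trans (+-comm _ _) (sym (Q-J+deviation α)))))
        (+-mono-≤
          (≤-trans (J-contracts _) (≤-respˡ (sym (A₁-isometry (E 1# α))) (E₁-bound α)))
          (≤-trans (E₁-bound _) (*-monoˡ-≤ (square≥0 μ)
            (≤-trans (deviation-contracts _) (≤-reflexive (A₁-isometry (J α))))))))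

      E₁AE₁-bound : ∀ α → Q X (E 1# (A₁ (E 1# α))) ≤ μ * μ * (μ * μ) * Q X α
      E₁AE₁-bound α = ≤-trans (E₁-bound _) (≤-respʳ (sym (*-assoc _ _ _)) (*-monoˡ-≤ (square≥0 μ)
        (≤-trans (deviation-contracts _) (≤-respˡ (sym (A₁-isometry (E 1# α)))
          (≤-trans (E₁-bound α) (*-monoˡ-≤ (square≥0 μ) (deviation-contracts α)))))))

      zigzag-bound : Contracts (G₁ ⓩ G₂) (λ₁ + μ + μ * μ)
      zigzag-bound α ∑α≈0 = ≤-respˡ (sym (Q-cong X split))
        (Q-+-≤ X (+-nonNeg 0≤λ₁ 0≤μ) (square≥0 μ) (Q-nonNeg X α)
          (Q-+-≤ X 0≤λ₁ 0≤μ (Q-nonNeg X α) (JAJ-bound α ∑α≈0) (cross-bound α))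
          (E₁AE₁-bound α))
        where
        open import Relation.Binary.Reasoning.Setoid setoid
        E₁A-split : ∀ x → E 1# (A₁ (B₂ α)) x ≈ E 1# (A₁ (J α)) x + E 1# (A₁ (E 1# α)) x
        E₁A-split x = trans
          (E-cong 1# {η = λ x → A₁ (J α) x + A₁ (E 1# α) x}
              (λ x → trans (B₂-split 1# α (rot G₁ x)) (+-congʳ (*-identityˡ _))) x)
          (E-+ 1# (A₁ (J α)) (A₁ (E 1# α)) x)
        split : ∀ x → walk (G₁ ⓩ G₂) α x ≈
          (J (A₁ (J α)) x + (J (A₁ (E 1# α)) x + E 1# (A₁ (J α)) x)) + E 1# (A₁ (E 1# α)) x
        split x = begin
          walk (G₁ ⓩ G₂) α x
            ≈⟨ trans (walk-zigzag α x) (zigzag-split 1# α x) ⟩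
          1# * (1# * J (A₁ (J α)) x + J (A₁ (E 1# α)) x) + E 1# (A₁ (B₂ α)) x
            ≈⟨ +-cong (trans (*-identityˡ _) (+-congʳ (*-identityˡ _))) (E₁A-split x) ⟩
          (J (A₁ (J α)) x + J (A₁ (E 1# α)) x) + (E 1# (A₁ (J α)) x + E 1# (A₁ (E 1# α)) x)
            ≈⟨ solve 4 (λ a b c d → (a :+ b) :+ (c :+ d) := (a :+ (b :+ c)) :+ d) refl _ _ _ _ ⟩
          (J (A₁ (J α)) x + (J (A₁ (E 1# α)) x + E 1# (A₁ (J α)) x)) + E 1# (A₁ (E 1# α)) x ∎

      zigzag-bound′ : ∀ {t} → 0# ≤ t → t + μ ≈ 1# → Contracts (G₁ ⓩ G₂) (t * (t * λ₁ + μ) + μ)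
      zigzag-bound′ {t} 0≤t t+μ≈1 α ∑α≈0 = ≤-respˡ
        (sym (Q-cong X (λ x → trans (walk-zigzag α x) (zigzag-split t α x))))
        (Q-+-≤ X (*-nonNeg 0≤t (+-nonNeg (*-nonNeg 0≤t 0≤λ₁) 0≤μ)) 0≤μ (Q-nonNeg X α)
          (Q-*-≤ X t (Q-+-≤ X (*-nonNeg 0≤t 0≤λ₁) 0≤μ (Q-nonNeg X α)
            (Q-*-≤ X t (JAJ-bound α ∑α≈0))
            (≤-trans (J-contracts _) (≤-respˡ (sym (A₁-isometry (E t α))) (E-bound t+μ≈1 α)))))
          (≤-trans (E-bound t+μ≈1 _) (*-monoˡ-≤ (square≥0 μ)
            (≤-respˡ (sym (A₁-isometry (B₂ α))) (B₂-contracts α)))))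

-- The function f and its basic properties

module Bound (R : OrderedAlgebra) where
  open import Defs using (FinSet; Carrier; Graph; _ⓩ_)
  open OrderedAlgebra R hiding (zero) renaming (Carrier to S)
  open OrderedAlgebraProperties R
  open Sums R
  open Forms R
  open Expansion R

  -- Done for norms, where the factor enters linearly and `≤-*-⊓` applies; then squared again.
  Contracts-⊓ : {V L : FinSet} (G : Graph V L) {c d : S} → 0# ≤ c → 0# ≤ d →
    Contracts G c → Contracts G d → Contracts G (c ⊓ d)
  Contracts-⊓ {V} G 0≤c 0≤d H K α ∑α≈0 = ≤*√⇒≤ (Q-nonNeg V _) (Q-nonNeg V α) (⊓-glb 0≤c 0≤d)
    (≤-*-⊓ (√-nonNeg _)
      (√≤*√ (Q-nonNeg V _) (Q-nonNeg V α) 0≤c (H α ∑α≈0))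
      (√≤*√ (Q-nonNeg V _) (Q-nonNeg V α) 0≤d (K α ∑α≈0)))

  Contracts-1 : {V L : FinSet} (G : Graph V L) → Contracts G 1#
  Contracts-1 G α _ = ≤-respʳ (sym (trans (*-congʳ (*-identityˡ 1#)) (*-identityˡ _))) (walk-contracts G α)

  -- The overview's μ and t. Truncation keeps t nonnegative when y > 1, and it is harmless because
  -- every walk contracts by 1.
  clip gap : S → S
  clip y = y ⊓ 1#
  gap y = 1# - clip y

  zigzagBound : S → S → S
  zigzagBound x y = (x + y + y * y) ⊓ (gap y * (gap y * x + clip y) + clip y)

  zigzagBound-cong : ∀ {x y u v} → x ≈ u → y ≈ v → zigzagBound x y ≈ zigzagBound u v
  zigzagBound-cong p q = ⊓-cong (+-cong (+-cong p q) (*-cong q q))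
    (+-cong (*-cong gap-cong (+-cong (*-cong gap-cong p) clip-cong)) clip-cong)
    where
    clip-cong = ⊓-cong q refl
    gap-cong  = +-congˡ (-‿cong clip-cong)

  0≤1 : 0# ≤ 1#
  0≤1 = ≤-respʳ (*-identityˡ 1#) (square≥0 1#)

  module _ {x y : S} (0≤x : 0# ≤ x) (0≤y : 0# ≤ y) where

    0≤clip : 0# ≤ clip y
    0≤clip = ⊓-glb 0≤y 0≤1

    0≤gap : 0# ≤ gap y
    0≤gap = x≤y⇒0≤y-x (x⊓y≤y y 1#)

    0≤bound : 0# ≤ x + y + y * y
    0≤bound = +-nonNeg (+-nonNeg 0≤x 0≤y) (square≥0 y)

    0≤bound′ : 0# ≤ gap y * (gap y * x + clip y) + clip y
    0≤bound′ = +-nonNeg (*-nonNeg 0≤gap (+-nonNeg (*-nonNeg 0≤gap 0≤x) 0≤clip)) 0≤clip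

    zigzagBound-nonNeg : 0# ≤ zigzagBound x y
    zigzagBound-nonNeg = ⊓-glb 0≤bound 0≤bound′

    zigzag-contracts : {V K L : FinSet} (G₁ : Graph V K) (G₂ : Graph K L) →
      Contracts G₁ x → Contracts G₂ y → Contracts (G₁ ⓩ G₂) (zigzagBound x y)
    zigzag-contracts G₁ G₂ C₁ C₂ = Contracts-⊓ (G₁ ⓩ G₂) 0≤bound 0≤bound′
      (zigzag-bound G₁ G₂ 0≤x 0≤y C₁ C₂)
      -- `G₂` contracts by y and, like every walk, by 1, hence by `clip y`.
      (zigzag-bound′ G₁ G₂ 0≤x 0≤clip C₁ (Contracts-⊓ G₂ 0≤y 0≤1 C₂ (Contracts-1 G₂))
        0≤gap (solve 2 (λ o m → (o :- m) :+ m := o) refl 1# (clip y)))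

-- Between bounds on norms and bounds on squared norms

module Norms (R : OrderedAlgebra) where
  open import Defs using (FinSet; Carrier; _⊗_; Graph; _ⓩ_)
  open OrderedAlgebra R hiding (zero) renaming (Carrier to S)
  open OrderedAlgebraProperties R
  open Sums R
  open Forms R
  open Expansion R
  open Bound R

  -- Over ℝ these are ‖_‖, ⟪_, 1⟫ and _·_.
  module _
    (norm total : (V : FinSet) → (Carrier V → S) → S)
    (image : (V L : FinSet) → Graph V L → (Carrier V → S) → Carrier V → S)
    (norm≈  : ∀ V α → norm V α ≈ √ Q V α)
    (total≈ : ∀ V α → total V α ≈ ∑ V α)
    (image≈ : ∀ V L G α u → image V L G α u ≈ walk G α u) where

    NormBound : (V L : FinSet) → Graph V L → S → Set
    NormBound V L G c = ∀ (α : Carrier V → S) → total V α ≈ 0# → ¬ (∀ v → α v ≈ 0#) →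
      norm V (image V L G α) ≤ c * norm V α

    module _ {V L : FinSet} (G : Graph V L) {c : S} (0≤c : 0# ≤ c) where

      private
        norm-image : ∀ α → norm V (image V L G α) ≈ √ Q V (image V L G α)
        norm-image α = norm≈ V (image V L G α)

        Q-image : ∀ α → Q V (image V L G α) ≈ Q V (walk G α)
        Q-image α = Q-cong V (image≈ V L G α)

      -- If α vanishes, then so does its image, and ≤-stable excludes the middle.
      NormBound⇒Contracts : NormBound V L G c → Contracts G c
      NormBound⇒Contracts H α ∑α≈0 = ≤-stable λ ¬goal → ¬goal (≤-respˡ (Q-image α)
        (≤*√⇒≤ (Q-nonNeg V _) (Q-nonNeg V α) 0≤c
          (≤-respˡ (norm-image α) (≤-respʳ (*-congˡ (norm≈ V α))
            (H α (trans (total≈ V α) ∑α≈0)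
              (λ α≈0 → ¬goal (≤-trans (walk-contracts G α)
                (≤-respˡ (sym (∑-zero V (λ v → trans (*-congʳ (α≈0 v)) (zeroˡ _))))
                  (*-nonNeg (square≥0 c) (Q-nonNeg V α))))))))))

      Contracts⇒NormBound : Contracts G c → NormBound V L G c
      Contracts⇒NormBound H α ∑α≈0 _ = ≤-respˡ (sym (norm-image α)) (≤-respʳ (*-congˡ (sym (norm≈ V α)))
        (√≤*√ (Q-nonNeg V _) (Q-nonNeg V α) 0≤c
          (≤-respˡ (sym (Q-image α)) (H α (trans (sym (total≈ V α)) ∑α≈0)))))

    zigzag-normBound : ∀ {x y} → 0# ≤ x → 0# ≤ y → (V K L : FinSet) (G₁ : Graph V K) (G₂ : Graph K L) →
      NormBound V K G₁ x → NormBound K L G₂ y → NormBound (V ⊗ K) (L ⊗ L) (G₁ ⓩ G₂) (zigzagBound x y)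
    zigzag-normBound 0≤x 0≤y V K L G₁ G₂ H₁ H₂ =
      Contracts⇒NormBound (G₁ ⓩ G₂) (zigzagBound-nonNeg 0≤x 0≤y)
        (zigzag-contracts 0≤x 0≤y G₁ G₂ (NormBound⇒Contracts G₁ 0≤x H₁) (NormBound⇒Contracts G₂ 0≤y H₂))

-- The Cauchy reals as an ordered algebra

module RealNumbers where
  import Defs as R
  open import Defs using (ℝ; mkℝ; seq; cauchy; fromℚ; 0ℝ; 1ℝ;
                      bounded; bisect; width; module Q; module Bisection)
  open ≡ using (refl; sym; trans; cong; subst; subst₂)
  open import Data.Rational
  open +-*-Solver using (solve; _:=_; _:+_; _:*_; :-_; _:-_; con)

  Eventually : (ℕ → Set) → Set
  Eventually P = ∃ λ N → ∀ n → N ℕ.≤ n → P n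

  map-ev : ∀ {P P′ : ℕ → Set} → (∀ n → P n → P′ n) → Eventually P → Eventually P′
  map-ev f (N , h) = N , λ n N≤n → f n (h n N≤n)

  zip-ev : ∀ {P P′ P″ : ℕ → Set} → (∀ n → P n → P′ n → P″ n) →
           Eventually P → Eventually P′ → Eventually P″
  zip-ev f (N , h) (N′ , h′) = N ℕ.⊔ N′ , λ n N⊔N′≤n →
    f n (h n (ℕₚ.m⊔n≤o⇒m≤o N N′ N⊔N′≤n)) (h′ n (ℕₚ.m⊔n≤o⇒n≤o N N′ N⊔N′≤n))

  0<ε*½ : ∀ {ε} → 0ℚ < ε → 0ℚ < ε * ½
  0<ε*½ 0<ε = Q.*-pos 0<ε Q.0<½

  p≤p+q : ∀ {p q} → 0ℚ ≤ q → p ≤ p + q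
  p≤p+q {p} {q} 0≤q = subst (_≤ p + q) (ℚₚ.+-identityʳ p) (ℚₚ.+-monoʳ-≤ p 0≤q)

  -- A tolerance d with k d ≤ ε. The extra d ≤ 1 serves error terms such as (a + b + d) d, whose
  -- first factor must be bounded before d is chosen.
  small : ∀ k {ε} → 0ℚ < k → 0ℚ < ε → ∃ λ d → 0ℚ < d × d ≤ 1ℚ × k * d ≤ ε
  small k {ε} 0<k 0<ε with Q.split k 0<ε 0<k
  ... | d , 0<d , eq with ℚₚ.≤-total d 1ℚ
  ...   | inj₁ d≤1 = d , 0<d , d≤1 , ℚₚ.≤-reflexive eq
  ...   | inj₂ 1≤d = 1ℚ , Q.0<1 , ℚₚ.≤-refl ,
    ℚₚ.≤-trans (ℚₚ.*-monoˡ-≤-nonNeg k {{nonNegative (ℚₚ.<⇒≤ 0<k)}} 1≤d) (ℚₚ.≤-reflexive eq)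

  <⇒≱ : ∀ {p q} → p < q → ¬ q ≤ p
  <⇒≱ p<q q≤p = ℚₚ.<-irrefl refl (ℚₚ.<-≤-trans p<q q≤p)

  square-cancel : ∀ {p q} → 0ℚ ≤ q → p * p ≤ q * q → p ≤ q
  square-cancel {p} {q} 0≤q h with p ≤? q
  ... | yes p≤q = p≤q
  ... | no p≰q = contradiction h (<⇒≱ (ℚₚ.≤-<-trans
      (ℚₚ.*-monoˡ-≤-nonNeg q {{nonNegative 0≤q}} (ℚₚ.<⇒≤ q<p))
      (ℚₚ.*-monoˡ-<-pos p {{positive (ℚₚ.≤-<-trans 0≤q q<p)}} q<p)))
    where q<p = ℚₚ.≰⇒> p≰q

  ≈-pointwise : ∀ x y → (∀ n → seq x n ≡ seq y n) → x R.≈ y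
  ≈-pointwise x y h ε 0<ε = 0 , λ n _ → subst (_≤ ε)
    (sym (trans (cong (λ z → ∣ z - seq y n ∣) (h n)) (cong ∣_∣ (ℚₚ.+-inverseʳ (seq y n))))) (ℚₚ.<⇒≤ 0<ε)

  ≤-pointwise : ∀ x y → (∀ n → seq x n ≤ seq y n) → x R.≤ y
  ≤-pointwise x y h ε 0<ε = 0 , λ n _ → ℚₚ.≤-trans (h n) (p≤p+q (ℚₚ.<⇒≤ 0<ε))

  ≈⇒≤ : ∀ x y → x R.≈ y → x R.≤ y
  ≈⇒≤ x y h ε 0<ε = map-ev (λ n → Q.∣∣-elim) (h ε 0<ε)

  ≤-antisym : ∀ x y → x R.≤ y → y R.≤ x → x R.≈ y
  ≤-antisym x y h k ε 0<ε = zip-ev (λ n → Q.∣∣-intro) (h ε 0<ε) (k ε 0<ε)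

  ≤-trans : ∀ x y z → x R.≤ y → y R.≤ z → x R.≤ z
  ≤-trans x y z h k ε 0<ε = zip-ev
    (λ n p q → ℚₚ.≤-trans p (subst (seq y n + ε * ½ ≤_)
      (trans (ℚₚ.+-assoc (seq z n) _ _) (cong (seq z n +_) (Q.halves ε)))
      (ℚₚ.+-monoˡ-≤ (ε * ½) q)))
    (h (ε * ½) (0<ε*½ 0<ε)) (k (ε * ½) (0<ε*½ 0<ε))

  abs-swap : ∀ p q → ∣ p - q ∣ ≡ ∣ q - p ∣
  abs-swap p q = trans (cong ∣_∣ (sym (Q.neg-swap q p))) (ℚₚ.∣-p∣≡∣p∣ (q - p))

  ≈-sym : ∀ x y → x R.≈ y → y R.≈ x
  ≈-sym x y h ε 0<ε = map-ev (λ n → subst (_≤ ε) (abs-swap (seq x n) (seq y n))) (h ε 0<ε)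

  ≈-trans : ∀ x y z → x R.≈ y → y R.≈ z → x R.≈ z
  ≈-trans x y z h k = ≤-antisym x z (≤-trans x y z (≈⇒≤ x y h) (≈⇒≤ y z k))
    (≤-trans z y x (≈⇒≤ z y (≈-sym y z k)) (≈⇒≤ y x (≈-sym x y h)))

  +-mono-≤ : ∀ x y u v → x R.≤ y → u R.≤ v → x R.+ u R.≤ y R.+ v
  +-mono-≤ x y u v h k ε 0<ε = zip-ev
    (λ n p q → ℚₚ.≤-trans (ℚₚ.+-mono-≤ p q) (ℚₚ.≤-reflexive (trans
      (solve 3 (λ y v e → (y :+ e) :+ (v :+ e) := (y :+ v) :+ (e :+ e)) refl (seq y n) (seq v n) (ε * ½))
      (cong (seq y n + seq v n +_) (Q.halves ε)))))
    (h (ε * ½) (0<ε*½ 0<ε)) (k (ε * ½) (0<ε*½ 0<ε))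

  +-cong : ∀ x y u v → x R.≈ y → u R.≈ v → x R.+ u R.≈ y R.+ v
  +-cong x y u v h k = ≤-antisym (x R.+ u) (y R.+ v)
    (+-mono-≤ x y u v (≈⇒≤ x y h) (≈⇒≤ u v k))
    (+-mono-≤ y x v u (≈⇒≤ y x (≈-sym x y h)) (≈⇒≤ v u (≈-sym u v k)))

  *-near : ∀ p q r {A d} → 0ℚ ≤ A → ∣ p ∣ ≤ A → ∣ q - r ∣ ≤ d → ∣ p * q - p * r ∣ ≤ A * d
  *-near p q r {A} {d} 0≤A p≤A q-r≤d = begin
    ∣ p * q - p * r ∣    ≡⟨ cong ∣_∣ (solve 3 (λ p q r → p :* q :- p :* r := p :* (q :- r)) refl p q r) ⟩
    ∣ p * (q - r) ∣      ≡⟨ ℚₚ.∣p*q∣≡∣p∣*∣q∣ p (q - r) ⟩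
    ∣ p ∣ * ∣ q - r ∣    ≤⟨ Q.*-mono-≤ {∣ p ∣} {A} {∣ q - r ∣} {d} (ℚₚ.0≤∣p∣ (q - r)) 0≤A p≤A q-r≤d ⟩
    A * d                ∎
    where open ℚₚ.≤-Reasoning

  Bounded : ℝ → Set
  Bounded x = ∃ λ B → 0ℚ < B × Eventually (λ n → ∣ seq x n ∣ ≤ B)

  *-congˡ : ∀ x y z → y R.≈ z → x R.* y R.≈ x R.* z
  *-congˡ x y z h ε 0<ε = go (bounded x)
    where
    go : Bounded x → Eventually (λ n → ∣ seq x n * seq y n - seq x n * seq z n ∣ ≤ ε)
    go (A , 0<A , bound) =
      let d , 0<d , eq = Q.split A 0<ε 0<A
      in zip-ev (λ n p q → subst (∣ seq x n * seq y n - seq x n * seq z n ∣ ≤_) eq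
           (*-near (seq x n) (seq y n) (seq z n) {A} {d} (ℚₚ.<⇒≤ 0<A) p q))
         bound (h d 0<d)

  *-comm : ∀ x y → x R.* y R.≈ y R.* x
  *-comm x y = ≈-pointwise (x R.* y) (y R.* x) (λ n → ℚₚ.*-comm (seq x n) (seq y n))

  *-cong : ∀ x y u v → x R.≈ y → u R.≈ v → x R.* u R.≈ y R.* v
  *-cong x y u v h k = ≈-trans (x R.* u) (x R.* v) (y R.* v) (*-congˡ x u v k)
    (≈-trans (x R.* v) (v R.* x) (y R.* v) (*-comm x v)
      (≈-trans (v R.* x) (v R.* y) (y R.* v) (*-congˡ v x y h) (*-comm v y)))

  -- As a product, negation inherits its Cauchy property and its congruence. The terms of `gap`
  -- therefore read `1ℚ + - 1ℚ * c`.
  -ℝ_ : ℝ → ℝ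
  -ℝ x = fromℚ (- 1ℚ) R.* x

  commutativeRing : CommutativeRing 0ℓ 0ℓ
  commutativeRing = record
    { Carrier = ℝ
    ; _≈_ = R._≈_
    ; _+_ = R._+_
    ; _*_ = R._*_
    ; -_  = -ℝ_
    ; 0#  = 0ℝ
    ; 1#  = 1ℝ
    ; isCommutativeRing = record
      { isRing = record
        { +-isAbelianGroup = record
          { isGroup = record
            { isMonoid = record
              { isSemigroup = record
                { isMagma = record
                  { isEquivalence = record
                    { refl  = λ {x} → ≈-pointwise x x (λ _ → refl)
                    ; sym   = λ {x} {y} → ≈-sym x y
                    ; trans = λ {x} {y} {z} → ≈-trans x y z
                    }
                  ; ∙-cong = λ {x} {y} {u} {v} → +-cong x y u v
                  }
                ; assoc = λ x y z → ≈-pointwise (x R.+ y R.+ z) (x R.+ (y R.+ z))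
                    (λ n → ℚₚ.+-assoc (seq x n) (seq y n) (seq z n))
                }
              ; identity = (λ x → ≈-pointwise (0ℝ R.+ x) x (λ n → ℚₚ.+-identityˡ (seq x n)))
                         , (λ x → ≈-pointwise (x R.+ 0ℝ) x (λ n → ℚₚ.+-identityʳ (seq x n)))
              }
            ; inverse = (λ x → ≈-pointwise ((-ℝ x) R.+ x) 0ℝ
                (λ n → solve 1 (λ x → con (- 1ℚ) :* x :+ x := con 0ℚ) refl (seq x n)))
                      , (λ x → ≈-pointwise (x R.+ (-ℝ x)) 0ℝ
                          (λ n → solve 1 (λ x → x :+ con (- 1ℚ) :* x := con 0ℚ) refl (seq x n)))
            ; ⁻¹-cong = λ {x} {y} → *-congˡ (fromℚ (- 1ℚ)) x y
            }
          ; comm = λ x y → ≈-pointwise (x R.+ y) (y R.+ x) (λ n → ℚₚ.+-comm (seq x n) (seq y n))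
          }
        ; *-cong     = λ {x} {y} {u} {v} → *-cong x y u v
        ; *-assoc    = λ x y z → ≈-pointwise (x R.* y R.* z) (x R.* (y R.* z))
            (λ n → ℚₚ.*-assoc (seq x n) (seq y n) (seq z n))
        ; *-identity = (λ x → ≈-pointwise (1ℝ R.* x) x (λ n → ℚₚ.*-identityˡ (seq x n)))
                     , (λ x → ≈-pointwise (x R.* 1ℝ) x (λ n → ℚₚ.*-identityʳ (seq x n)))
        ; distrib    = (λ x y z → ≈-pointwise (x R.* (y R.+ z)) (x R.* y R.+ x R.* z)
            (λ n → ℚₚ.*-distribˡ-+ (seq x n) (seq y n) (seq z n)))
                     , (λ x y z → ≈-pointwise ((y R.+ z) R.* x) (y R.* x R.+ z R.* x)
                         (λ n → ℚₚ.*-distribʳ-+ (seq x n) (seq y n) (seq z n)))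
        }
      ; *-comm = *-comm
      }
    }

  -- Comparing x and y with precision ε/8 at one sufficiently large index.
  compare : ∀ x y ε → 0ℚ < ε →
    Eventually (λ n → seq x n ≤ seq y n + ε) ⊎ Eventually (λ n → seq y n + ε * ½ * ½ ≤ seq x n)
  compare x y ε 0<ε = decide (cauchy x d 0<d) (cauchy y d 0<d)
    where
    open ℚₚ.≤-Reasoning
    h = ε * ½
    q = h * ½
    d = q * ½
    0<h : 0ℚ < h
    0<h = 0<ε*½ 0<ε
    0<q : 0ℚ < q
    0<q = 0<ε*½ 0<h
    0<d : 0ℚ < d
    0<d = 0<ε*½ 0<q
    below : ∀ a b c e → a ≤ b + d → b ≤ c + h → c ≤ e + d → a ≤ e + ε
    below a b c e p r s = begin
      a                     ≤⟨ p ⟩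
      b + d                 ≤⟨ ℚₚ.+-monoˡ-≤ d r ⟩
      c + h + d             ≤⟨ ℚₚ.+-monoˡ-≤ d (ℚₚ.+-monoˡ-≤ h s) ⟩
      e + d + h + d         ≤⟨ p≤p+q (ℚₚ.<⇒≤ 0<q) ⟩
      e + d + h + d + q     ≡⟨ solve 2 (λ e x → let h = x :* con ½ ; q = h :* con ½ ; d = q :* con ½ in
                                 (((e :+ d) :+ h) :+ d) :+ q := e :+ x) refl e ε ⟩
      e + ε                 ∎
    above : ∀ a b c e → a ≤ b + d → b + h ≤ c → c ≤ e + d → a + q ≤ e
    above a b c e p r s = begin
      a + q                 ≤⟨ ℚₚ.+-monoˡ-≤ q p ⟩
      b + d + q             ≡⟨ solve 2 (λ b x → let h = x :* con ½ ; q = h :* con ½ ; d = q :* con ½ in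
                                 (b :+ d) :+ q := (b :+ h) :- d) refl b ε ⟩
      b + h - d             ≤⟨ ℚₚ.+-monoˡ-≤ (- d) (ℚₚ.≤-trans r s) ⟩
      e + d - d             ≡⟨ solve 2 (λ e d → (e :+ d) :- d := e) refl e d ⟩
      e                     ∎
    decide : (∃ λ N → ∀ m n → N ℕ.≤ m → N ℕ.≤ n → ∣ seq x m - seq x n ∣ ≤ d) →
             (∃ λ N → ∀ m n → N ℕ.≤ m → N ℕ.≤ n → ∣ seq y m - seq y n ∣ ≤ d) →
             Eventually (λ n → seq x n ≤ seq y n + ε) ⊎ Eventually (λ n → seq y n + q ≤ seq x n)
    decide (Nx , hx) (Ny , hy) = Sum.map
      (λ le → M , λ n M≤n → below (seq x n) (seq x M) (seq y M) (seq y n)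
        (near x hx n M (ℕₚ.≤-trans Nx≤M M≤n) Nx≤M) le (near y hy M n Ny≤M (ℕₚ.≤-trans Ny≤M M≤n)))
      (λ ge → M , λ n M≤n → above (seq y n) (seq y M) (seq x M) (seq x n)
        (near y hy n M (ℕₚ.≤-trans Ny≤M M≤n) Ny≤M) ge (near x hx M n Nx≤M (ℕₚ.≤-trans Nx≤M M≤n)))
      (ℚₚ.≤-total (seq x M) (seq y M + h))
      where
      M = Nx ℕ.⊔ Ny
      Nx≤M = ℕₚ.m≤m⊔n Nx Ny
      Ny≤M = ℕₚ.m≤n⊔m Nx Ny
      near : ∀ z {N} → (∀ m n → N ℕ.≤ m → N ℕ.≤ n → ∣ seq z m - seq z n ∣ ≤ d) →
             ∀ m n → N ℕ.≤ m → N ℕ.≤ n → seq z m ≤ seq z n + d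
      near z hz m n N≤m N≤n = Q.∣∣-elim {seq z m} {seq z n} (hz m n N≤m N≤n)

  0<quarter : ∀ {ε} → 0ℚ < ε → 0ℚ < ε * ½ * ½
  0<quarter 0<ε = 0<ε*½ (0<ε*½ 0<ε)

  ≤-weaken : ∀ p q {r e} → 0ℚ ≤ r → 0ℚ ≤ e → p + r ≤ q → p ≤ q + e
  ≤-weaken p q {r} {e} 0≤r 0≤e p+r≤q = begin
    p       ≤⟨ p≤p+q {p} {r} 0≤r ⟩
    p + r   ≤⟨ p+r≤q ⟩
    q       ≤⟨ p≤p+q {q} {e} 0≤e ⟩
    q + e   ∎
    where open ℚₚ.≤-Reasoning

  half< : ∀ q → 0ℚ < q → q * ½ < q
  half< q 0<q = subst₂ _<_ (ℚₚ.+-identityʳ (q * ½)) (Q.halves q) (ℚₚ.+-monoʳ-< (q * ½) (0<ε*½ {q} 0<q))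

  ≤-excludes : ∀ x y q → 0ℚ < q → Eventually (λ n → seq y n + q ≤ seq x n) → ¬ (x R.≤ y)
  ≤-excludes x y q 0<q (N , y+q≤x) x≤y = clash (x≤y (q * ½) (0<ε*½ {q} 0<q))
    where
    clash : ¬ Eventually (λ n → seq x n ≤ seq y n + q * ½)
    clash (N′ , x≤y+q/2) = <⇒≱ (ℚₚ.+-monoʳ-< (seq y M) (half< q 0<q))
      (ℚₚ.≤-trans (y+q≤x M (ℕₚ.m≤m⊔n N N′)) (x≤y+q/2 M (ℕₚ.m≤n⊔m N N′)))
      where M = N ℕ.⊔ N′

  -- For each ε, `compare` yields either the inequality up to ε or a positive gap the other way, and
  -- the gap refutes x ≤ y.
  ≤-stable : ∀ x y → ¬ ¬ (x R.≤ y) → x R.≤ y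
  ≤-stable x y ¬¬h ε 0<ε = Sum.[_,_]′ (λ h → h)
      (λ y+q≤x → ⊥-elim (¬¬h (≤-excludes x y (ε * ½ * ½) (0<quarter {ε} 0<ε) y+q≤x)))
    (compare x y ε 0<ε)

  -- If both inequalities are denied, the second outcome of `compare` is impossible for every ε, as
  -- it gives y ≤ x. The first outcome for every ε is x ≤ y.
  ≤-total : ∀ x y → ¬ ¬ (x R.≤ y ⊎ y R.≤ x)
  ≤-total x y ¬total = ¬total (inj₁ λ ε 0<ε →
    Sum.[_,_]′ (λ h → h) (λ y+q≤x → contradiction (inj₂ (y≤x 0<ε y+q≤x)) ¬total) (compare x y ε 0<ε))
    where
    y≤x : ∀ {ε} → 0ℚ < ε → Eventually (λ n → seq y n + ε * ½ * ½ ≤ seq x n) → y R.≤ x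
    y≤x 0<ε y+q≤x ε′ 0<ε′ = map-ev
      (λ n → ≤-weaken (seq y n) (seq x n) (ℚₚ.<⇒≤ (0<quarter 0<ε)) (ℚₚ.<⇒≤ 0<ε′)) y+q≤x

  -- A nonnegative real may have slightly negative terms. Shifted by d both factors are nonnegative,
  -- and their product differs from ab by (a + b + d) d.
  *-near-nonNeg : ∀ a b {A B d ε} → 0ℚ ≤ d → d ≤ 1ℚ → (A + B + 1ℚ) * d ≤ ε →
    ∣ a ∣ ≤ A → 0ℚ ≤ a + d → ∣ b ∣ ≤ B → 0ℚ ≤ b + d → 0ℚ ≤ a * b + ε
  *-near-nonNeg a b {A} {B} {d} {ε} 0≤d d≤1 kd≤ε a≤A 0≤a+d b≤B 0≤b+d = begin
    0ℚ                              ≤⟨ Q.*-mono-≤ {0ℚ} {a + d} {0ℚ} {b + d} ℚₚ.≤-refl 0≤a+d 0≤a+d 0≤b+d ⟩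
    (a + d) * (b + d)
      ≡⟨ solve 3 (λ a b d → (a :+ d) :* (b :+ d) := a :* b :+ (a :+ b :+ d) :* d) refl a b d ⟩
    a * b + (a + b + d) * d         ≤⟨ ℚₚ.+-monoʳ-≤ (a * b) (ℚₚ.*-monoʳ-≤-nonNeg d {{nonNegative 0≤d}}
        (ℚₚ.+-mono-≤ (ℚₚ.+-mono-≤ (ℚₚ.≤-trans (Q.p≤∣p∣ a) a≤A) (ℚₚ.≤-trans (Q.p≤∣p∣ b) b≤B)) d≤1)) ⟩
    a * b + (A + B + 1ℚ) * d        ≤⟨ ℚₚ.+-monoʳ-≤ (a * b) kd≤ε ⟩
    a * b + ε                       ∎
    where open ℚₚ.≤-Reasoning

  *-nonNeg : ∀ x y → 0ℝ R.≤ x → 0ℝ R.≤ y → 0ℝ R.≤ x R.* y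
  *-nonNeg x y 0≤x 0≤y ε 0<ε = go (bounded x) (bounded y)
    where
    go : Bounded x → Bounded y → Eventually (λ n → 0ℚ ≤ seq x n * seq y n + ε)
    go (A , 0<A , bx) (B , 0<B , by) =
      let d , 0<d , d≤1 , kd≤ε = small (A + B + 1ℚ) (Q.+-pos (Q.+-nonNeg (ℚₚ.<⇒≤ 0<A) (ℚₚ.<⇒≤ 0<B)) Q.0<1) 0<ε
      in zip-ev (λ n (p , p′) (r , r′) → *-near-nonNeg (seq x n) (seq y n) (ℚₚ.<⇒≤ 0<d) d≤1 kd≤ε p p′ r r′)
        (zip-ev (λ _ → _,_) bx (0≤x d 0<d)) (zip-ev (λ _ → _,_) by (0≤y d 0<d))

  square-nonNeg : ∀ p → 0ℚ ≤ p * p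
  square-nonNeg p with ℚₚ.≤-total 0ℚ p
  ... | inj₁ 0≤p = Q.*-mono-≤ ℚₚ.≤-refl 0≤p 0≤p 0≤p
  ... | inj₂ p≤0 = subst (0ℚ ≤_) (solve 1 (λ p → (:- p) :* (:- p) := p :* p) refl p)
      (Q.*-mono-≤ ℚₚ.≤-refl 0≤-p 0≤-p 0≤-p)
    where
    0≤-p : 0ℚ ≤ - p
    0≤-p = ℚₚ.neg-antimono-≤ p≤0

  square-cancel-≤ : ∀ x y → 0ℝ R.≤ y → x R.* x R.≤ y R.* y → x R.≤ y
  square-cancel-≤ x y 0≤y h ε 0<ε = zip-ev (λ n → go n) (0≤y g 0<g) (h (g * g) (Q.*-pos 0<g 0<g))
    where
    open ℚₚ.≤-Reasoning
    -- With ε = 4g, (b + ε)² - (b² + g²) = 8g(b + g) + 7g², and both summands are nonnegative once b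
    -- + g is.
    g = ε * ½ * ½
    0<g : 0ℚ < g
    0<g = 0<quarter 0<ε
    0≤g = ℚₚ.<⇒≤ 0<g
    go : ∀ n → 0ℚ ≤ seq y n + g → seq x n * seq x n ≤ seq y n * seq y n + g * g → seq x n ≤ seq y n + ε
    go n 0≤b+g a²≤ = square-cancel (begin
        0ℚ                 ≤⟨ Q.+-nonNeg 0≤b+g (Q.+-nonNeg (Q.+-nonNeg 0≤g 0≤g) 0≤g) ⟩
        b + g + (g + g + g) ≡⟨ solve 2 (λ b x → let g = x :* con ½ :* con ½ in
                               b :+ g :+ (g :+ g :+ g) := b :+ x) refl b ε ⟩
        b + ε              ∎)
      (begin
        seq x n * seq x n  ≤⟨ a²≤ ⟩
        b * b + g * g      ≤⟨ p≤p+q (Q.+-nonNeg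
                                (scaled 8 (Q.*-mono-≤ ℚₚ.≤-refl 0≤g 0≤g 0≤b+g)) (scaled 7 (square-nonNeg g))) ⟩
        b * b + g * g + (ℤ.+ 8 / 1 * (g * (b + g)) + ℤ.+ 7 / 1 * (g * g))
                           ≡⟨ solve 2 (λ b x → let g = x :* con ½ :* con ½ in
                                b :* b :+ g :* g :+ (con (ℤ.+ 8 / 1) :* (g :* (b :+ g)) :+ con (ℤ.+ 7 / 1) :* (g :* g))
                                := (b :+ x) :* (b :+ x)) refl b ε ⟩
        (b + ε) * (b + ε)  ∎)
      where
      b = seq y n
      scaled : ∀ k {p} → 0ℚ ≤ p → 0ℚ ≤ ℤ.+ k / 1 * p
      scaled k 0≤p = Q.*-mono-≤ {r = 0ℚ} ℚₚ.≤-refl 0≤k 0≤k 0≤p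
        where
        0≤k : 0ℚ ≤ ℤ.+ k / 1
        0≤k = ℚₚ.nonNegative⁻¹ _ {{ℚₚ.normalize-nonNeg k 1}}

  ⊓-near : ∀ p q p′ q′ {e} → p ≤ p′ + e → q ≤ q′ + e → p ⊓ q ≤ p′ ⊓ q′ + e
  ⊓-near p q p′ q′ {e} h k with ℚₚ.⊓-sel p′ q′
  ... | inj₁ eq = subst (λ z → p ⊓ q ≤ z + e) (sym eq) (ℚₚ.≤-trans (ℚₚ.p⊓q≤p p q) h)
  ... | inj₂ eq = subst (λ z → p ⊓ q ≤ z + e) (sym eq) (ℚₚ.≤-trans (ℚₚ.p⊓q≤q p q) k)

  infixl 6 _⊓ℝ_
  _⊓ℝ_ : ℝ → ℝ → ℝ
  x ⊓ℝ y = mkℝ (λ n → seq x n ⊓ seq y n) λ ε 0<ε → near ε (cauchy x ε 0<ε) (cauchy y ε 0<ε)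
    where
    near : ∀ ε → (∃ λ N → ∀ m n → N ℕ.≤ m → N ℕ.≤ n → ∣ seq x m - seq x n ∣ ≤ ε) →
           (∃ λ N → ∀ m n → N ℕ.≤ m → N ℕ.≤ n → ∣ seq y m - seq y n ∣ ≤ ε) →
           ∃ λ N → ∀ m n → N ℕ.≤ m → N ℕ.≤ n → ∣ seq x m ⊓ seq y m - seq x n ⊓ seq y n ∣ ≤ ε
    near ε (Nx , hx) (Ny , hy) = Nx ℕ.⊔ Ny , λ m n N≤m N≤n →
      let Nx≤m = ℕₚ.m⊔n≤o⇒m≤o Nx Ny N≤m
          Ny≤m = ℕₚ.m⊔n≤o⇒n≤o Nx Ny N≤m
          Nx≤n = ℕₚ.m⊔n≤o⇒m≤o Nx Ny N≤n
          Ny≤n = ℕₚ.m⊔n≤o⇒n≤o Nx Ny N≤n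
      in Q.∣∣-intro
        (⊓-near (seq x m) (seq y m) (seq x n) (seq y n)
          (Q.∣∣-elim {seq x m} {seq x n} (hx m n Nx≤m Nx≤n)) (Q.∣∣-elim {seq y m} {seq y n} (hy m n Ny≤m Ny≤n)))
        (⊓-near (seq x n) (seq y n) (seq x m) (seq y m)
          (Q.∣∣-elim {seq x n} {seq x m} (hx n m Nx≤n Nx≤m)) (Q.∣∣-elim {seq y n} {seq y m} (hy n m Ny≤n Ny≤m)))

  ⊓ℝ-glb : ∀ x y z → z R.≤ x → z R.≤ y → z R.≤ x ⊓ℝ y
  ⊓ℝ-glb x y z h k ε 0<ε = zip-ev
    (λ n p q → subst (_≤ seq x n ⊓ seq y n + ε) (ℚₚ.⊓-idem (seq z n))
        (⊓-near (seq z n) (seq z n) (seq x n) (seq y n) p q))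
    (h ε 0<ε) (k ε 0<ε)

  -- With b and w the approximation and its width, b² ≤ q < (b + w)², an error of at most (2b + w)
  -- w. The term p may be slightly negative, but q = p ⊔ 0 exceeds it by at most ε. The width is
  -- taken at the bound B, since q itself changes with n.
  bisect-square : ∀ p n {B d ε} → 0ℚ ≤ B → d ≤ 1ℚ → (B + 1ℚ + (B + 1ℚ) + 1ℚ) * d ≤ ε → 0ℚ ≤ ε →
    ∣ p ∣ ≤ B → 0ℚ ≤ p + ε → width B n ≤ d →
    ∣ bisect (p ⊔ 0ℚ) n * bisect (p ⊔ 0ℚ) n - p ∣ ≤ ε
  bisect-square p n {B} {d} {ε} 0≤B d≤1 kd≤ε 0≤ε p≤B 0≤p+ε width≤d = Q.∣∣-intro
      (ℚₚ.≤-trans (Bisection.bisect-lower q n 0≤q) (ℚₚ.⊔-lub (p≤p+q {p} {ε} 0≤ε) 0≤p+ε))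
      (begin
        p                ≤⟨ ℚₚ.p≤p⊔q (p) 0ℚ ⟩
        q                      ≤⟨ ℚₚ.<⇒≤ (Bisection.bisect-upper q n 0≤q) ⟩
        (b + w) * (b + w)
          ≡⟨ solve 2 (λ b w → (b :+ w) :* (b :+ w) := b :* b :+ (b :+ b :+ w) :* w) refl b w ⟩
        b * b + (b + b + w) * w ≤⟨ ℚₚ.+-monoʳ-≤ (b * b) (Q.*-mono-≤ {b + b + w} {B + 1ℚ + (B + 1ℚ) + 1ℚ} {w} {d} 0≤w 0≤k
                                    (ℚₚ.+-mono-≤ (ℚₚ.+-mono-≤ b≤B+1 b≤B+1) (ℚₚ.≤-trans w≤d d≤1)) w≤d) ⟩
        b * b + (B + 1ℚ + (B + 1ℚ) + 1ℚ) * d ≤⟨ ℚₚ.+-monoʳ-≤ (b * b) kd≤ε ⟩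
        b * b + ε              ∎)
    where
    open ℚₚ.≤-Reasoning
    q = p ⊔ 0ℚ
    b = bisect q n
    w = width q n
    0≤q : 0ℚ ≤ q
    0≤q = ℚₚ.p≤q⊔p (p) 0ℚ
    q≤B : q ≤ B
    q≤B = ℚₚ.⊔-lub (ℚₚ.≤-trans (Q.p≤∣p∣ (p)) p≤B) 0≤B
    w≤d : w ≤ d
    w≤d = ℚₚ.≤-trans (Bisection.width-mono n q≤B) width≤d
    0≤w : 0ℚ ≤ w
    0≤w = ℚₚ.<⇒≤ (Bisection.width-pos n 0≤q)
    0≤B+1 : 0ℚ ≤ B + 1ℚ
    0≤B+1 = Q.+-nonNeg 0≤B (ℚₚ.<⇒≤ Q.0<1)
    0≤k : 0ℚ ≤ B + 1ℚ + (B + 1ℚ) + 1ℚ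
    0≤k = Q.+-nonNeg (Q.+-nonNeg 0≤B+1 0≤B+1) (ℚₚ.<⇒≤ Q.0<1)
    -- The root of B may exceed B when B < 1, but not B + 1.
    b≤B+1 : b ≤ B + 1ℚ
    b≤B+1 = square-cancel 0≤B+1 (begin
      b * b                  ≤⟨ Bisection.bisect-lower q n 0≤q ⟩
      q                      ≤⟨ q≤B ⟩
      B                      ≤⟨ p≤p+q (Q.+-nonNeg (square-nonNeg B) 0≤B+1) ⟩
      B + (B * B + (B + 1ℚ))
        ≡⟨ solve 1 (λ b → b :+ (b :* b :+ (b :+ con 1ℚ)) := (b :+ con 1ℚ) :* (b :+ con 1ℚ)) refl B ⟩
      (B + 1ℚ) * (B + 1ℚ)    ∎)

  √-square : ∀ x → 0ℝ R.≤ x → (R.√ x) R.* (R.√ x) R.≈ x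
  √-square x 0≤x ε 0<ε = go (bounded x)
    where
    go : Bounded x → Eventually (λ n → ∣ bisect (seq x n ⊔ 0ℚ) n * bisect (seq x n ⊔ 0ℚ) n - seq x n ∣ ≤ ε)
    go (B , 0<B , bx) =
      let d , 0<d , d≤1 , kd≤ε = small (B + 1ℚ + (B + 1ℚ) + 1ℚ) (Q.+-pos (Q.+-nonNeg 0≤B+1 0≤B+1) Q.0<1) 0<ε
      in zip-ev (λ n (x≤B , 0≤x+ε) → bisect-square (seq x n) n (ℚₚ.<⇒≤ 0<B) d≤1 kd≤ε (ℚₚ.<⇒≤ 0<ε) x≤B 0≤x+ε)
        (zip-ev (λ _ → _,_) bx (0≤x ε 0<ε)) (Bisection.width-small (ℚₚ.<⇒≤ 0<B) 0<d)
      where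
      0≤B+1 : 0ℚ ≤ B + 1ℚ
      0≤B+1 = Q.+-nonNeg (ℚₚ.<⇒≤ 0<B) (ℚₚ.<⇒≤ Q.0<1)

  -- With g = 1 - c the bound g(gx + c) + c is 1 - g²(1 - x).
  below-1 : ∀ p x y {d e} → 0ℚ ≤ d → 0ℚ ≤ e → x + e ≤ 1ℚ → y + d ≤ 1ℚ →
    let c = y ⊓ 1ℚ ; g = 1ℚ + - 1ℚ * c in p ⊓ (g * (g * x + c) + c) + d * d * e ≤ 1ℚ
  below-1 p x y {d} {e} 0≤d 0≤e x+e≤1 y+d≤1 = begin
    p ⊓ (g * (g * x + c) + c) + d * d * e  ≤⟨ ℚₚ.+-mono-≤ (ℚₚ.p⊓q≤q p (g * (g * x + c) + c))
        (Q.*-mono-≤ {d * d} {g * g} {e} {1ℚ - x} 0≤e (square-nonNeg g)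
          (Q.*-mono-≤ {d} {g} {d} {g} 0≤d (ℚₚ.≤-trans 0≤d d≤g) d≤g d≤g)
          (complement x e x+e≤1)) ⟩
    g * (g * x + c) + c + g * g * (1ℚ - x) ≡⟨ solve 2 (λ x c → let g = con 1ℚ :+ con (- 1ℚ) :* c in
                                               g :* (g :* x :+ c) :+ c :+ g :* g :* (con 1ℚ :- x) := con 1ℚ)
                                             refl x c ⟩
    1ℚ                                     ∎
    where
    open ℚₚ.≤-Reasoning
    c = y ⊓ 1ℚ
    g = 1ℚ + - 1ℚ * c
    complement : ∀ p r → p + r ≤ 1ℚ → r ≤ 1ℚ - p
    complement p r h = subst (_≤ 1ℚ - p) (solve 2 (λ p r → (p :+ r) :- p := r) refl p r) (ℚₚ.+-monoˡ-≤ (- p) h)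
    d≤g : d ≤ g
    d≤g = subst (d ≤_) (solve 1 (λ c → con 1ℚ :- c := con 1ℚ :+ con (- 1ℚ) :* c) refl c)
      (complement c d (ℚₚ.≤-trans (ℚₚ.+-monoˡ-≤ d (ℚₚ.p⊓q≤p y 1ℚ)) y+d≤1))

  orderedAlgebra : OrderedAlgebra
  orderedAlgebra = record
    { commutativeRing = commutativeRing
    ; _≤_         = R._≤_
    ; ≤-reflexive = λ {x} {y} → ≈⇒≤ x y
    ; ≤-trans     = λ {x} {y} {z} → ≤-trans x y z
    ; ≤-antisym   = λ {x} {y} → ≤-antisym x y
    ; ≤-total     = ≤-total
    ; ≤-stable    = λ {x} {y} → ≤-stable x y
    ; +-mono-≤    = λ {x} {y} {u} {v} → +-mono-≤ x y u v
    ; *-nonNeg    = λ {x} {y} → *-nonNeg x y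
    ; square≥0    = λ x → ≤-pointwise 0ℝ (x R.* x) (λ n → square-nonNeg (seq x n))
    ; square-cancel-≤ = λ {x} {y} → square-cancel-≤ x y
    ; ι           = fromℚ
    ; ι-homo-+    = λ p q → ≈-pointwise (fromℚ (p + q)) (fromℚ p R.+ fromℚ q) (λ _ → refl)
    ; ι-homo-*    = λ p q → ≈-pointwise (fromℚ (p * q)) (fromℚ p R.* fromℚ q) (λ _ → refl)
    ; ι-homo-0    = ≈-pointwise 0ℝ 0ℝ (λ _ → refl)
    ; ι-homo-1    = ≈-pointwise 1ℝ 1ℝ (λ _ → refl)
    ; ι-mono      = λ {p} {q} p≤q → ≤-pointwise (fromℚ p) (fromℚ q) (λ _ → p≤q)
    ; √_          = R.√_
    ; √-nonNeg    = λ x → ≤-pointwise 0ℝ (R.√ x)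
        (λ n → Bisection.bisect-nonNeg (seq x n ⊔ 0ℚ) n (ℚₚ.p≤q⊔p (seq x n) 0ℚ))
    ; √-square    = λ {x} → √-square x
    ; _⊓_         = _⊓ℝ_
    ; x⊓y≤x       = λ x y → ≤-pointwise (x ⊓ℝ y) x (λ n → ℚₚ.p⊓q≤p (seq x n) (seq y n))
    ; x⊓y≤y       = λ x y → ≤-pointwise (x ⊓ℝ y) y (λ n → ℚₚ.p⊓q≤q (seq x n) (seq y n))
    ; ⊓-glb       = λ {x} {y} {z} → ⊓ℝ-glb x y z
    }

-- Norms, totals and matrix products of the reals in the abstract setting

module RealNorms where
  import Defs as R
  open import Defs using (ℝ; seq; 0ℝ; 1ℝ; bisect; Carrier; elements; Graph)
  open RealNumbers using (orderedAlgebra; ≈-pointwise; ≈-trans)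
  open OrderedAlgebra orderedAlgebra using (_*_; _≈_; √_; ι)

  -- Comparing one index at a time leaves the Cauchy proofs, which differ, out of the comparison.
  ∑-≗ : ∀ A (f g : Carrier A → ℝ) n → (∀ a → seq (f a) n ≡ seq (g a) n) →
        seq (R.∑ A f) n ≡ seq (Sums.∑ orderedAlgebra A g) n
  ∑-≗ A f g n h = go (elements A)
    where
    go : ∀ as → seq (foldr R._+_ 0ℝ (map f as)) n ≡
                seq (foldr (OrderedAlgebra._+_ orderedAlgebra) 0ℝ (map g as)) n
    go []       = ≡.refl
    go (a ∷ as) = ≡.cong₂ ℚ._+_ (h a) (go as)

  norm≈ : ∀ V (α : Carrier V → ℝ) → R.‖_‖ {V} α ≈ √ Forms.Q orderedAlgebra V α
  norm≈ V α = ≈-pointwise (R.‖_‖ {V} α) (√ Forms.Q orderedAlgebra V α) (λ n →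
    ≡.cong (λ z → bisect (z ℚ.⊔ 0ℚ) n)
      (∑-≗ V (λ v → α v R.* α v) (λ v → α v * α v) n (λ v → ≡.refl)))

  total≈ : ∀ V (α : Carrier V → ℝ) → R.⟪_,_⟫ {V} α (λ _ → 1ℝ) ≈ Sums.∑ orderedAlgebra V α
  total≈ V α = ≈-pointwise (R.⟪_,_⟫ {V} α (λ _ → 1ℝ)) (Sums.∑ orderedAlgebra V α) (λ n →
    ∑-≗ V (λ v → α v R.* 1ℝ) α n (λ v → ℚₚ.*-identityʳ (seq (α v) n)))

  image≈ : ∀ V L (G : Graph V L) (α : Carrier V → ℝ) u →
    R._·_ {V} {L} G α u ≈ Sums.walk orderedAlgebra {V} {L} G α u
  image≈ V L G α u = ≈-trans (R._·_ {V} {L} G α u)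
    (Sums.∑ orderedAlgebra V (λ v → ι (R.adjacency {V} {L} G u v) * α v))
    (Sums.walk orderedAlgebra {V} {L} G α u)
    (≈-pointwise (R._·_ {V} {L} G α u)
      (Sums.∑ orderedAlgebra V (λ v → ι (R.adjacency {V} {L} G u v) * α v)) (λ n →
      ∑-≗ V (λ v → R.fromℚ (R.adjacency {V} {L} G u v) R.* α v)
        (λ v → ι (R.adjacency {V} {L} G u v) * α v) n (λ v → ≡.refl)))
    (Sums.adjacency≈walk orderedAlgebra {V} {L} G α u)

-- A Turing machine for the rotation map

module TuringMachine where
  open ≡ using (_≢_; refl; sym; trans; cong; subst)
  open import Data.Fin using () renaming (#_ to at)
  open import Data.Nat using (zero; suc; _+_)
  open import Defs hiding (_+_; _*_; _≤_; _<_)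

  infix 4 _≋_
  -- Cells spelling a string, up to trailing blanks. Erased cells stay on the list as explicit
  -- blanks, so equality of lists would be too strict.
  data _≋_ : List Symbol → String → Set where
    []    : [] ≋ []
    blank : ∀ {ss} → ss ≋ [] → nothing ∷ ss ≋ []
    _∷_   : ∀ a {ss as} → ss ≋ as → just a ∷ ss ≋ a ∷ as

  written : ∀ as → map just as ≋ as
  written []       = []
  written (a ∷ as) = a ∷ written as

  popped : ∀ {ss as} → ss ≋ as → (proj₁ (pop ss) ∷ proj₂ (pop ss)) ≋ as
  popped []        = blank []
  popped (blank h) = blank h
  popped (a ∷ h)   = a ∷ h

  -- The head separates l (read leftwards) from r (read rightwards); it stands
  -- on the first letter of r under AtRight and on that of l under AtLeft.
  record AtRight (l r : String) (T : Tape) : Set where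
    constructor _,_
    field
      leftOf  : Tape.before T ≋ l
      rightOf : Tape.here T ∷ Tape.after T ≋ r

  record AtLeft (l r : String) (T : Tape) : Set where
    constructor _,_
    field
      leftOf  : Tape.here T ∷ Tape.before T ≋ l
      rightOf : Tape.after T ≋ r

  read-AtRight : ∀ {l r τ} → AtRight l r τ → read τ ≡ r
  read-AtRight {τ = tape _ _ _} (_ , h) = upToBlank-≋ h
    where
    upToBlank-≋ : ∀ {ss as} → ss ≋ as → upToBlank ss ≡ as
    upToBlank-≋ []        = refl
    upToBlank-≋ (blank h) = refl
    upToBlank-≋ (a ∷ h)   = cong (a ∷_) (upToBlank-≋ h)

  write-AtRight : ∀ as → AtRight [] as (write as)
  write-AtRight []       = [] , blank []
  write-AtRight (a ∷ as) = [] , a ∷ written as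

  module _ {a : Letter} where
    eraseRight : ∀ {r T} → AtRight [] (a ∷ r) T → AtRight [] r (act (nothing , right) T)
    eraseRight {T = tape _ _ _} (hl , _ ∷ hr) = blank hl , popped hr

    writeRight : ∀ {l T} → AtRight l [] T → AtRight (a ∷ l) [] (act (just a , right) T)
    writeRight {T = tape _ _ _} (hl , blank hr) = a ∷ hl , popped hr

    eraseLeft : ∀ {l T} → AtLeft (a ∷ l) [] T → AtLeft l [] (act (nothing , left) T)
    eraseLeft {T = tape _ _ _} (_ ∷ hl , hr) = popped hl , blank hr

    writeLeft : ∀ {r T} → AtLeft [] r T → AtLeft [] (a ∷ r) (act (just a , left) T)
    writeLeft {T = tape _ _ _} (blank hl , hr) = popped hl , a ∷ hr

  turnLeft : ∀ {l r T s} → s ≡ Tape.here T → AtRight l r T → AtLeft l r (act (s , left) T)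
  turnLeft {T = tape _ _ _} refl (hl , hr) = popped hl , hr

  turnRight : ∀ {r T} → AtLeft [] r T → AtRight [] r (act (nothing , right) T)
  turnRight {T = tape _ _ _} (blank hl , hr) = blank hl , popped hr

  allBlank : ∀ {T} → AtLeft [] [] T → AtRight [] [] (act (nothing , stay) T)
  allBlank {T = tape _ _ _} (blank hl , hr) = hl , blank hr

  scanRight : ∀ {l a r T} → AtRight l (a ∷ r) T → Tape.here T ≡ just a
  scanRight {T = tape _ _ _} (_ , _ ∷ _) = refl

  scanLeft : ∀ {a l r T} → AtLeft (a ∷ l) r T → Tape.here T ≡ just a
  scanLeft {T = tape _ _ _} (_ ∷ _ , _) = refl

  scanBlank : ∀ {r T} → AtLeft [] r T → Tape.here T ≡ nothing
  scanBlank {T = tape _ _ _} (blank _ , _) = refl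

  pattern inp = Fin.zero
  pattern out = Fin.suc Fin.zero
  pattern qry = Fin.suc (Fin.suc Fin.zero)
  pattern wrk i = Fin.suc (Fin.suc (Fin.suc i))
  pattern A = wrk Fin.zero
  pattern B = wrk (Fin.suc Fin.zero)
  pattern C = wrk (Fin.suc (Fin.suc Fin.zero))
  pattern D = wrk (Fin.suc (Fin.suc (Fin.suc Fin.zero)))

  -- The index counts all letters including the closing `#`, that is, the steps it takes to move the
  -- numeral.
  data Numeral : ℕ → String → Set where
    end   : Numeral 1 (# ∷ [])
    digit : ∀ {m b u} → Numeral m u → Numeral (suc m) (bit b ∷ u)

  -- copy p q moves a numeral from p to the right end of q, erasing it;
  -- back p q followed by drain p q moves all that is left of the head of p
  -- in front of the string on q.  The last argument is the next state.
  data Instruction (n : ℕ) : Set where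
    copy back drain : Fin 7 → Fin 7 → Fin n → Instruction n
    ask⟨_⟩          : Oracle → Fin n → Instruction n
    stop            : Instruction n

  onTwo : (p q : Fin 7) → Symbol × Move → Symbol × Move → Vec Symbol 7 → Vec (Symbol × Move) 7
  onTwo p q x y σ = Vec.map (_, stay) σ [ p ]≔ x [ q ]≔ y

  module _ {n : ℕ} where

    copyAct drainAct : Symbol → (p q : Fin 7) → Fin n → Fin n → Vec Symbol 7 → Action n 7
    copyAct (just (bit b)) p q s s′ σ =
      step s  (onTwo p q (nothing , right) (just (bit b) , right) σ)
    copyAct (just #) p q s s′ σ =
      step s′ (onTwo p q (nothing , right) (just # , right) σ)
    -- On a tape holding a numeral `#` comes before any blank; halting is an arbitrary value for
    -- other tapes.
    copyAct nothing p q s s′ σ = halt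

    drainAct (just a) p q s s′ σ = step s  (onTwo p q (nothing , left) (just a , left) σ)
    -- Every letter left the head of q one cell before its string; the final move to the right puts
    -- it on the first letter.
    drainAct nothing  p q s s′ σ = step s′ (onTwo p q (nothing , stay) (nothing , right) σ)

    execute : Instruction n → Fin n → Vec Symbol 7 → Action n 7
    execute (copy p q s′)   s σ = copyAct (lookup σ p) p q s s′ σ
    execute (back p q s′)   s σ = step s′ (onTwo p q (lookup σ p , left) (lookup σ q , left) σ)
    execute (drain p q s′)  s σ = drainAct (lookup σ p) p q s s′ σ
    execute (ask⟨ o ⟩ s′)   s σ = query o s′
    execute stop            s σ = halt

  machine : ∀ {n} → Vec (Instruction (suc n)) (suc n) → Machine
  machine {n} program = record
    { states    = suc n
    ; workTapes = 4
    ; start     = Fin.zero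
    ; δ         = λ s → execute (lookup program s) s
    }

  module Run {n} (program : Vec (Instruction (suc n)) (suc n)) (O : Oracle → String → String) where

    M : Machine
    M = machine program

    Config : Set
    Config = Vec (String × String) 7

    Shows : Config → Vec Tape 7 → Set
    Shows c τ = ∀ p → AtRight (proj₁ (lookup c p)) (proj₂ (lookup c p)) (lookup τ p)

    -- Quantified over all tapes showing c, since leftover blanks vary. The rules below chain such
    -- statements backwards from the halting state.
    record Finishes (s : Fin (suc n)) (c : Config) (t a b : ℕ) (y : String) : Set where
      constructor finishes
      field
        from : ∀ τ → Shows c τ → Halts M O s τ t a b y

    open Finishes

    config : (inp out qry a b c d : String) → Config
    config i o q a b c d =
      ([] , i) ∷ ([] , o) ∷ ([] , q) ∷ (a , []) ∷ (b , []) ∷ (c , []) ∷ (d , []) ∷ []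

    shows-initial : ∀ u → Shows (config u [] [] [] [] [] []) (initial M O u)
    shows-initial u inp = write-AtRight u
    shows-initial u out = write-AtRight []
    shows-initial u qry = write-AtRight []
    shows-initial u A = write-AtRight []
    shows-initial u B = write-AtRight []
    shows-initial u C = write-AtRight []
    shows-initial u D = write-AtRight []

    at-value : ∀ {z z′ T} → z ≡ z′ → AtRight (proj₁ z′) (proj₂ z′) T → AtRight (proj₁ z) (proj₂ z) T
    at-value refl h = h

    apply : Vec (Symbol × Move) 7 → Vec Tape 7 → Vec Tape 7
    apply = Vec.zipWith act

    here-lookup : ∀ (τ : Vec Tape 7) p → lookup (scan M O τ) p ≡ Tape.here (lookup τ p)
    here-lookup τ p = Vecₚ.lookup-map p Tape.here τ

    lookup-update : ∀ {S : Set} {x : S} xs {p q : Fin 7} → p ≢ q → lookup (xs [ q ]≔ x) p ≡ lookup xs p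
    lookup-update xs {p} {q} p≢q = Vecₚ.lookup∘update′ p≢q xs _

    module _ (p q : Fin 7) (p≢q : p ≢ q) (x y : Symbol × Move) (τ : Vec Tape 7) where
      private
        σ  = scan M O τ
        as = Vec.map (_, stay) σ
        τ′ = apply (onTwo p q x y σ) τ

      at-cell : ∀ r {z} → lookup (onTwo p q x y σ) r ≡ z → lookup τ′ r ≡ act z (lookup τ r)
      at-cell r eq = trans (Vecₚ.lookup-zipWith act r (onTwo p q x y σ) τ)
        (cong (λ z → act z (lookup τ r)) eq)

      at-fst : lookup τ′ p ≡ act x (lookup τ p)
      at-fst = at-cell p (trans (lookup-update (as [ p ]≔ x) p≢q) (Vecₚ.lookup∘update p as x))

      at-snd : lookup τ′ q ≡ act y (lookup τ q)
      at-snd = at-cell q (Vecₚ.lookup∘update q (as [ p ]≔ x) y)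

      at-rest : ∀ r → r ≢ p → r ≢ q → lookup τ′ r ≡ lookup τ r
      -- Writing back the scanned symbol and staying is the identity on tapes by η.
      at-rest r r≢p r≢q = at-cell r {Tape.here (lookup τ r) , stay} (trans (lookup-update (as [ p ]≔ x) r≢q)
        (trans (lookup-update as r≢p)
          (trans (Vecₚ.lookup-map r (_, stay) σ) (cong (_, stay) (here-lookup τ r)))))

    -- The invariant within an instruction: p and q are in the midst of a transfer, all other tapes
    -- are as in c.
    record Except (c : Config) (p q : Fin 7) (P Q : Tape → Set) (τ : Vec Tape 7) : Set where
      constructor except
      field
        on-fst  : P (lookup τ p)
        on-snd  : Q (lookup τ q)
        on-rest : ∀ r → r ≢ p → r ≢ q → AtRight (proj₁ (lookup c r)) (proj₂ (lookup c r)) (lookup τ r)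

    open Except

    module _ {c : Config} {p q : Fin 7} (p≢q : p ≢ q) where

      apply-except : ∀ {P Q P′ Q′ : Tape → Set} {x y τ} → Except c p q P Q τ →
        (P (lookup τ p) → P′ (act x (lookup τ p))) → (Q (lookup τ q) → Q′ (act y (lookup τ q))) →
        Except c p q P′ Q′ (apply (onTwo p q x y (scan M O τ)) τ)
      apply-except {P′ = P′} {Q′} {x} {y} {τ} (except hp hq hr) f g =
        except
          (subst P′ (sym (at-fst p q p≢q x y τ)) (f hp))
          (subst Q′ (sym (at-snd p q p≢q x y τ)) (g hq))
          (λ r r≢p r≢q → subst (AtRight _ _) (sym (at-rest p q p≢q x y τ r r≢p r≢q)) (hr r r≢p r≢q))

      except⇒shows : ∀ {l r l′ r′ τ} → Except c p q (AtRight l r) (AtRight l′ r′) τ →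
        Shows (c [ p ]≔ (l , r) [ q ]≔ (l′ , r′)) τ
      except⇒shows {l} {r} {l′} {r′} {τ} (except hp hq hr) s with s Fin.≟ q
      ... | yes refl = at-value (Vecₚ.lookup∘update q (c [ p ]≔ (l , r)) (l′ , r′)) hq
      ... | no s≢q with s Fin.≟ p
      ...   | yes refl = at-value
          (trans (lookup-update (c [ p ]≔ (l , r)) s≢q) (Vecₚ.lookup∘update p c (l , r))) hp
      ...   | no s≢p   = at-value
          (trans (lookup-update (c [ p ]≔ (l , r)) s≢q) (lookup-update c s≢p)) (hr s s≢p s≢q)

      shows⇒except : ∀ {l r l′ r′ τ} → lookup c p ≡ (l , r) → lookup c q ≡ (l′ , r′) → Shows c τ →
        Except c p q (AtRight l r) (AtRight l′ r′) τ
      shows⇒except {τ = τ} ep eq h = except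
        (subst (λ z → AtRight (proj₁ z) (proj₂ z) (lookup τ p)) ep (h p))
        (subst (λ z → AtRight (proj₁ z) (proj₂ z) (lookup τ q)) eq (h q))
        (λ r _ _ → h r)

    δ-at : ∀ {s i} → lookup program s ≡ i → ∀ τ →
           Machine.δ M s (scan M O τ) ≡ execute i s (scan M O τ)
    δ-at {s} eq τ = cong (λ i → execute i s (scan M O τ)) eq

    module _ {c : Config} {p q : Fin 7} {t a b : ℕ} {y : String} (p≢q : p ≢ q) where

      -- One step per letter, the last of them changing the state at `#`. Every letter ends up
      -- directly left of the head of q, hence the reversed append.
      copy-rule : ∀ {s s′ l r m u} → lookup program s ≡ copy p q s′ → Numeral m u →
        lookup c p ≡ ([] , u ++ r) → lookup c q ≡ (l , []) →
        Finishes s′ (c [ p ]≔ ([] , r) [ q ]≔ (u ʳ++ l , [])) t a b y →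
        Finishes s c (m + t) a b y
      copy-rule {s} {s′} {r = r} prog num ep eq next = finishes λ τ₀ h₀ →
        loop num τ₀ next (shows⇒except p≢q {τ = τ₀} ep eq h₀)
        where
        symbol : ∀ {x l r} τ → AtRight l (x ∷ r) (lookup τ p) →
                 Machine.δ M s (scan M O τ) ≡ copyAct (just x) p q s s′ (scan M O τ)
        symbol τ h = trans (δ-at prog τ)
          (cong (λ z → copyAct z p q s s′ (scan M O τ))
            (trans (here-lookup τ p) (scanRight h)))

        loop : ∀ {m u l} → Numeral m u → ∀ τ →
          Finishes s′ (c [ p ]≔ ([] , r) [ q ]≔ (u ʳ++ l , [])) t a b y →
          Except c p q (AtRight [] (u ++ r)) (AtRight l []) τ →
          Halts M O s τ (m + t) a b y
        loop end         τ next h = steps (symbol τ (on-fst h))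
          (from next _ (except⇒shows p≢q (apply-except p≢q h eraseRight writeRight)))
        loop (digit num) τ next h = steps (symbol τ (on-fst h))
          (loop num _ next (apply-except p≢q h eraseRight writeRight))

      -- Besides one step per letter there is one for `back` and one for noticing the blank at the
      -- left end. The transfer runs leftwards and so restores the reading order.
      flush-rule : ∀ {s s′ s″ l r r′ m} →
        lookup program s ≡ back p q s′ → lookup program s′ ≡ drain p q s″ →
        lookup c p ≡ (l , []) → lookup c q ≡ ([] , r) → l ʳ++ r ≡ r′ → length l ≡ m →
        Finishes s″ (c [ p ]≔ ([] , []) [ q ]≔ ([] , r′)) t a b y →
        Finishes s c (2 + m + t) a b y
      flush-rule {s} {s′} {s″} {l₀} {r₀} prog prog′ ep eq refl refl next = finishes λ τ₀ h₀ →
        steps (δ-at prog τ₀) (loop l₀ r₀ _ next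
          (apply-except p≢q (shows⇒except p≢q {τ = τ₀} ep eq h₀)
            (turnLeft (here-lookup τ₀ p)) (turnLeft (here-lookup τ₀ q))))
        where
        symbol : ∀ {x} τ → Tape.here (lookup τ p) ≡ x →
                 Machine.δ M s′ (scan M O τ) ≡ drainAct x p q s′ s″ (scan M O τ)
        symbol τ h = trans (δ-at prog′ τ)
          (cong (λ z → drainAct z p q s′ s″ (scan M O τ)) (trans (here-lookup τ p) h))

        loop : ∀ l r τ → Finishes s″ (c [ p ]≔ ([] , []) [ q ]≔ ([] , l ʳ++ r)) t a b y →
          Except c p q (AtLeft l []) (AtLeft [] r) τ → Halts M O s′ τ (suc (length l) + t) a b y
        loop []      r τ next h = steps (symbol τ (scanBlank (on-fst h)))
          (from next _ (except⇒shows p≢q (apply-except p≢q h allBlank turnRight)))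
        loop (x ∷ l) r τ next h = steps (symbol τ (scanLeft (on-fst h)))
          (loop l (x ∷ r) _ next (apply-except p≢q h eraseLeft writeLeft))

    asked : ∀ o c τ {l r ans} → lookup c qry ≡ (l , r) → O o r ≡ ans → Shows c τ →
            Shows (c [ qry ]≔ ([] , ans)) (ask M O o τ)
    asked o c (i ∷ u ∷ q ∷ w) {l} {r} {ans} eq refl h = go
      where
      r≡ : read q ≡ r
      r≡ = trans (read-AtRight (h qry)) (cong proj₂ eq)
      go : Shows (c [ qry ]≔ ([] , ans)) (i ∷ u ∷ write (O o (read q)) ∷ w)
      go inp     = at-value (lookup-update c {inp} (λ ())) (h inp)
      go out     = at-value (lookup-update c {out} (λ ())) (h out)
      go qry     = at-value (Vecₚ.lookup∘update qry c ([] , O o r))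
        (subst (λ z → AtRight [] (O o r) (write (O o z))) (sym r≡) (write-AtRight (O o r)))
      go (wrk p) = at-value (lookup-update c {wrk p} (λ ())) (h (wrk p))

    module _ {c : Config} {s s′ : Fin (suc n)} {t a b : ℕ} {y l r ans : String} (eq : lookup c qry ≡ (l , r)) where

      ask₁-rule : lookup program s ≡ ask⟨ oracle₁ ⟩ s′ → O oracle₁ r ≡ ans →
        Finishes s′ (c [ qry ]≔ ([] , ans)) t a b y → Finishes s c (suc t) (suc a) b y
      ask₁-rule prog e next = finishes λ τ h → asks₁ (δ-at prog τ) (from next _ (asked oracle₁ c τ eq e h))

      ask₂-rule : lookup program s ≡ ask⟨ oracle₂ ⟩ s′ → O oracle₂ r ≡ ans →
        Finishes s′ (c [ qry ]≔ ([] , ans)) t a b y → Finishes s c (suc t) a (suc b) y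
      ask₂-rule prog e next = finishes λ τ h → asks₂ (δ-at prog τ) (from next _ (asked oracle₂ c τ eq e h))

    stop-rule : ∀ {c s l y} → lookup program s ≡ stop → lookup c out ≡ (l , y) → Finishes s c 0 0 0 y
    stop-rule {c} {s} prog eq = finishes stopped
      where
      stopped : ∀ τ → Shows c τ → Halts M O s τ 0 0 0 _
      stopped (i ∷ u ∷ τ) h = subst (Halts M O s (i ∷ u ∷ τ) 0 0 0)
        (trans (read-AtRight (h out)) (cong proj₂ eq)) (halts (δ-at prog (i ∷ u ∷ τ)))

  -- A receives v k′ for the query to G₁ and then the answer w ℓ j′, B the
  -- queries k i and ℓ′ j to G₂, C the answer i′, and D the unused N₁ D₁ D₂.
  program : Vec (Instruction 27) 27
  program =
      copy  inp D     (at 1)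
    ∷ copy  inp D     (at 2)
    ∷ copy  inp D     (at 3)
    ∷ copy  inp A     (at 4)
    ∷ copy  inp B     (at 5)
    ∷ copy  inp B     (at 6)
    ∷ back  B   qry   (at 7)
    ∷ drain B   qry   (at 8)
    ∷ ask⟨ oracle₂ ⟩  (at 9)
    ∷ copy  qry A     (at 10)
    ∷ copy  qry C     (at 11)
    ∷ back  A   qry   (at 12)
    ∷ drain A   qry   (at 13)
    ∷ ask⟨ oracle₁ ⟩  (at 14)
    ∷ copy  qry A     (at 15)
    ∷ copy  qry B     (at 16)
    ∷ copy  inp B     (at 17)
    ∷ back  B   qry   (at 18)
    ∷ drain B   qry   (at 19)
    ∷ ask⟨ oracle₂ ⟩  (at 20)
    ∷ copy  qry A     (at 21)
    ∷ copy  qry A     (at 22)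
    ∷ back  C   out   (at 23)
    ∷ drain C   out   (at 24)
    ∷ back  A   out   (at 25)
    ∷ drain A   out   (at 26)
    ∷ stop
    ∷ []

  zigzagMachine : Machine
  zigzagMachine = machine program

  -- Numerals copied one after another are stored reversed left of the head; flushing reverses
  -- again, so the first copied comes first.
  stacked₂ : ∀ (x y : String) → (y ʳ++ (x ʳ++ [])) ʳ++ [] ≡ x ++ y
  stacked₂ x y = trans (Listₚ.ʳ++-ʳ++ y) (trans (Listₚ.ʳ++-ʳ++ x)
    (cong (x ++_) (Listₚ.++-identityʳ y)))

  stacked₃ : ∀ (x y z u : String) → (z ʳ++ (y ʳ++ (x ʳ++ []))) ʳ++ u ≡ x ++ y ++ z ++ u
  stacked₃ x y z u = trans (Listₚ.ʳ++-ʳ++ z) (trans (Listₚ.ʳ++-ʳ++ y) (Listₚ.ʳ++-ʳ++ x))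

  length-push : ∀ {m u} → Numeral m u → ∀ {s : String} {l} → length s ≡ l → length (u ʳ++ s) ≡ m + l
  length-push {u = u} num {s} refl = trans (Listₚ.length-ʳ++ u) (cong (_+ length s) (length-numeral num))
    where
    length-numeral : ∀ {m u} → Numeral m u → length u ≡ m
    length-numeral end         = refl
    length-numeral (digit num) = cong suc (length-numeral num)

  -- There are 1 + ⌊log₂ N⌋ digits and the `#`. The length does not depend on n, so N and all
  -- indices below it move in equal time.
  isNumeral : ∀ N n → Numeral (2 + ⌊log₂ N ⌋) (numeral N n)
  isNumeral N n = go (suc ⌊log₂ N ⌋) n
    where
    go : ∀ w n → Numeral (suc w) (bits w n ++ # ∷ [])
    go zero    n = end
    go (suc w) n = digit (go w (n ℕ./ 2))

  -- A symbolic run: only the lengths α, β, γ of numerals for N₁, D₁, D₂ and the three oracle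
  -- answers enter.
  module _ (O : Oracle → String → String) {α β γ : ℕ} {n₁ d₁ d₂ v k i j k′ i′ w ℓ′ ℓ j′ : String}
    (Nn₁ : Numeral α n₁) (Nd₁ : Numeral β d₁) (Nd₂ : Numeral γ d₂) (Nv : Numeral α v)
    (Nk : Numeral β k) (Ni : Numeral γ i) (Nj : Numeral γ j) (Nk′ : Numeral β k′) (Ni′ : Numeral γ i′)
    (Nw : Numeral α w) (Nℓ′ : Numeral β ℓ′) (Nℓ : Numeral β ℓ) (Nj′ : Numeral γ j′)
    (ask-ki  : O oracle₂ (k ++ i) ≡ k′ ++ i′)
    (ask-vk′ : O oracle₁ (v ++ k′) ≡ w ++ ℓ′)
    (ask-ℓ′j : O oracle₂ (ℓ′ ++ j) ≡ ℓ ++ j′) where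

    open Run program O

    private
      -- `copy-rule` splits off the rest of the tape even when it is empty.
      whole : ∀ u → _≡_ {A = String × String} ([] , u) ([] , u ++ [])
      whole u = cong ([] ,_) (sym (Listₚ.++-identityʳ u))

    module _ {t a b : ℕ} {y : String} where

      load : ∀ {rest} →
        Finishes (at 6) (config rest [] [] (v ʳ++ []) (i ʳ++ (k ʳ++ [])) [] (d₂ ʳ++ (d₁ ʳ++ (n₁ ʳ++ [])))) t a b y →
        Finishes (at 0) (config (n₁ ++ d₁ ++ d₂ ++ v ++ k ++ i ++ rest) [] [] [] [] [] [])
          (α + (β + (γ + (α + (β + (γ + t)))))) a b y
      load next =
        copy-rule (λ ()) refl Nn₁ refl refl
        (copy-rule (λ ()) refl Nd₁ refl refl
        (copy-rule (λ ()) refl Nd₂ refl refl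
        (copy-rule (λ ()) refl Nv refl refl
        (copy-rule (λ ()) refl Nk refl refl
        (copy-rule (λ ()) refl Ni refl refl next)))))

      query-ki : ∀ {r x d} →
        Finishes (at 11) (config r [] [] (k′ ʳ++ x) [] (i′ ʳ++ []) d) t a b y →
        Finishes (at 6) (config r [] [] x (i ʳ++ (k ʳ++ [])) [] d)
          (2 + (γ + (β + 0)) + (1 + (β + (γ + t)))) a (suc b) y
      query-ki next =
        flush-rule (λ ()) refl refl refl refl (stacked₂ k i) (length-push Ni (length-push Nk refl))
        (ask₂-rule refl refl ask-ki
        (copy-rule (λ ()) refl Nk′ refl refl
        (copy-rule (λ ()) {r = []} refl Ni′ (whole i′) refl next)))

      query-vk′ : ∀ {x d} →
        Finishes (at 17) (config [] [] [] (w ʳ++ []) (j ʳ++ (ℓ′ ʳ++ [])) x d) t a b y →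
        Finishes (at 11) (config (j ++ []) [] [] (k′ ʳ++ (v ʳ++ [])) [] x d)
          (2 + (β + (α + 0)) + (1 + (α + (β + (γ + t))))) (suc a) b y
      query-vk′ next =
        flush-rule (λ ()) refl refl refl refl (stacked₂ v k′) (length-push Nk′ (length-push Nv refl))
        (ask₁-rule refl refl ask-vk′
        (copy-rule (λ ()) refl Nw refl refl
        (copy-rule (λ ()) {r = []} refl Nℓ′ (whole ℓ′) refl
        (copy-rule (λ ()) {r = []} refl Nj refl refl next))))

      query-ℓ′j : ∀ {x u d} →
        Finishes (at 22) (config [] [] [] (j′ ʳ++ (ℓ ʳ++ u)) [] x d) t a b y →
        Finishes (at 17) (config [] [] [] u (j ʳ++ (ℓ′ ʳ++ [])) x d)
          (2 + (γ + (β + 0)) + (1 + (β + (γ + t)))) a (suc b) y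
      query-ℓ′j next =
        flush-rule (λ ()) refl refl refl refl (stacked₂ ℓ′ j) (length-push Nj (length-push Nℓ′ refl))
        (ask₂-rule refl refl ask-ℓ′j
        (copy-rule (λ ()) refl Nℓ refl refl
        (copy-rule (λ ()) {r = []} refl Nj′ (whole j′) refl next)))

    deliver : ∀ {d} →
      Finishes (at 22) (config [] [] [] (j′ ʳ++ (ℓ ʳ++ (w ʳ++ []))) [] (i′ ʳ++ []) d)
        (2 + (γ + 0) + (2 + (γ + (β + (α + 0))) + 0)) 0 0
        (w ++ ℓ ++ j′ ++ i′ ++ [])
    deliver =
      flush-rule (λ ()) refl refl refl refl (Listₚ.ʳ++-ʳ++ i′) (length-push Ni′ refl)
      (flush-rule (λ ()) refl refl refl refl (stacked₃ w ℓ j′ _)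
        (length-push Nj′ (length-push Nℓ (length-push Nw refl)))
      (stop-rule refl refl))

    run : Finishes (at 0) (config (n₁ ++ d₁ ++ d₂ ++ v ++ k ++ i ++ j ++ []) [] [] [] [] [] []) _ 1 2
      (w ++ ℓ ++ j′ ++ i′ ++ [])
    run = load (query-ki (query-vk′ (query-ℓ′j deliver)))

  -- Numerals for N₁ are moved 5 times, those for D₁ and for D₂ 9 times each, at 2 + ⌊log₂ _⌋ steps
  -- a move. The constant is 2 for each of these 23 moves, 2 for each of five flushes and 1 for each
  -- of three queries.
  timeBound : Polynomial 3
  timeBound = con 59 :+ ((con 5 :* var (at 0)) :+ ((con 9 :* var (at 1)) :+ (con 9 :* var (at 2))))

  runningTime : ∀ a b c →
    (2 + a) + ((2 + b) + ((2 + c) + ((2 + a) + ((2 + b) + ((2 + c) + (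
    2 + ((2 + c) + ((2 + b) + 0)) + (1 + ((2 + b) + ((2 + c) + (
    2 + ((2 + b) + ((2 + a) + 0)) + (1 + ((2 + a) + ((2 + b) + ((2 + c) + (
    2 + ((2 + c) + ((2 + b) + 0)) + (1 + ((2 + b) + ((2 + c) + (
    2 + ((2 + c) + 0) + (2 + ((2 + c) + ((2 + b) + ((2 + a) + 0))) + 0))))))))))))))))))))
    ≡ 59 + (5 ℕ.* a + (9 ℕ.* b + 9 ℕ.* c))
  runningTime = solve-∀

  zigzagMachine-correct : ComputesZigzag zigzagMachine timeBound
  zigzagMachine-correct N₁ D₁ D₂ G₁ G₂ O O₁ O₂ ((v , k) , (i , j)) =
    _ , ℕₚ.≤-reflexive (runningTime ⌊log₂ N₁ ⌋ ⌊log₂ D₁ ⌋ ⌊log₂ D₂ ⌋) ,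
    reformat
      (cong (λ z → numeral N₁ N₁ ++ numeral D₁ D₁ ++ numeral D₂ D₂ ++ z)
        (regroup (vertex v) (vertex k) (vertex i) (vertex j)))
      (regroup (vertex w) (vertex ℓ) (vertex j′) (vertex i′))
      (Finishes.from
        (run O (isNumeral N₁ N₁) (isNumeral D₁ D₁) (isNumeral D₂ D₂)
          (isNumeral N₁ (toℕ v)) (isNumeral D₁ (toℕ k)) (isNumeral D₂ (toℕ i)) (isNumeral D₂ (toℕ j))
          (isNumeral D₁ (toℕ k′)) (isNumeral D₂ (toℕ i′)) (isNumeral N₁ (toℕ w)) (isNumeral D₁ (toℕ ℓ′))
          (isNumeral D₁ (toℕ ℓ)) (isNumeral D₂ (toℕ j′)) (O₂ (k , i)) (O₁ (v , k′)) (O₂ (ℓ′ , j)))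
        _ (Run.shows-initial program O _))
    where
    open Run program O using (Finishes)
    reformat : ∀ {x x′ y y′ t} → x ≡ x′ → y ≡ y′ →
      Halts zigzagMachine O Fin.zero (initial zigzagMachine O x) t 1 2 y →
      Halts zigzagMachine O Fin.zero (initial zigzagMachine O x′) t 1 2 y′
    reformat refl refl h = h
    k′ = proj₁ (rot G₂ (k , i))
    i′ = proj₂ (rot G₂ (k , i))
    w  = proj₁ (rot G₁ (v , k′))
    ℓ′ = proj₂ (rot G₁ (v , k′))
    ℓ  = proj₁ (rot G₂ (ℓ′ , j))
    j′ = proj₂ (rot G₂ (ℓ′ , j))
    regroup : ∀ (x y z u : String) → x ++ y ++ z ++ u ++ [] ≡ (x ++ y) ++ (z ++ u)
    regroup x y z u = trans (cong (λ s → x ++ y ++ z ++ s) (Listₚ.++-identityʳ u))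
      (sym (Listₚ.++-assoc x y (z ++ u)))

-- The theorem for the Cauchy reals

open import Defs

open RealNumbers using (orderedAlgebra; ≤-pointwise; below-1)

bound : ℝ → ℝ → ℝ
bound = Bound.zigzagBound orderedAlgebra

bound-cong : ∀ x y u v → x ≈ u → y ≈ v → bound x y ≈ bound u v
bound-cong x y u v = Bound.zigzagBound-cong orderedAlgebra {x} {y} {u} {v}

bound-≤ : ∀ x y → bound x y ≤ x + y + y * y
bound-≤ x y = ≤-pointwise (bound x y) (x + y + y * y)
  (λ n → ℚₚ.p⊓q≤p (seq x n ℚ.+ seq y n ℚ.+ seq y n ℚ.* seq y n) _)

bound-<1 : ∀ x y → x < 1ℝ → y < 1ℝ → bound x y < 1ℝ
bound-<1 x y (e , 0<e , N , x+e≤1) (d , 0<d , N′ , y+d≤1) =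
  -- The bound is at most 1 - g²(1 - x), where g ≥ d and 1 - x ≥ e.
  d ℚ.* d ℚ.* e , Q.*-pos (Q.*-pos 0<d 0<d) 0<e , N ℕ.⊔ N′ , λ n N⊔N′≤n →
    below-1 (seq x n ℚ.+ seq y n ℚ.+ seq y n ℚ.* seq y n) (seq x n) (seq y n) (ℚₚ.<⇒≤ 0<d) (ℚₚ.<⇒≤ 0<e)
      (x+e≤1 n (ℕₚ.m⊔n≤o⇒m≤o N N′ N⊔N′≤n)) (y+d≤1 n (ℕₚ.m⊔n≤o⇒n≤o N N′ N⊔N′≤n))

bound-nonNeg : ∀ x y → 0ℝ ≤ x → 0ℝ ≤ y → 0ℝ ≤ bound x y
bound-nonNeg x y = Bound.zigzagBound-nonNeg orderedAlgebra {x} {y}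

bound-zigzag : ∀ x y → 0ℝ ≤ x → 0ℝ ≤ y → (V K L : FinSet) (G₁ : Graph V K) (G₂ : Graph K L) →
  λ[_]≤_ {V} {K} G₁ x → λ[_]≤_ {K} {L} G₂ y →
  λ[_]≤_ {V ⊗ K} {L ⊗ L} (_ⓩ_ {V} {K} {L} G₁ G₂) (bound x y)
bound-zigzag x y 0≤x 0≤y V K L G₁ G₂ (_ , H₁) (_ , H₂) = bound-nonNeg x y 0≤x 0≤y ,
  Norms.zigzag-normBound orderedAlgebra (λ V → ‖_‖ {V}) (λ V α → ⟪_,_⟫ {V} α (λ _ → 1ℝ))
    (λ V L → _·_ {V} {L}) RealNorms.norm≈ RealNorms.total≈ RealNorms.image≈
    {x} {y} 0≤x 0≤y V K L G₁ G₂ H₁ H₂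

theorem3p2 : (∃ λ (f : ℝ≥0 → ℝ≥0 → ℝ) →
    (∀ λ₁ λ₂ μ₁ μ₂ → ⟨ λ₁ ⟩ ≈ ⟨ μ₁ ⟩ → ⟨ λ₂ ⟩ ≈ ⟨ μ₂ ⟩ → f λ₁ λ₂ ≈ f μ₁ μ₂)
    × (∀ λ₁ λ₂ → f λ₁ λ₂ ≤ ⟨ λ₁ ⟩ + ⟨ λ₂ ⟩ + ⟨ λ₂ ⟩ * ⟨ λ₂ ⟩)
    × (∀ λ₁ λ₂ → ⟨ λ₁ ⟩ < 1ℝ → ⟨ λ₂ ⟩ < 1ℝ → f λ₁ λ₂ < 1ℝ)
    × (∀ (N₁ D₁ D₂ : ℕ) {{_ : NonZero N₁}} {{_ : NonZero D₁}} {{_ : NonZero D₂}}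
    (λ₁ λ₂ : ℝ≥0) (G₁ : Graph [1⋯ N₁ ] [1⋯ D₁ ]) (G₂ : Graph [1⋯ D₁ ] [1⋯ D₂ ]) →
    G₁ is⟨ N₁ , D₁ , ⟨ λ₁ ⟩ ⟩-graph →
    G₂ is⟨ D₁ , D₂ , ⟨ λ₂ ⟩ ⟩-graph →
    (G₁ ⓩ G₂) is⟨ N₁ ℕ.* D₁ , D₂ ℕ.^ 2 , f λ₁ λ₂ ⟩-graph))
    × (∃ λ (M : Machine) → ∃ λ (p : Polynomial 3) → ComputesZigzag M p)
theorem3p2 =
  ( (λ λ₁ λ₂ → bound ⟨ λ₁ ⟩ ⟨ λ₂ ⟩)
  , (λ λ₁ λ₂ μ₁ μ₂ → bound-cong ⟨ λ₁ ⟩ ⟨ λ₂ ⟩ ⟨ μ₁ ⟩ ⟨ μ₂ ⟩)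
  , (λ λ₁ λ₂ → bound-≤ ⟨ λ₁ ⟩ ⟨ λ₂ ⟩)
  , (λ λ₁ λ₂ → bound-<1 ⟨ λ₁ ⟩ ⟨ λ₂ ⟩)
  , (λ N₁ D₁ D₂ λ₁ λ₂ G₁ G₂ (_ , _ , H₁) (_ , _ , H₂) →
       -- `D₂ ℕ.^ 2` unfolds to `D₂ ℕ.* (D₂ ℕ.* 1)`.
       ≡.refl , ≡.cong (D₂ ℕ.*_) (≡.sym (ℕₚ.*-identityʳ D₂)) ,
       bound-zigzag ⟨ λ₁ ⟩ ⟨ λ₂ ⟩ (proj₂ λ₁) (proj₂ λ₂) [1⋯ N₁ ] [1⋯ D₁ ] [1⋯ D₂ ] G₁ G₂ H₁ H₂))
  , TuringMachine.zigzagMachine , TuringMachine.timeBound , TuringMachine.zigzagMachine-correct
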